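{- There is no $2$-analog of a $(9,3,1)$-design that is cyclic, i.e. no $2$-analog of a $(9,3,1)$-design admits an automorphism (a collineation of $\mathrm{PG}(8,2)$ mapping blocks to blocks) that cyclically permutes all $511$ of its points.
   Context: A $(v,k,1)$-design is a pair $(V,\mathcal{B})$ with $V$ a $v$-set and $\mathcal{B}$ a collection of $k$-subsets such that every pair of distinct points lies in exactly one block. A $2$-analog of a $(9,3,1)$-design is a $(511,7,1)$-design whose point set is the point set of the projective space $\mathrm{PG}(8,2)$ (equivalently, the nonzero vectors of $\mathbb{F}_2^9$) and whose blocks are projective planes of $\mathrm{PG}(8,2)$ (i.e. the sets of nonzero vectors of $3$-dimensional subspaces of $\mathbb{F}_2^9$); thus every $2$-dimensional subspace of $\mathbb{F}_2^9$ lies in exactly one block. Automorphisms of such a $2$-analog are taken to be elements of $\mathrm{PGL}(9,2)$ leaving the set of blocks invariant; the design is cyclic if some automorphism permutes all points in a single cycle of length $511$. -}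

module Defs where

open import Data.Bool using (Bool; true; false; _xor_; _∧_)
open import Data.Nat using (ℕ; zero; suc; _<_)
open import Data.Fin using (Fin)
open import Data.Vec using (Vec; replicate; zipWith; map; foldr)
open import Data.Product using (Σ; ∃; ∃-syntax; _×_; _,_)
open import Relation.Binary.PropositionalEquality using (_≡_; _≢_)

-- The field F₂ is Bool with xor as addition and ∧ as multiplication.
-- V = F₂^9, vectors as Vec Bool 9.
V : Set
V = Vec Bool 9

0v : V
0v = replicate 9 false

_⊕_ : V → V → V
_⊕_ = zipWith _xor_

_·_ : Bool → V → V
a · x = map (a ∧_) x

-- Points of PG(8,2): nonzero vectors of F₂^9.
IsPoint : V → Set
IsPoint x = x ≢ 0v

-- A block is presented by an (ordered) basis (u , v , w) of a 3-dim subspace.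
Triple : Set
Triple = V × V × V

_∈span_ : V → Triple → Set
x ∈span (u , v , w) = ∃[ a ] ∃[ b ] ∃[ c ] x ≡ ((a · u) ⊕ (b · v)) ⊕ (c · w)

LinIndep3 : Triple → Set
LinIndep3 (u , v , w) =
  ∀ a b c → ((a · u) ⊕ (b · v)) ⊕ (c · w) ≡ 0v → (a ≡ false) × (b ≡ false) × (c ≡ false)

SameSpan : Triple → Triple → Set
SameSpan t s = (∀ x → x ∈span t → x ∈span s) × (∀ x → x ∈span s → x ∈span t)

Is2Analog931 : (n : ℕ) → (Fin n → Triple) → Set
Is2Analog931 n B =
  (∀ i → LinIndep3 (B i)) ×
  (∀ x y → IsPoint x → IsPoint y → x ≢ y →
     Σ (Fin n) λ i → (x ∈span B i) × (y ∈span B i) ×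
       (∀ j → x ∈span B j → y ∈span B j → j ≡ i))

Matrix : Set
Matrix = Vec V 9

dot : V → V → Bool
dot r x = foldr (λ _ → Bool) _xor_ false (zipWith _∧_ r x)

apply : Matrix → V → V
apply M x = map (λ r → dot r x) M

applyPow : ℕ → Matrix → V → V
applyPow zero    M x = x
applyPow (suc k) M x = apply M (applyPow k M x)

-- g ∈ GL(9,2) = PGL(9,2)
Invertible : Matrix → Set
Invertible M = ∃[ N ] (∀ x → apply N (apply M x) ≡ x) × (∀ x → apply M (apply N x) ≡ x)

applyT : Matrix → Triple → Triple
applyT M (u , v , w) = apply M u , apply M v , apply M w

IsAutomorphism : (n : ℕ) → (Fin n → Triple) → Matrix → Set
IsAutomorphism n B g =
  Invertible g × (∀ i → ∃[ j ] SameSpan (applyT g (B i)) (B j))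

IsSingleCycle : Matrix → Set
IsSingleCycle g = ∀ x y → IsPoint x → IsPoint y → ∃[ k ] (k < 511) × (applyPow k g x ≡ y)

{-# OPTIONS --safe #-}
module Submission where

-- A single cycle identifies the points with the exponents modulo 511 of a root of x⁹ + x⁴ + 1, and
-- collineations commute with it, so blocks become translation-invariant 7-sets of exponents.  Under
-- translation the lines of PG(8,2) fall into 84 orbits of length 511 and one orbit of length 73 (the
-- lines of the multiplicative cosets of F₈).  Since 7 does not divide 85, some block is a coset of F₈*,
-- and every other orbit of blocks contains exactly seven of the 84 remaining orbits of lines.  So a
-- cyclic design is an exact cover of 84 items by explicitly known 7-sets, on which the Frobenius map acts
-- with order 9.  An exhaustive search, with one root for each orbit of 7-sets and previous roots excluded,
-- refutes all 39 cases.
-- The search stores sets of 7-sets as integers: each 7-set Q gets its own prime p(Q), and a number X(P) is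
-- 1 modulo p(Q) when P and Q are disjoint or equal and, up to harmless exceptions, 0 otherwise.  Then the
-- product of the X(P) over the chosen P is nonzero modulo p(Q) exactly if Q is still available, and an
-- item is dead when that product vanishes modulo the product of the primes of all 7-sets through it.

open import Defs
open import Data.Nat using (ℕ)
open import Data.Fin using (Fin)
open import Data.Product using (Σ; _×_)
open import Relation.Nullary using (¬_)

-- The search is carried out by evaluation, where arithmetic on large naturals is the one cheap
-- operation; hence sets of 7-sets become integers. Soundness rests on a single congruence: two
-- 7-sets `P`, `Q` of one solution are equal or disjoint, so X(P) is 1 modulo p(Q), and this
-- survives products and reductions. A vanishing residue therefore only discards 7-sets outside the
-- solution. No translation fixes a line, since 3 does not divide 511. So all 85 line orbits,
-- including that of the lines inside cosets of F₈*, have length 511; it is the cosets themselves,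
-- as blocks, that form an orbit of length 73. A block sharing two points with a translate of itself
-- equals that translate, which rules out the planes with repeated differences other than those
-- cosets. Frobenius permutes the line orbits in nine cycles of length 9, the cycle 81, 82, 83 and
-- the fixed orbit 84. Some 7-set covers 81, and those meeting the short cycle form only 39
-- Frobenius orbits: these are the cases. A whole orbit can be excluded at once because a solution
-- using a rotated 7-set becomes, after the Frobenius map, a solution of another design using the
-- representative.

module Search where

  open import Agda.Builtin.Nat using (mod-helper)
  open import Data.Bool using (Bool; true; false; _∧_; _∨_; if_then_else_)
  open import Data.Nat
  open import Data.Nat.Properties
  open import Data.Nat.DivMod
  open import Data.Nat.Divisibility
  open import Data.List using (List; []; _∷_; take)
  open import Data.List.Relation.Unary.All using (All; []; _∷_)
  open import Data.Product using (_×_; _,_; proj₁; proj₂)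
  open import Data.Sum using (_⊎_; inj₁; inj₂)
  open import Data.Empty using (⊥; ⊥-elim)
  open import Function using (_∘_)
  open import Relation.Binary.PropositionalEquality

  -- Exact cover search in integer arithmetic.

  data Options : Set where
    []  : Options
    opt : (p x : ℕ) → Options → Options

  -- Moduli are stored as predecessors, the form `mod-helper` expects. In `opt p x` the prime of the
  -- 7-set is `suc p` and `x` is its number X; in `item m n os`, `suc m` is the product of the
  -- primes and `n` the sum of the numbers `x`.
  data Item : Set where
    item : (m n : ℕ) → Options → Item

  data Ranked : Set where
    ranked : ℕ → Item → Ranked

  compatible : ℕ → Options → Options
  compatible′ : ℕ → (p x : ℕ) → Options → ℕ → Options
  compatible a [] = []
  compatible a (opt p x os) = compatible′ (mod-helper 0 p a p) p x os a
  compatible′ zero    _ _ []           a = []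
  compatible′ zero    _ _ (opt p x os) a = compatible′ (mod-helper 0 p a p) p x os a
  compatible′ (suc _) p x os           a = opt p x (compatible a os)

  -- One reduction modulo the product of the item's primes keeps every residue that matters, and the
  -- tests of the single options then act on a short number.
  remaining : ℕ → ℕ → Options → Options
  remaining a m os = compatible (mod-helper 0 m a m) os

  product : Options → ℕ
  product []           = 1
  product (opt p x os) = suc p * product os

  total : Options → ℕ
  total []           = 0
  total (opt p x os) = x + total os

  elem : ℕ → List ℕ → Bool
  elem p []       = false
  elem p (q ∷ qs) = (p ≡ᵇ q) ∨ elem p qs

  -- A chosen 7-set stays compatible with itself, so an item that it covers survives as a singleton;
  -- such an item must be recognised and not branched on.
  chosen : Options → List ℕ → Bool
  chosen (opt p x []) ps = elem p ps
  chosen _            ps = false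

  dead : ℕ → ℕ → List Item → Bool
  dead zero    a is                = true
  dead (suc _) a []                = false
  dead (suc _) a (item m _ _ ∷ is) = dead (mod-helper 0 m a m) a is

  visit  : (a M : ℕ) → List Item → List ℕ → Bool
  branch : (a M : ℕ) → List Item → List ℕ → Bool
  branch′ : Options → (a M : ℕ) → List Item → List ℕ → Bool
  tryAll : Options → (a M : ℕ) → List Item → List ℕ → Bool
  -- The 1 is a dummy nonzero residue, in force before the first item has been tested.
  visit a M is ps = dead 1 a is ∨ branch a M is ps
  branch a M []                 ps = false
  branch a M (item m _ os ∷ is) ps = branch′ (remaining a m os) a M is ps
  branch′ os a M is ps = if chosen os ps then branch a M is ps else tryAll os a M is ps
  tryAll []           a M is ps = true
  tryAll (opt p x os) a M is ps =
    visit (mod-helper 0 M (a * x) M) M is (p ∷ ps) ∧ tryAll os a M is ps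

  insert  : ℕ → Item → List Ranked → List Ranked
  insert′ : Bool → ℕ → Item → ℕ → Item → List Ranked → List Ranked
  insert k i []                = ranked k i ∷ []
  insert k i (ranked l j ∷ rs) = insert′ (k <ᵇ l) k i l j rs
  insert′ true  k i l j rs = ranked k i ∷ ranked l j ∷ rs
  insert′ false k i l j rs = ranked l j ∷ insert k i rs

  covered : ℕ → (x p : ℕ) → Options → Bool
  covered 1 x p os = chosen (compatible x os) (p ∷ [])
  covered _ x p os = false

  -- Modulo the prime of a 7-set P, each summand of `n` is 1 or 0 according to its compatibility
  -- with P. One division thus counts the options left after choosing P, as long as the count is
  -- below the prime. The count only orders the items; an item is dropped after an exact test by
  -- `covered`.
  rank  : (x p : ℕ) → List Item → List Ranked
  rank′ : ℕ → (x p : ℕ) → Item → List Item → List Ranked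
  rank x p []                  = []
  rank x p (item m n os ∷ is)  = rank′ (mod-helper 0 p n p) x p (item m n os) is
  rank′ k x p (item m n os) is =
    if covered k x p os then rank x p is else insert k (item m n os) (rank x p is)

  build : Options → Item
  build os = item (pred (product os)) (total os) os

  restrict : ℕ → List Ranked → List Item
  restrict x []                           = []
  restrict x (ranked _ (item m _ os) ∷ rs) = build (remaining x m os) ∷ restrict x rs

  absorb  : ℕ → Options → ℕ
  absorb′ : ℕ → ℕ → ℕ → Options → ℕ
  absorb M []           = M
  absorb M (opt p _ os) = absorb′ (mod-helper 0 p M p) M p os
  absorb′ zero    M p os = absorb M os
  absorb′ (suc _) M p os = absorb (suc p * M) os

  modulus : ℕ → List Item → ℕ
  modulus M []                 = M
  modulus M (item _ _ os ∷ is) = modulus (absorb M os) is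

  reduceOptions : ℕ → Options → Options
  reduceOptions M []           = []
  reduceOptions M (opt p x os) = opt p (mod-helper 0 M x M) (reduceOptions M os)

  -- Only the primes of the surviving options matter from here on, so every number shrinks to its
  -- residue modulo their product.
  reduce : ℕ → List Item → List Item
  reduce M []                 = []
  reduce M (item m n os ∷ is) = item m n (reduceOptions M os) ∷ reduce M is

  -- A single surviving option is mostly the 7-set just chosen, which makes the item useless for
  -- branching.
  weight : ℕ → ℕ
  weight 1 = 1000
  weight k = k

  swap : Item → List Item → List Item
  swap i []       = i ∷ []
  swap i (j ∷ is) = j ∷ i ∷ is

  -- Brings the lightest of the first `suc l` items, the current best `i` included, to the front.
  promote  : ℕ → ℕ → ℕ → Item → List Item → List Item
  promote′ : ℕ → ℕ → ℕ → ℕ → Item → Item → List Item → List Item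
  promote zero    p k i is                 = i ∷ is
  promote (suc l) p k i []                 = i ∷ []
  promote (suc l) p k i (item m n os ∷ is) =
    promote′ (weight (mod-helper 0 p n p)) l p k i (item m n os) is
  promote′ k′ l p k i j is =
    if k′ <ᵇ k then swap i (promote l p k′ j is) else swap j (promote l p k i is)

  leaf : (M x p : ℕ) → List Item → Bool
  leaf M x p []                 = false
  leaf M x p (item m _ os ∷ is) = tryAll (remaining x m os) x M is (p ∷ [])

  leaf′ : (M x p : ℕ) → List Item → Bool
  leaf′ M x p []                 = false
  leaf′ M x p (item m n os ∷ is) =
    leaf M x p (promote 5 p (weight (mod-helper 0 p n p)) (item m n os) is)

  -- Each number in the list stands for one level at which items are filtered and rebuilt with a
  -- smaller modulus. Below the last level the search runs on with fixed items and a fixed modulus,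
  -- as rebuilding costs more than it saves there.
  descend : List ℕ → ℕ → Options → List Item → Bool
  step    : List ℕ → (M x p : ℕ) → List Item → Bool
  step₁   : ℕ → List ℕ → ℕ → List Ranked → Bool
  step₂   : List ℕ → List Item → Bool
  step₃   : List ℕ → ℕ → List Item → Bool
  step₄   : List ℕ → ℕ → List Item → Bool
  descend ks M []           is = true
  descend ks M (opt p x os) is = step ks M x p is ∧ descend ks M os is
  step []       M x p is = leaf′ M x p is
  step (k ∷ ks) M x p is = step₁ k ks x (rank x p is)
  -- A contradiction among the `k` most constrained items is already a contradiction, and it
  -- involves fewer primes; all items are used only if this attempt fails.
  step₁ k ks x rs = step₂ ks (restrict x (take k rs)) ∨ step₂ ks (restrict x rs)
  step₂ ks is = step₃ ks (pred (modulus 1 is)) is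
  step₃ ks M is = step₄ ks M (reduce M is)
  step₄ ks M []                 = false
  step₄ ks M (item m _ os ∷ is) = descend ks M os is

  -- Soundness of the search.

  Good : (ℕ → Set) → ℕ → Set
  Good P x = ∀ {q} → P q → x % suc q ≡ 1

  -- Here `P` holds the primes, minus one, of a hypothetical solution. The invariant of the whole
  -- search is that each item keeps an option of the solution whose number is 1 modulo every prime
  -- of the solution.
  data Live (P : ℕ → Set) (m : ℕ) : Options → Set where
    here  : ∀ {p x os} → P p → Good P x → suc p ∣ suc m → Live P m (opt p x os)
    there : ∀ {p x os} → Live P m os → Live P m (opt p x os)

  Solvable : (ℕ → Set) → Item → Set
  Solvable P (item m n os) = Live P m os

  ∧-true : ∀ {a b} → a ∧ b ≡ true → a ≡ true × b ≡ true
  ∧-true {true} e = refl , e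

  ∨-true : ∀ {a b} → a ∨ b ≡ true → a ≡ true ⊎ b ≡ true
  ∨-true {true}  e = inj₁ refl
  ∨-true {false} e = inj₂ e

  -- A residue 1 excludes the modulus 1, for which `1 % suc p` would be 0.
  1%p≡1 : ∀ p x → x % suc p ≡ 1 → 1 % suc p ≡ 1
  1%p≡1 p x e = trans (cong (_% suc p) (sym e)) (trans (m%n%n≡m%n x (suc p)) e)

  good-* : ∀ {P a x} → Good P a → Good P x → Good P (a * x)
  good-* {P} {a} {x} ga gx {q} pq = begin
    (a * x) % suc q                       ≡⟨ %-distribˡ-* a x (suc q) ⟩
    ((a % suc q) * (x % suc q)) % suc q   ≡⟨ cong₂ (λ u v → (u * v) % suc q) (ga pq) (gx pq) ⟩
    1 % suc q                             ≡⟨ 1%p≡1 q x (gx pq) ⟩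
    1                                     ∎
    where open ≡-Reasoning

  Divides : (ℕ → Set) → ℕ → Set
  Divides P M = ∀ {q} → P q → suc q ∣ suc M

  good-% : ∀ {P M x} → Divides P M → Good P x → Good P (mod-helper 0 M x M)
  good-% {P} {M} {x} d g {q} pq = trans (m∣n⇒o%n%m≡o%m (suc q) (suc M) x (d pq)) (g pq)

  module _ {P : ℕ → Set} where

    live-remaining : ∀ a {m os} → Good P a → Live P m os → Live P m (remaining a m os)
    live-remaining a {m} {os} g l = go os l
      where
        -- only the residues modulo divisors of suc m are known for the reduced argument
        b = mod-helper 0 m a m
        go : ∀ os → Live P m os → Live P m (compatible b os)
        go′ : ∀ p x os → Live P m (opt p x os) → ∀ r → r ≡ b % suc p → Live P m (compatible′ r p x os b)
        go (opt p x os) l = go′ p x os l _ refl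
        go′ p x os (here pp gx d) zero e
          with trans e (trans (m∣n⇒o%n%m≡o%m (suc p) (suc m) a d) (g pp))
        ... | ()
        go′ p x (opt p′ x′ os) (there l) zero e = go′ p′ x′ os l _ refl
        go′ p x os (here pp gx d) (suc r) e = here pp gx d
        go′ p x os (there l) (suc r) e = there (go os l)

    dead-sound : ∀ {a is} r → dead r a is ≡ true → r ≢ 0 → Good P a → All (Solvable P) is → ⊥
    dead-sound zero e r≢0 g s = r≢0 refl
    dead-sound {a} {item m n os ∷ is} (suc r) e _ g (l ∷ s) =
      dead-sound (a % suc m) e (nonzero l) g s
      where
        nonzero : ∀ {os} → Live P m os → a % suc m ≢ 0
        nonzero (there l) z = nonzero l z
        nonzero (here {p} pp gx d) z with trans (sym (g pp)) (n∣m⇒m%n≡0 a (suc p) (∣-trans d (m%n≡0⇒n∣m a (suc m) z)))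
        ... | ()

    module _ {M : ℕ} (d : Divides P M) where
      -- The running product is reduced modulo `suc M` at each choice; the assumption `d` that all
      -- primes of the solution divide `suc M` keeps its residues at 1.
      visit-sound : ∀ {a} is {ps} → visit a M is ps ≡ true → Good P a → All (Solvable P) is → ⊥
      branch-sound : ∀ {a} is {ps} → branch a M is ps ≡ true → Good P a → All (Solvable P) is → ⊥
      branch′-sound : ∀ {m} os {a is ps} → branch′ os a M is ps ≡ true → Live P m os → Good P a →
        All (Solvable P) is → ⊥
      tryAll-sound : ∀ {m} os {a is ps} → tryAll os a M is ps ≡ true → Live P m os → Good P a →
        All (Solvable P) is → ⊥
      visit-sound {a} is e g s with ∨-true {dead 1 a is} e
      ... | inj₁ e′ = dead-sound {is = is} 1 e′ (λ ()) g s
      ... | inj₂ e′ = branch-sound is e′ g s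
      branch-sound {a} (item m n os ∷ is) e g (l ∷ s) =
        branch′-sound (remaining a m os) e (live-remaining a g l) g s
      branch′-sound os {is = is} {ps} e l g s with chosen os ps
      ... | true  = branch-sound is e g s
      ... | false = tryAll-sound os e l g s
      tryAll-sound (opt p x os) {a} {is} e (here pp gx _) g s =
        visit-sound is (proj₁ (∧-true e)) (good-% {x = a * x} d (good-* {a = a} {x} g gx)) s
      tryAll-sound (opt p x os) {a} {is} {ps} e (there l) g s =
        tryAll-sound os (proj₂ (∧-true {visit (mod-helper 0 M (a * x) M) M is (p ∷ ps)} e)) l g s

    SolvableR : Ranked → Set
    SolvableR (ranked k i) = Solvable P i

    insert-all : ∀ k i rs → Solvable P i → All SolvableR rs → All SolvableR (insert k i rs)
    insert-all k i [] s [] = s ∷ []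
    insert-all k i (ranked l j ∷ rs) s (t ∷ ts) with k <ᵇ l
    ... | true  = s ∷ t ∷ ts
    ... | false = t ∷ insert-all k i rs s ts

    rank-all : ∀ x p is → All (Solvable P) is → All SolvableR (rank x p is)
    rank-all x p [] [] = []
    rank-all x p (item m n os ∷ is) (s ∷ ss) with covered (mod-helper 0 p n p) x p os
    ... | true  = rank-all x p is ss
    ... | false = insert-all _ _ _ s (rank-all x p is ss)

    swap-all : ∀ {i is} → Solvable P i → All (Solvable P) is → All (Solvable P) (swap i is)
    swap-all s []       = s ∷ []
    swap-all s (t ∷ ts) = t ∷ s ∷ ts

    promote-all : ∀ l p k i is → Solvable P i → All (Solvable P) is → All (Solvable P) (promote l p k i is)
    promote-all zero    p k i is s ss = s ∷ ss
    promote-all (suc l) p k i [] s [] = s ∷ []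
    promote-all (suc l) p k i (item m n os ∷ is) s (t ∷ ss) with weight (mod-helper 0 p n p) <ᵇ k
    ... | true  = swap-all s (promote-all l p _ _ is t ss)
    ... | false = swap-all t (promote-all l p k i is s ss)

    take-all : ∀ k {rs} → All SolvableR rs → All SolvableR (take k rs)
    take-all zero    ss       = []
    take-all (suc k) []       = []
    take-all (suc k) (s ∷ ss) = s ∷ take-all k ss

    pred-product : ∀ os → suc (pred (product os)) ≡ product os
    pred-product []           = refl
    pred-product (opt p x os) with product os | pred-product os
    ... | suc m | _ = refl

    -- The new modulus is the product of the moduli of the options present, so that of the live
    -- option divides it.
    live-build : ∀ {m os} → Live P m os → Solvable P (build os)
    live-build {os = os} l = go l (subst (product os ∣_) (sym (pred-product os)) ∣-refl)
      where
        go : ∀ {m n os} → Live P m os → product os ∣ suc n → Live P n os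
        go (here {p} {x} {os} pp gx _) d = here pp gx (m*n∣⇒m∣ (suc p) (product os) d)
        go (there {p} {x} {os} l) d = there (go l (m*n∣⇒n∣ (suc p) (product os) d))

    restrict-all : ∀ x rs → Good P x → All SolvableR rs → All (Solvable P) (restrict x rs)
    restrict-all x [] g [] = []
    restrict-all x (ranked _ (item m _ os) ∷ rs) g (s ∷ ss) =
      live-build (live-remaining x g s) ∷ restrict-all x rs g ss

  absorb-∣ : ∀ M os → M ∣ absorb M os
  absorb-∣ M [] = ∣-refl
  absorb-∣ M (opt p x os) with mod-helper 0 p M p
  ... | zero  = absorb-∣ M os
  ... | suc _ = ∣-trans (n∣m*n (suc p)) (absorb-∣ (suc p * M) os)

  modulus-∣ : ∀ M is → M ∣ modulus M is
  modulus-∣ M [] = ∣-refl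
  modulus-∣ M (item _ _ os ∷ is) = ∣-trans (absorb-∣ M os) (modulus-∣ (absorb M os) is)

  absorb-nonzero : ∀ M os → M ≢ 0 → absorb M os ≢ 0
  absorb-nonzero M [] z = z
  absorb-nonzero M (opt p x os) z with mod-helper 0 p M p
  ... | zero  = absorb-nonzero M os z
  ... | suc _ = absorb-nonzero (suc p * M) os (λ e → z (m*n≡0⇒m≡0 M (suc p) (trans (*-comm M (suc p)) e)))

  modulus-nonzero : ∀ M is → M ≢ 0 → modulus M is ≢ 0
  modulus-nonzero M [] z = z
  modulus-nonzero M (item _ _ os ∷ is) z = modulus-nonzero _ is (absorb-nonzero M os z)

  suc-pred-≢ : ∀ n → n ≢ 0 → suc (pred n) ≡ n
  suc-pred-≢ zero z = ⊥-elim (z refl)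
  suc-pred-≢ (suc n) z = refl

  data ReducedLive (P : ℕ → Set) (m : ℕ) (D : ℕ) : Options → Set where
    here  : ∀ {p x os} → P p → Good P x → suc p ∣ suc m → suc p ∣ D → ReducedLive P m D (opt p x os)
    there : ∀ {p x os} → ReducedLive P m D os → ReducedLive P m D (opt p x os)

  module _ {P : ℕ → Set} where
    absorb-live : ∀ {m} M os D → absorb M os ∣ D → Live P m os → ReducedLive P m D os
    absorb-live M (opt p x os) D d l with mod-helper 0 p M p in eq
    absorb-live M (opt p x os) D d (here pp gx e) | zero =
      here pp gx e (∣-trans (m%n≡0⇒n∣m M (suc p) eq) (∣-trans (absorb-∣ M os) d))
    absorb-live M (opt p x os) D d (there l) | zero = there (absorb-live M os D d l)
    absorb-live M (opt p x os) D d (here pp gx e) | suc _ =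
      here pp gx e (∣-trans (m∣m*n M) (∣-trans (absorb-∣ (suc p * M) os) d))
    absorb-live M (opt p x os) D d (there l) | suc _ = there (absorb-live (suc p * M) os D d l)

    -- Reduction modulo a smaller product destroys residues at the primes left out. The solution is
    -- therefore cut down to the primes dividing the new modulus; the live options remain, since
    -- `absorb` has put their primes into it.
    Below : ℕ → ℕ → Set
    Below M p = P p × (suc p ∣ suc M)

    reduce-live : ∀ {m M os} → ReducedLive P m (suc M) os → Live (Below M) m (reduceOptions M os)
    reduce-live {M = M} (here {x = x} pp gx d d′) =
      here (pp , d′) (λ {q} (pq , e) → good-% {Below M} {M} {x} proj₂ (gx ∘ proj₁) (pq , e)) d
    reduce-live (there l) = there (reduce-live l)

    reduce-all : ∀ M N is → modulus N is ∣ suc M → All (Solvable P) is → All (Solvable (Below M)) (reduce M is)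
    reduce-all M N [] d [] = []
    reduce-all M N (item m n os ∷ is) d (s ∷ ss) =
      reduce-live (absorb-live N os (suc M) (∣-trans (modulus-∣ (absorb N os) is) d) s)
        ∷ reduce-all M (absorb N os) is d ss

  leaf-sound : ∀ {P M x p} is → Divides P M → leaf M x p is ≡ true → Good P x → All (Solvable P) is → ⊥
  leaf-sound {x = x} (item m n os ∷ is) d e g (s ∷ ss) =
    tryAll-sound d (remaining x m os) e (live-remaining x g s) g ss

  leaf′-sound : ∀ {P M x p} is → Divides P M → leaf′ M x p is ≡ true → Good P x → All (Solvable P) is → ⊥
  leaf′-sound {p = p} (item m n os ∷ is) d e g (s ∷ ss) =
    leaf-sound (promote 5 p (weight (mod-helper 0 p n p)) (item m n os) is) d e g
      (promote-all 5 p _ _ is s ss)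

  descend-sound : ∀ {P m M} ks os is → Divides P M → descend ks M os is ≡ true →
    Live P m os → All (Solvable P) is → ⊥
  -- The condition on `M` is demanded only at a leaf: every other level computes its own modulus,
  -- and the root call passes the placeholder 0.
  step-sound : ∀ {P M x} ks p is → (ks ≡ [] → Divides P M) → step ks M x p is ≡ true →
    Good P x → All (Solvable P) is → ⊥
  step₂-sound : ∀ {P} ks is → step₂ ks is ≡ true → All (Solvable P) is → ⊥
  step₄-sound : ∀ {P M} ks is → Divides P M → step₄ ks M is ≡ true → All (Solvable P) is → ⊥
  descend-sound ks (opt p x os) is d e (here pp gx _) s =
    step-sound ks p is (λ _ → d) (proj₁ (∧-true e)) gx s
  descend-sound {M = M} ks (opt p x os) is d e (there l) s =
    descend-sound ks os is d (proj₂ (∧-true {step ks M x p is} e)) l s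
  step-sound [] p is d e g s = leaf′-sound is (d refl) e g s
  step-sound {x = x} (k ∷ ks) p is d e g s
    with ∨-true {step₂ ks (restrict x (take k (rank x p is)))} e
  ... | inj₁ e′ = step₂-sound ks _ e′ (restrict-all x _ g (take-all k (rank-all x p is s)))
  ... | inj₂ e′ = step₂-sound ks _ e′ (restrict-all x _ g (rank-all x p is s))
  step₂-sound ks is e s = step₄-sound ks (reduce M is) proj₂ e (reduce-all M 1 is d s)
    where
      M = pred (modulus 1 is)
      d : modulus 1 is ∣ suc M
      d = subst (modulus 1 is ∣_) (sym (suc-pred-≢ _ (modulus-nonzero 1 is (λ ())))) ∣-refl
  step₄-sound ks (item m n os ∷ is) d e (l ∷ s) = descend-sound ks os is d e l s

-- Boolean tests on lists, and counting a partition into parts of equal size.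

module Lists where

  open import Data.Bool using (Bool; true; false; _∧_; _∨_; not; if_then_else_; T)
  open import Data.Nat
  open import Data.Nat.Properties
  open import Data.Nat.Divisibility using (_∣_; ∣m∣n⇒∣m+n; ∣-refl; _∣0)
  open import Data.List using (List; []; _∷_; _++_; length)
  open import Data.List.Properties using (length-++)
  open import Data.List.Membership.Propositional using (_∈_; _∉_)
  open import Data.List.Membership.Propositional.Properties using (∈-∃++; ∈-++⁻; ∈-++⁺ˡ; ∈-++⁺ʳ)
  open import Data.List.Relation.Unary.Any using (here; there)
  open import Data.List.Relation.Unary.All as All using (All; []; _∷_)
  open import Data.List.Relation.Unary.AllPairs using ([]; _∷_)
  open import Data.List.Relation.Unary.Unique.Propositional using (Unique)
  open import Data.Product using (∃-syntax; _×_; _,_; proj₁)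
  open import Data.Sum using (_⊎_; inj₁; inj₂)
  open import Data.Empty using (⊥-elim)
  open import Relation.Nullary using (yes; no)
  open import Relation.Binary.PropositionalEquality
  open Search using (elem; ∧-true; ∨-true)

  exists : {A : Set} → (A → Bool) → List A → Bool
  exists f []       = false
  exists f (x ∷ xs) = f x ∨ exists f xs

  every : {A : Set} → (A → Bool) → List A → Bool
  every f []       = true
  every f (x ∷ xs) = f x ∧ every f xs

  everyBelow : ℕ → (ℕ → Bool) → Bool
  everyBelow zero    f = true
  everyBelow (suc n) f = f n ∧ everyBelow n f

  ∧-true² : ∀ {a b} → a ∧ b ≡ true → b ≡ true
  ∧-true² {true} e = e

  exists⁻ : ∀ {A : Set} {f : A → Bool} xs → exists f xs ≡ true → ∃[ x ] x ∈ xs × f x ≡ true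
  exists⁻ {f = f} (x ∷ xs) e with ∨-true {f x} e
  ... | inj₁ e′ = x , here refl , e′
  ... | inj₂ e′ with y , y∈ , fy ← exists⁻ xs e′ = y , there y∈ , fy

  every⁻ : ∀ {A : Set} {f : A → Bool} {xs x} → every f xs ≡ true → x ∈ xs → f x ≡ true
  every⁻ e (here refl) = proj₁ (∧-true e)
  every⁻ {f = f} {y ∷ _} e (there x∈) = every⁻ (∧-true² {f y} e) x∈

  everyBelow⁻ : ∀ {f} n {k} → everyBelow n f ≡ true → k < n → f k ≡ true
  everyBelow⁻ {f} (suc n) {k} e k<n with k ≟ n
  ... | yes refl = proj₁ (∧-true e)
  ... | no k≢n = everyBelow⁻ n (∧-true² {f n} e) (≤∧≢⇒< (s≤s⁻¹ k<n) k≢n)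

  ≡ᵇ-true : ∀ {m n} → (m ≡ᵇ n) ≡ true → m ≡ n
  ≡ᵇ-true {m} {n} e = ≡ᵇ⇒≡ m n (subst T (sym e) _)

  <ᵇ-true : ∀ {m n} → (m <ᵇ n) ≡ true → m < n
  <ᵇ-true {m} {n} e = <ᵇ⇒< m n (subst T (sym e) _)

  ≡ᵇ-refl : ∀ n → (n ≡ᵇ n) ≡ true
  ≡ᵇ-refl zero    = refl
  ≡ᵇ-refl (suc n) = ≡ᵇ-refl n

  elem⁻ : ∀ {x} xs → elem x xs ≡ true → x ∈ xs
  elem⁻ {x} (y ∷ ys) e with ∨-true {x ≡ᵇ y} e
  ... | inj₁ e′ = here (≡ᵇ-true e′)
  ... | inj₂ e′ = there (elem⁻ ys e′)

  ∨-trueʳ : ∀ a {b} → b ≡ true → a ∨ b ≡ true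
  ∨-trueʳ true  e = refl
  ∨-trueʳ false e = e

  elem⁺ : ∀ {x xs} → x ∈ xs → elem x xs ≡ true
  elem⁺ {x} (here refl) rewrite ≡ᵇ-refl x = refl
  elem⁺ {x} {y ∷ ys} (there x∈) = ∨-trueʳ (x ≡ᵇ y) (elem⁺ x∈)

  not-true : ∀ {b} → not b ≡ true → b ≡ false
  not-true {false} e = refl

  notElem⁻ : ∀ {x xs} → not (elem x xs) ≡ true → x ∉ xs
  notElem⁻ e x∈ with () ← trans (sym (not-true e)) (elem⁺ x∈)

  distinct : List ℕ → Bool
  distinct []       = true
  distinct (x ∷ xs) = not (elem x xs) ∧ distinct xs

  distinct⁻ : ∀ xs → distinct xs ≡ true → Unique xs
  distinct⁻ [] e = []
  distinct⁻ (x ∷ xs) e =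
    All.tabulate (λ y∈ x≡y → notElem⁻ (proj₁ (∧-true e)) (subst (_∈ xs) (sym x≡y) y∈))
      ∷ distinct⁻ xs (∧-true² {not (elem x xs)} e)

  nub : List ℕ → List ℕ
  nub []       = []
  nub (x ∷ xs) = if elem x xs then nub xs else x ∷ nub xs

  nub⁺ : ∀ {x} xs → x ∈ xs → x ∈ nub xs
  nub⁺ (y ∷ ys) x∈ with elem y ys in eq
  nub⁺ (y ∷ ys) (here refl) | true  = nub⁺ ys (elem⁻ ys eq)
  nub⁺ (y ∷ ys) (there x∈)  | true  = nub⁺ ys x∈
  nub⁺ (y ∷ ys) (here refl) | false = here refl
  nub⁺ (y ∷ ys) (there x∈)  | false = there (nub⁺ ys x∈)

  nub⁻ : ∀ {x} xs → x ∈ nub xs → x ∈ xs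
  nub⁻ (y ∷ ys) x∈ with elem y ys
  nub⁻ (y ∷ ys) x∈          | true  = there (nub⁻ ys x∈)
  nub⁻ (y ∷ ys) (here refl) | false = here refl
  nub⁻ (y ∷ ys) (there x∈)  | false = there (nub⁻ ys x∈)

  _⊆ᵇ_ : List ℕ → List ℕ → Bool
  xs ⊆ᵇ ys = every (λ x → elem x ys) xs

  ⊆ᵇ⁻ : ∀ {xs ys} → xs ⊆ᵇ ys ≡ true → ∀ {x} → x ∈ xs → x ∈ ys
  ⊆ᵇ⁻ {ys = ys} e x∈ = elem⁻ ys (every⁻ e x∈)

  unique-middle : ∀ (as : List ℕ) {x bs} → Unique (as ++ x ∷ bs) → x ∉ as ++ bs × Unique (as ++ bs)
  unique-middle [] (x∉ ∷ u) = (λ x∈ → All.lookup x∉ x∈ refl) , u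
  unique-middle (a ∷ as) {x} {bs} (a∉ ∷ u) with unique-middle as u
  ... | x∉ , u′ = no-x , All.tabulate (λ {y} y∈ → All.lookup a∉ (weaken y∈)) ∷ u′
    where
      weaken : ∀ {y} → y ∈ as ++ bs → y ∈ as ++ x ∷ bs
      weaken y∈ with ∈-++⁻ as y∈
      ... | inj₁ p = ∈-++⁺ˡ p
      ... | inj₂ q = ∈-++⁺ʳ as (there q)
      no-x : x ∉ a ∷ as ++ bs
      no-x (here refl) = All.lookup a∉ (∈-++⁺ʳ as (here refl)) refl
      no-x (there x∈) = x∉ x∈

  remove : ∀ rs {l} → Unique rs → Unique l → (∀ {x} → x ∈ rs → x ∈ l) →
    ∃[ l′ ] Unique l′ × length l ≡ length rs + length l′ ×
      (∀ {x} → x ∈ l′ → x ∈ l × x ∉ rs) × (∀ {x} → x ∈ l → x ∉ rs → x ∈ l′)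
  remove [] {l} _ u _ = l , u , refl , (λ x∈ → x∈ , λ ()) , λ x∈ _ → x∈
  remove (r ∷ rs) {l} (r∉ ∷ urs) u sub with ∈-∃++ (sub (here refl))
  ... | as , bs , refl with unique-middle as u
  ... | r∉l , u′ with remove rs urs u′ (λ {x} x∈ → strengthen (sub (there x∈)) (λ e → All.lookup r∉ x∈ (sym e)))
    where
      strengthen : ∀ {x} → x ∈ as ++ r ∷ bs → x ≢ r → x ∈ as ++ bs
      strengthen x∈ x≢ with ∈-++⁻ as x∈
      ... | inj₁ p = ∈-++⁺ˡ p
      ... | inj₂ (here e) = ⊥-elim (x≢ e)
      ... | inj₂ (there q) = ∈-++⁺ʳ as q
  ... | l′ , ul′ , len , down , up = l′ , ul′ , len′ , down′ , up′
    where
      weaken : ∀ {y} → y ∈ as ++ bs → y ∈ as ++ r ∷ bs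
      weaken y∈ with ∈-++⁻ as y∈
      ... | inj₁ p = ∈-++⁺ˡ p
      ... | inj₂ q = ∈-++⁺ʳ as (there q)
      len′ : length (as ++ r ∷ bs) ≡ suc (length rs + length l′)
      len′ = trans (length-++ as) (trans (+-suc (length as) (length bs)) (cong suc (trans (sym (length-++ as)) len)))
      down′ : ∀ {x} → x ∈ l′ → x ∈ as ++ r ∷ bs × x ∉ r ∷ rs
      down′ x∈ with down x∈
      ... | x∈l , x∉ = weaken x∈l , λ { (here refl) → r∉l x∈l ; (there q) → x∉ q }
      up′ : ∀ {x} → x ∈ as ++ r ∷ bs → x ∉ r ∷ rs → x ∈ l′
      up′ x∈ x∉ with ∈-++⁻ as x∈
      ... | inj₁ p = up (∈-++⁺ˡ p) (λ q → x∉ (there q))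
      ... | inj₂ (here e) = ⊥-elim (x∉ (here e))
      ... | inj₂ (there q) = up (∈-++⁺ʳ as q) (λ q′ → x∉ (there q′))

  -- Remove the part of the head and recurse. By `same`, a part that meets the removed one lies
  -- inside it, so the parts of the remaining elements stay intact.
  partition-∣ : ∀ k (Part : List ℕ → Set) →
    (∀ {r r′ x} → Part r → Part r′ → x ∈ r → x ∈ r′ → ∀ {y} → y ∈ r → y ∈ r′) →
    ∀ l → Unique l →
    (∀ {x} → x ∈ l → ∃[ r ] Part r × x ∈ r × Unique r × length r ≡ k × (∀ {y} → y ∈ r → y ∈ l)) →
    k ∣ length l
  partition-∣ k Part same l₀ u₀ cover₀ = go (length l₀) l₀ ≤-refl u₀ cover₀
    where
      go : ∀ n l → length l ≤ n → Unique l →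
        (∀ {x} → x ∈ l → ∃[ r ] Part r × x ∈ r × Unique r × length r ≡ k × (∀ {y} → y ∈ r → y ∈ l)) →
        k ∣ length l
      go n [] _ _ _ = k ∣0
      go (suc n) (a ∷ l) le u cover with cover (here refl)
      ... | r , pr , a∈r , ur , len , r⊆ with remove r ur u r⊆
      ... | l′ , ul′ , len′ , down , up =
        subst (k ∣_) (sym (trans len′ (cong (_+ length l′) len)))
          (∣m∣n⇒∣m+n ∣-refl (go n l′ shorter ul′ cover′))
        where
          shorter : length l′ ≤ n
          shorter = s≤s⁻¹ (≤-trans (+-monoˡ-≤ (length l′) (nonempty a∈r)) (≤-trans (≤-reflexive (sym len′)) le))
            where
              nonempty : ∀ {x r} → x ∈ r → 1 ≤ length r
              nonempty (here _) = s≤s z≤n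
              nonempty (there _) = s≤s z≤n
          cover′ : ∀ {x} → x ∈ l′ → ∃[ r′ ] Part r′ × x ∈ r′ × Unique r′ × length r′ ≡ k × (∀ {y} → y ∈ r′ → y ∈ l′)
          cover′ x∈ with down x∈
          ... | x∈l , x∉r with cover x∈l
          ... | r′ , pr′ , x∈r′ , ur′ , lr′ , r′⊆ =
            r′ , pr′ , x∈r′ , ur′ , lr′ , λ y∈ → up (r′⊆ y∈) (λ y∈r → x∉r (same pr′ pr y∈ y∈r x∈r′))

  -- Each `t` decides for itself which alternative it offers, so a bounded search replaces excluded
  -- middle.
  first-or-all : ∀ {S : Set} {R : ℕ → Set} n → (∀ {t} → t < n → S ⊎ R t) → S ⊎ (∀ {t} → t < n → R t)
  first-or-all zero f = inj₂ λ ()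
  first-or-all {S} {R} (suc n) f with first-or-all {S} {R} n (λ t< → f (m<n⇒m<1+n t<)) | f {n} ≤-refl
  ... | inj₁ s | _      = inj₁ s
  ... | inj₂ _ | inj₁ s = inj₁ s
  ... | inj₂ g | inj₂ r = inj₂ h
    where
      h : ∀ {t} → t < suc n → R t
      h {t} t< with t ≟ n
      ... | yes refl = r
      ... | no t≢n = g (≤∧≢⇒< (s≤s⁻¹ t<) t≢n)

-- Exponents modulo 511, Zech logarithms and the Frobenius map.

module Exponent where

  open import Data.Nat
  open import Data.Nat.Properties
  open import Data.Nat.DivMod
  open import Data.Fin using (Fin)
  open import Data.List using (List; []; _∷_; map)
  open import Data.List.Membership.Propositional using (_∈_; _∉_)
  open import Data.List.Membership.Propositional.Properties using (∈-map⁻; ∈-map⁺)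
  open import Data.List.Relation.Unary.All as All using (All; []; _∷_)
  open import Data.List.Relation.Unary.AllPairs using ([]; _∷_)
  open import Data.Product using (∃-syntax; _×_; _,_; proj₁; proj₂)
  open import Relation.Binary.PropositionalEquality
  open Search using (elem; ∧-true; ∨-true)
  open Lists

  infix 4 _≈_
  -- Wrapped in a record so that `a` and `b` can be inferred from a proof, which the bare equation
  -- of remainders does not allow.
  record _≈_ (a b : ℕ) : Set where
    constructor mk≈
    field un≈ : a % 511 ≡ b % 511
  open _≈_ public

  ≈-refl : ∀ {a} → a ≈ a
  ≈-refl = mk≈ refl

  ≈-sym : ∀ {a b} → a ≈ b → b ≈ a
  ≈-sym (mk≈ e) = mk≈ (sym e)

  ≈-trans : ∀ {a b c} → a ≈ b → b ≈ c → a ≈ c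
  ≈-trans (mk≈ e) (mk≈ f) = mk≈ (trans e f)

  ≡⇒≈ : ∀ {a b} → a ≡ b → a ≈ b
  ≡⇒≈ refl = ≈-refl

  +-cong : ∀ {a b c d} → a ≈ b → c ≈ d → a + c ≈ b + d
  +-cong {a} {b} {c} {d} (mk≈ e) (mk≈ f) = mk≈ (trans (%-distribˡ-+ a c 511)
    (trans (cong₂ (λ u v → (u + v) % 511) e f) (sym (%-distribˡ-+ b d 511))))

  *-congʳ : ∀ k {a b} → a ≈ b → k * a ≈ k * b
  *-congʳ k {a} {b} (mk≈ e) = mk≈ (trans (%-distribˡ-* k a 511)
    (trans (cong (λ u → ((k % 511) * u) % 511) e) (sym (%-distribˡ-* k b 511))))

  %≈ : ∀ a → a % 511 ≈ a
  %≈ a = mk≈ (m%n%n≡m%n a 511)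

  ≈⇒≡ : ∀ {a b} → a < 511 → b < 511 → a ≈ b → a ≡ b
  ≈⇒≡ a< b< (mk≈ e) = trans (sym (m<n⇒m%n≡m a<)) (trans e (m<n⇒m%n≡m b<))

  %< : ∀ a → a % 511 < 511
  %< a = m%n<n a 511

  inverse≈ : ∀ {a} → a < 511 → a + (511 ∸ a) ≈ 0
  inverse≈ a< = ≈-trans (≡⇒≈ (m+[n∸m]≡n (<⇒≤ a<))) (mk≈ refl)

  +-cancelʳ≈ : ∀ {a b} c → c < 511 → a + c ≈ b + c → a ≈ b
  +-cancelʳ≈ {a} {b} c c< e =
    ≈-trans (≈-sym (lemma a)) (≈-trans (+-cong e (≈-refl {511 ∸ c})) (lemma b))
    where
      lemma : ∀ a → a + c + (511 ∸ c) ≈ a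
      lemma a = ≈-trans (≡⇒≈ (+-assoc a c (511 ∸ c)))
        (≈-trans (+-cong (≈-refl {a}) (inverse≈ c<)) (≡⇒≈ (+-identityʳ a)))

  -- For `a` below 511 this is b - a modulo 511; adding `511 ∸ a` avoids truncated subtraction.
  diff : ℕ → ℕ → ℕ
  diff a b = (b + (511 ∸ a)) % 511

  diff< : ∀ a b → diff a b < 511
  diff< a b = %< (b + (511 ∸ a))

  +diff : ∀ a b → a < 511 → a + diff a b ≈ b
  +diff a b a< = ≈-trans (+-cong (≈-refl {a}) (%≈ (b + (511 ∸ a))))
    (≈-trans (≡⇒≈ (trans (sym (+-assoc a b _)) (trans (cong (_+ (511 ∸ a)) (+-comm a b)) (+-assoc b a _))))
      (≈-trans (+-cong (≈-refl {b}) (inverse≈ a<)) (≡⇒≈ (+-identityʳ b))))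

  diff-unique : ∀ a b e → a < 511 → a + e ≈ b → diff a b ≈ e
  diff-unique a b e a< h = +-cancelʳ≈ a a<
    (≈-trans (≡⇒≈ (+-comm (diff a b) a)) (≈-trans (+diff a b a<) (≈-trans (≈-sym h) (≡⇒≈ (+-comm a e)))))

  double : ℕ → ℕ
  double a = 2 * a % 511

  double< : ∀ a → double a < 511
  double< a = %< (2 * a)

  diff-double : ∀ a b → a < 511 → diff (double a) (double b) ≡ double (diff a b)
  diff-double a b a< = ≈⇒≡ (diff< (double a) (double b)) (double< (diff a b))
    (diff-unique (double a) (double b) (double (diff a b)) (double< a)
      (≈-trans (+-cong (%≈ (2 * a)) (%≈ (2 * diff a b)))
        (≈-trans (≡⇒≈ (sym (*-distribˡ-+ 2 a (diff a b))))
          (≈-trans (*-congʳ 2 (+diff a b a<)) (≈-sym (%≈ (2 * b)))))))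

  +≢ : ∀ b e → e % 511 ≢ 0 → b % 511 ≢ (b + e) % 511
  +≢ b e e≢ h = e≢ (un≈ e≈0)
    where
      b+e≈b : b + e ≈ b
      b+e≈b = mk≈ (sym h)
      e+b≈b : e + b % 511 ≈ b % 511
      e+b≈b = ≈-trans {b = e + b} (+-cong (≈-refl {e}) (%≈ b))
        (≈-trans {b = b + e} (≡⇒≈ (+-comm e b)) (≈-trans {b = b} b+e≈b (≈-sym (%≈ b))))
      e≈0 : e ≈ 0
      e≈0 = +-cancelʳ≈ {e} {0} (b % 511) (%< b) e+b≈b

  translation : ℕ → ℕ → ℕ
  translation a b = b + (511 ∸ a % 511)

  +translation : ∀ a b → a + translation a b ≈ b
  +translation a b = ≈-trans {b = a % 511 + diff (a % 511) b}
    (+-cong {a} {a % 511} {translation a b} {diff (a % 511) b} (≈-sym (%≈ a)) (≈-sym (%≈ (translation a b))))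
    (+diff (a % 511) b (%< a))

  +-swapʳ : ∀ a e k → a + e + k ≡ a + k + e
  +-swapʳ a e k = trans (+-assoc a e k) (trans (cong (a +_) (+-comm e k)) (sym (+-assoc a k e)))

  diff-+ : ∀ a e → diff (a % 511) ((a + e) % 511) ≡ e % 511
  diff-+ a e = ≈⇒≡ (diff< (a % 511) ((a + e) % 511)) (%< e)
    (≈-trans {b = e} (diff-unique (a % 511) ((a + e) % 511) e (%< a) a+e≈) (≈-sym (%≈ e)))
    where
      a+e≈ : a % 511 + e ≈ (a + e) % 511
      a+e≈ = ≈-trans {b = a + e} (+-cong (%≈ a) (≈-refl {e})) (≈-sym (%≈ (a + e)))

  +diff-injective : ∀ {x y w} → x < 511 → w < 511 → y ≡ (w + diff x y) % 511 → w ≡ x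
  +diff-injective {x} {y} {w} x< w< e = ≈⇒≡ w< x< (+-cancelʳ≈ {w} {x} k (diff< x y) w+k≈x+k)
    where
      k = diff x y
      w+k≈x+k : w + k ≈ x + k
      w+k≈x+k = ≈-trans {b = (w + k) % 511} (≈-sym (%≈ (w + k)))
        (≈-trans {b = y} (≡⇒≈ (sym e)) (≈-sym (+diff x y x<)))

  module Triangle (zech : ℕ → ℕ) where

    -- With `zech` the Zech logarithm, 1 + α^d = α^(zech d), this is the exponent of α^a + α^b, the
    -- third point of a line.
    tri : ℕ → ℕ → ℕ
    tri a b = (a + zech (diff a b)) % 511

    tri< : ∀ a b → tri a b < 511
    tri< a b = %< (a + zech (diff a b))

    plane : ℕ → ℕ → ℕ → List ℕ
    plane a b c = a ∷ b ∷ tri a b ∷ c ∷ tri a c ∷ tri b c ∷ tri (tri a b) c ∷ []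

    -- Mem i a : the a-th power of the primitive element lies in block i
    record Geometry {n} (Mem : Fin n → ℕ → Set) : Set where
      field
        respects   : ∀ {i a b} → a ≈ b → Mem i a → Mem i b
        shift  : ∀ i k → ∃[ j ] ∀ a → (Mem i a → Mem j (a + k)) × (Mem j (a + k) → Mem i a)
        sum    : ∀ {i a b} → a < 511 → b < 511 → a ≢ b → Mem i a → Mem i b → Mem i (tri a b)
        join   : ∀ {a b} → a < 511 → b < 511 → a ≢ b → ∃[ i ] Mem i a × Mem i b
        unique : ∀ {i j a b} → a < 511 → b < 511 → a ≢ b → Mem i a → Mem i b → Mem j a → Mem j b → i ≡ j
        third  : ∀ {i a b} → a < 511 → b < 511 → a ≢ b → Mem i a → Mem i b →
                 ∃[ c ] c < 511 × Mem i c × c ∉ a ∷ b ∷ tri a b ∷ []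
        exact  : ∀ {i a b c x} → a < 511 → b < 511 → c < 511 → x < 511 → a ≢ b → c ∉ a ∷ b ∷ tri a b ∷ [] →
                 Mem i a → Mem i b → Mem i c → Mem i x → x ∈ plane a b c

  module Twist (zech : ℕ → ℕ)
    (zech-double : ∀ {d} → d < 511 → zech (2 * d % 511) ≡ 2 * zech d % 511)
    (h : ℕ) (2h≈1 : 2 * h ≈ 1) where

    open Triangle zech

    *-congˡ : ∀ {a b} k → a ≈ b → a * k ≈ b * k
    *-congˡ {a} {b} k e = ≈-trans (≡⇒≈ (*-comm a k)) (≈-trans (*-congʳ k e) (≡⇒≈ (*-comm k b)))

    half′≈ : ∀ a → 2 * (h * a) ≈ a
    half′≈ a = ≈-trans (≡⇒≈ (sym (*-assoc 2 h a))) (≈-trans (*-congˡ a 2h≈1) (≡⇒≈ (*-identityˡ a)))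

    half≈ : ∀ a → h * (2 * a) ≈ a
    half≈ a = ≈-trans (≡⇒≈ (trans (sym (*-assoc h 2 a)) (trans (cong (_* a) (*-comm h 2)) (*-assoc 2 h a)))) (half′≈ a)

    double-injective≈ : ∀ {a b} → 2 * a ≈ 2 * b → a ≈ b
    double-injective≈ {a} {b} e = ≈-trans (≈-sym (half≈ a)) (≈-trans (*-congʳ h e) (half≈ b))

    double-injective : ∀ {a b} → a < 511 → b < 511 → double a ≡ double b → a ≡ b
    double-injective a< b< e = ≈⇒≡ a< b< (double-injective≈ (mk≈ e))

    tri-double : ∀ a b → a < 511 → tri (double a) (double b) ≡ double (tri a b)
    tri-double a b a< = ≈⇒≡ (%< (double a + zech (diff (double a) (double b)))) (double< (tri a b))
      (≈-trans (%≈ _) (≈-trans (+-cong (%≈ (2 * a)) (≡⇒≈ (trans (cong zech (diff-double a b a<)) (zech-double (diff< a b)))))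
        (≈-trans (+-cong (≈-refl {2 * a}) (%≈ (2 * zech (diff a b))))
          (≈-trans (≡⇒≈ (sym (*-distribˡ-+ 2 a _))) (≈-trans (*-congʳ 2 (≈-sym (%≈ (a + zech (diff a b))))) (≈-sym (%≈ (2 * tri a b))))))))

    line-double : ∀ a b → a < 511 → b < 511 →
      double a ∷ double b ∷ tri (double a) (double b) ∷ [] ≡ map double (a ∷ b ∷ tri a b ∷ [])
    line-double a b a< b< = cong (λ u → double a ∷ double b ∷ u ∷ []) (tri-double a b a<)

    plane-double : ∀ a b c → a < 511 → b < 511 → c < 511 →
      plane (double a) (double b) (double c) ≡ map double (plane a b c)
    plane-double a b c a< b< c< =
      cong₂ _∷_ refl (cong₂ _∷_ refl (cong₂ _∷_ ab (cong₂ _∷_ refl (cong₂ _∷_ (tri-double a c a<)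
        (cong₂ _∷_ (tri-double b c b<) (cong₂ _∷_ (trans (cong (λ u → tri u (double c)) ab) (tri-double (tri a b) c (tri< a b))) refl))))))
      where
        ab = tri-double a b a<

    line< : ∀ {a b} → a < 511 → b < 511 → All (_< 511) (a ∷ b ∷ tri a b ∷ [])
    line< {a} {b} a< b< = a< ∷ b< ∷ tri< a b ∷ []

    plane< : ∀ {a b c} → a < 511 → b < 511 → c < 511 → All (_< 511) (plane a b c)
    plane< {a} {b} {c} a< b< c< =
      a< ∷ b< ∷ tri< a b ∷ c< ∷ tri< a c ∷ tri< b c ∷ tri< (tri a b) c ∷ []

    undouble : ∀ {x xs} → x < 511 → All (_< 511) xs → double x ∈ map double xs → x ∈ xs
    undouble {xs = xs} x< xs< m with ∈-map⁻ double m
    ... | y , y∈ , e = subst (_∈ xs) (sym (double-injective x< (All.lookup xs< y∈) e)) y∈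

    -- Squaring is a field automorphism, so it carries lines and planes to lines and planes and
    -- turns translation by `k` into translation by `2 * k`. It need not preserve the design: the
    -- result is another geometry. The inverse `h` of 2 is needed to pull the third point back.
    frobenius : ∀ {n} {Mem : Fin n → ℕ → Set} → Geometry Mem → Geometry (λ i a → Mem i (2 * a))
    frobenius {n} {Mem} G = record
      { respects   = λ e → respects (*-congʳ 2 e)
      ; shift  = λ i k → let j , f = shift i (2 * k) in
          j , λ a → (λ m → subst (Mem j) (sym (*-distribˡ-+ 2 a k)) (proj₁ (f (2 * a)) m))
                  , (λ m → proj₂ (f (2 * a)) (subst (Mem j) (*-distribˡ-+ 2 a k) m))
      ; sum    = λ {i} {a} {b} a< b< a≢b ma mb → back (tri a b) (subst (Mem i) (tri-double a b a<)
          (sum (double< a) (double< b) (λ e → a≢b (double-injective a< b< e)) (to a ma) (to b mb)))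
      ; join   = λ {a} {b} a< b< a≢b →
          let i , ma , mb = join (double< a) (double< b) (λ e → a≢b (double-injective a< b< e)) in i , back a ma , back b mb
      ; unique = λ {i} {j} {a} {b} a< b< a≢b p q r s →
          unique (double< a) (double< b) (λ e → a≢b (double-injective a< b< e)) (to a p) (to b q) (to a r) (to b s)
      ; third  = λ {i} {a} {b} a< b< a≢b ma mb →
          let c , c< , mc , c∉ = third (double< a) (double< b) (λ e → a≢b (double-injective a< b< e)) (to a ma) (to b mb)
              c′ = h * c % 511
              e : double c′ ≡ c
              e = ≈⇒≡ (double< c′) c< (≈-trans (%≈ (2 * c′)) (≈-trans (*-congʳ 2 (%≈ (h * c))) (half′≈ c)))
          in c′ , %< (h * c) , back c′ (subst (Mem i) (sym e) mc) ,
             λ m → c∉ (subst₂ _∈_ e (sym (line-double a b a< b<)) (∈-map⁺ double m))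
      ; exact  = λ {i} {a} {b} {c} {x} a< b< c< x< a≢b c∉ ma mb mc mx →
          undouble x< (plane< a< b< c<) (subst (double x ∈_) (plane-double a b c a< b< c<)
            (exact (double< a) (double< b) (double< c) (double< x) (λ e → a≢b (double-injective a< b< e))
              (λ m → c∉ (undouble c< (line< a< b<) (subst (double c ∈_) (line-double a b a< b<) m)))
              (to a ma) (to b mb) (to c mc) (to x mx)))
      }
      where
        open Geometry G
        to : ∀ {i} a → Mem i (2 * a) → Mem i (double a)
        to a = respects (≈-sym (%≈ (2 * a)))
        back : ∀ {i} a → Mem i (double a) → Mem i (2 * a)
        back a = respects (%≈ (2 * a))

-- Orbits of lines, and blocks as sets of line orbits.

module Classes (zech class span : ℕ → ℕ) where

  open import Data.Nat
  open import Relation.Binary.PropositionalEquality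
  open Exponent

  open import Data.Bool using (Bool; true; _∧_; _∨_; not)
  open import Data.Nat.Properties
  open import Data.Nat.DivMod hiding (_%_)
  open import Data.Nat.Divisibility using (_∣_; _∣?_)
  open import Data.Fin using (Fin)
  open import Data.List using (List; []; _∷_; length; map; upTo)
  open import Data.List.Properties using (length-upTo)
  open import Data.List.Membership.Propositional using (_∈_; _∉_)
  open import Data.List.Membership.Propositional.Properties using (∈-map⁻; ∈-map⁺; ∈-upTo⁺; ∈-upTo⁻)
  open import Data.List.Relation.Unary.Any using (here; there)
  open import Data.List.Relation.Unary.All as All using (All; []; _∷_)
  open import Data.List.Relation.Unary.AllPairs using ([]; _∷_)
  open import Data.List.Relation.Unary.Unique.Propositional using (Unique)
  open import Data.List.Relation.Unary.Unique.Propositional.Properties using (upTo⁺)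
  open import Data.Product using (∃-syntax; _×_; _,_; proj₁; proj₂)
  open import Data.Sum using (_⊎_; inj₁; inj₂)
  open import Data.Empty using (⊥; ⊥-elim)
  open import Induction.WellFounded using (Acc; acc)
  open import Data.Nat.Induction using (<-wellFounded)
  open import Relation.Nullary.Decidable using (from-no)
  open Search using (elem; ∧-true; ∨-true)
  open Lists
  open Triangle zech

  Contains : ∀ {n} → (Fin n → ℕ → Set) → Fin n → ℕ → Set
  Contains Mem i t = ∃[ a ] Mem i a × Mem i (a + span t)

  -- The block `i` stands for its orbit under translation, and `r` is exactly the set of line orbits
  -- represented in it.
  Solution : ∀ {n} → (Fin n → ℕ → Set) → List ℕ → Set
  Solution Mem r = ∃[ i ] ∀ {t} → t < 85 → (t ∈ r → Contains Mem i t) × (Contains Mem i t → t ∈ r)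

  twist : ∀ {n} → (Fin n → ℕ → Set) → Fin n → ℕ → Set
  twist Mem i a = Mem i (2 * a)

  rot : ℕ → ℕ
  rot t = class (2 * span t % 511)

  unrot : ℕ → ℕ → ℕ
  unrot h t = class (h * span t % 511)

  line : ℕ → List ℕ
  line d = 0 ∷ d ∷ zech d ∷ []

  classes : List ℕ → List ℕ
  classesFrom : ℕ → List ℕ → List ℕ → List ℕ
  classes []       = []
  classes (x ∷ xs) = classesFrom x xs xs
  classesFrom x []       zs = classes zs
  classesFrom x (y ∷ ys) zs = class (diff x y) ∷ classesFrom x ys zs

  stays : List ℕ → (k x w : ℕ) → Bool
  stays pts k x w = not (w ≡ᵇ x) ∧ elem ((w + k) % 511) pts

  leaves : List ℕ → (k v : ℕ) → Bool
  leaves pts k v = not (elem ((v + k) % 511) pts)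

  conflictAt : List ℕ → (x y : ℕ) → Bool
  conflictAt pts x y =
    not (x ≡ᵇ y) ∧ (exists (stays pts (diff x y) x) pts ∧ exists (leaves pts (diff x y)) pts)

  conflictFrom : List ℕ → ℕ → Bool
  conflictFrom pts x = exists (conflictAt pts x) pts

  -- Two points of the set, but not all, stay in it under some translation.
  conflict : List ℕ → Bool
  conflict pts = exists (conflictFrom pts) pts

  Conflict : List ℕ → Set
  Conflict pts = ∃[ x ] ∃[ y ] ∃[ w ] ∃[ v ] x ∈ pts × y ∈ pts × w ∈ pts × v ∈ pts × w ≢ x ×
    (w + diff x y) % 511 ∈ pts × (v + diff x y) % 511 ∉ pts

  conflict⁻ : ∀ pts → conflict pts ≡ true → Conflict pts
  conflict⁻ pts e = from (exists⁻ {f = conflictFrom pts} pts e)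
    where
      ≡ᵇ-≢ : ∀ {a b} → not (a ≡ᵇ b) ≡ true → a ≢ b
      ≡ᵇ-≢ {a} e refl with () ← trans (sym (not-true e)) (≡ᵇ-refl a)
      finish : ∀ {x y} → x ∈ pts → y ∈ pts → ∃[ w ] w ∈ pts × stays pts (diff x y) x w ≡ true →
        ∃[ v ] v ∈ pts × leaves pts (diff x y) v ≡ true → Conflict pts
      finish {x} {y} x∈ y∈ (w , w∈ , ew) (v , v∈ , ev) = x , y , w , v , x∈ , y∈ , w∈ , v∈ ,
        ≡ᵇ-≢ {w} {x} (proj₁ (∧-true {not (w ≡ᵇ x)} {elem ((w + diff x y) % 511) pts} ew)) ,
        elem⁻ {(w + diff x y) % 511} pts (∧-true² {not (w ≡ᵇ x)} ew) ,
        notElem⁻ {(v + diff x y) % 511} {pts} ev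
      at-y : ∀ {x} → x ∈ pts → ∃[ y ] y ∈ pts × conflictAt pts x y ≡ true → Conflict pts
      at-y {x} x∈ (y , y∈ , ey) = finish x∈ y∈ (exists⁻ {f = stays pts (diff x y) x} pts (proj₁ both))
          (exists⁻ {f = leaves pts (diff x y)} pts (proj₂ both))
        where
          both : exists (stays pts (diff x y) x) pts ≡ true × exists (leaves pts (diff x y)) pts ≡ true
          both = ∧-true (∧-true² {not (x ≡ᵇ y)} ey)
      from : ∃[ x ] x ∈ pts × conflictFrom pts x ≡ true → Conflict pts
      from (x , x∈ , ex) = at-y x∈ (exists⁻ {f = conflictAt pts x} pts ex)

  same : List ℕ → List ℕ → Bool
  same r s = (r ⊆ᵇ s) ∧ (s ⊆ᵇ r)

  -- Three ways to pass: the seven lines lie in seven different orbits; all lines lie in orbit 84,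
  -- as in a coset of F₈*; or the plane cannot be a block. A plane of the first kind must be listed,
  -- unless it contains orbit 84, in which case `covers` rejects it.
  judge : List (List ℕ) → List ℕ → List ℕ → Bool
  judge rows pts r =
    ((length r ≡ᵇ 7) ∧ (distinct r ∧ (elem 84 r ∨ exists (same r) rows))) ∨ ((r ⊆ᵇ (84 ∷ [])) ∨ conflict pts)

  judgePlane : List (List ℕ) → List ℕ → Bool
  judgePlane rows pts = distinct pts ∧ judge rows pts (nub (classes pts))

  smaller : List ℕ → List ℕ → ℕ → Bool
  smaller ls ps c = exists (λ p → (p <ᵇ c) ∧ not (elem p ls)) ps

  -- The third point c is only examined when it is least among the four points of the plane off the line ls.
  judgeLeast : List (List ℕ) → List ℕ → List ℕ → ℕ → List ℕ → Bool
  judgeLeast rows ls ps c pts = elem c ls ∨ (smaller ls ps c ∨ judgePlane rows pts)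

  classify : List (List ℕ) → ℕ → ℕ → Bool
  classify rows d c =
    judgeLeast rows (0 ∷ d ∷ tri 0 d ∷ []) (tri 0 c ∷ tri d c ∷ tri (tri 0 d) c ∷ []) c (plane 0 d c)

  judgeLeast⁻ : ∀ rows ls ps c pts → judgeLeast rows ls ps c pts ≡ true →
    c ∈ ls ⊎ (∃[ p ] p ∈ ps × p < c × p ∉ ls) ⊎ judgePlane rows pts ≡ true
  judgeLeast⁻ rows ls ps c pts e with ∨-true {elem c ls} e
  ... | inj₁ h = inj₁ (elem⁻ ls h)
  ... | inj₂ h with ∨-true {smaller ls ps c} h
  ... | inj₂ g = inj₂ (inj₂ g)
  ... | inj₁ g with exists⁻ ps g
  ... | p , p∈ , q = inj₂ (inj₁ (p , p∈ , <ᵇ-true (proj₁ (∧-true q)) , notElem⁻ (∧-true² {p <ᵇ c} q)))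

  -- Certifies the label of `d`: up to translation, the line through 0 and `d` contains the
  -- representative pair of its class.
  canonical : ℕ → Bool
  canonical d = (class d <ᵇ 85) ∧ exists (λ u → elem ((u + span (class d)) % 511) (line d)) (line d)

  module Sound
    (zech-double : ∀ {d} → d < 511 → zech (2 * d % 511) ≡ 2 * zech d % 511)
    (h : ℕ) (2h≈1 : 2 * h ≈ 1)
    (span-pos : ∀ {t} → t < 85 → 0 < span t) (span< : ∀ {t} → t < 85 → span t < 511)
    (class-span : ∀ {t} → t < 85 → class (span t) ≡ t)
    (class-canonical : ∀ {d} → 0 < d → d < 511 → canonical d ≡ true)
    (class-sym : ∀ {d} → 0 < d → d < 511 → class (511 ∸ d) ≡ class d)
    (unrot-rot : ∀ {t} → t < 85 → unrot h (rot t) ≡ t)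
    (rows : ℕ → List (List ℕ))
    (classified : ∀ {t c} → t < 85 → c < 511 → classify (rows t) (span t) c ≡ true)
    where

    open Twist zech zech-double h 2h≈1

    class< : ∀ {d} → 0 < d → d < 511 → class d < 85
    class< d> d< = <ᵇ-true (proj₁ (∧-true (class-canonical d> d<)))

    diff-pos : ∀ {a b} → a < 511 → b < 511 → a ≢ b → 0 < diff a b
    diff-pos {a} {b} a< b< a≢b = n≢0⇒n>0 λ e → a≢b (≈⇒≡ a< b<
      (≈-trans (≡⇒≈ (sym (trans (cong (a +_) e) (+-identityʳ a)))) (+diff a b a<)))

    module _ {n} {Mem : Fin n → ℕ → Set} (G : Geometry Mem) where
      open Geometry G

      -- A block containing two points contains their line by `sum`, and `canonical` finds the
      -- representative pair on that line.
      canon : ∀ {i a b} → a < 511 → b < 511 → a ≢ b → Mem i a → Mem i b → Contains Mem i (class (diff a b))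
      canon {i} {a} {b} a< b< a≢b ma mb
        with exists⁻ (line (diff a b)) (∧-true² {class (diff a b) <ᵇ 85} (class-canonical (diff-pos a< b< a≢b) (diff< a b)))
      ... | u , u∈ , e = a + u , on u∈ ,
          respects (≈-trans (+-cong (≈-refl {a}) (%≈ (u + span (class (diff a b)))))
              (≡⇒≈ (sym (+-assoc a u _))))
            (on (elem⁻ {(u + span (class (diff a b))) % 511} (line (diff a b)) e))
        where
          on : ∀ {u} → u ∈ line (diff a b) → Mem i (a + u)
          on (here refl) = subst (Mem i) (sym (+-identityʳ a)) ma
          on (there (here refl)) = respects (≈-sym (+diff a b a<)) mb
          on (there (there (here refl))) = respects (%≈ (a + zech (diff a b))) (sum a< b< a≢b ma mb)

      canon-+ : ∀ {i} a e → Mem i a → Mem i (a + e) → e % 511 ≢ 0 → Contains Mem i (class (e % 511))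
      canon-+ {i} a e ma mb e≢ = subst (λ d → Contains Mem i (class d)) eq
        (canon (%< a) (%< (a + e)) distinct′ (respects (≈-sym (%≈ a)) ma) (respects (≈-sym (%≈ (a + e))) mb))
        where
          eq : diff (a % 511) ((a + e) % 511) ≡ e % 511
          eq = diff-+ a e
          distinct′ : a % 511 ≢ (a + e) % 511
          distinct′ = +≢ a e e≢

      span≢0 : ∀ {t} → t < 85 → span t % 511 ≢ 0
      span≢0 t< e = <⇒≢ (span-pos t<) (sym (trans (sym (m<n⇒m%n≡m (span< t<))) e))

      -- Shifting `i` so that its pair of difference `span t` falls on that of `j` gives two common
      -- points, hence the same block.
      translated : ∀ {i j t} → t < 85 → Contains Mem i t → Contains Mem j t →
        ∃[ k ] ∀ {a} → Mem i a → Mem j (a + k)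
      translated {i} {j} {t} t< (a , ma , ma′) (b , mb , mb′) = go (shift i k)
        where
          k = translation a b
          e = span t
          a+k≈b : a + k ≈ b
          a+k≈b = +translation a b
          a+e+k≈b+e : a + e + k ≈ b + e
          a+e+k≈b+e = ≈-trans {b = a + k + e} (≡⇒≈ (+-swapʳ a e k)) (+-cong a+k≈b (≈-refl {e}))
          go : (∃[ j′ ] ∀ c → (Mem i c → Mem j′ (c + k)) × (Mem j′ (c + k) → Mem i c)) → ∃[ k ] ∀ {a} → Mem i a → Mem j (a + k)
          go (j′ , sh) = k , λ {c} mc → subst (λ j → Mem j (c + k)) j′≡j (proj₁ (sh c) mc)
            where
              j′≡j : j′ ≡ j
              j′≡j = unique (%< b) (%< (b + e)) (+≢ b e (span≢0 t<))
                (respects (≈-trans {b = b} a+k≈b (≈-sym (%≈ b))) (proj₁ (sh a) ma))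
                (respects (≈-trans {b = b + e} a+e+k≈b+e (≈-sym (%≈ (b + e)))) (proj₁ (sh (a + e)) ma′))
                (respects (≈-sym (%≈ b)) mb) (respects (≈-sym (%≈ (b + e))) mb′)

      -- This makes the problem an exact cover: the sets of line orbits belonging to two blocks are
      -- equal or disjoint.
      meets : ∀ {r s t} → t < 85 → Solution Mem r → Solution Mem s → t ∈ r → t ∈ s →
        ∀ {u} → u < 85 → u ∈ r → u ∈ s
      meets t< (i , f) (j , g) t∈r t∈s {u} u< u∈r
        with translated t< (proj₁ (f t<) t∈r) (proj₁ (g t<) t∈s) | proj₁ (f u<) u∈r
      ... | k , move | c , mc , mc′ = proj₂ (g u<)
        (c + k , move mc , subst (Mem j) (+-swapʳ c (span u) k) (move mc′))

      Kind : ℕ → List ℕ → Set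
      Kind t r = (∀ {x} → x ∈ r → x ≡ 84)
               ⊎ (length r ≡ 7 × Unique r × (84 ∈ r ⊎ ∃[ s ] s ∈ rows t × (∀ {x} → x ∈ r → x ∈ s) × (∀ {x} → x ∈ s → x ∈ r)))

      Through : ℕ → Set
      Through t = ∃[ r ] Solution Mem r × t ∈ r × (∀ {x} → x ∈ r → x < 85) × Kind t r

      single : ∀ {x y : ℕ} → x ∈ y ∷ [] → x ≡ y
      single (here e) = e

      judge⁻ : ∀ t {pts r} → judge (rows t) pts r ≡ true → Kind t r ⊎ conflict pts ≡ true
      judge⁻ t {pts} {r} e = first (∨-true {(length r ≡ᵇ 7) ∧ (distinct r ∧ matched)} {(r ⊆ᵇ f8) ∨ conflict pts} e)
        where
          f8 : List ℕ
          f8 = 84 ∷ []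
          matched : Bool
          matched = elem 84 r ∨ exists (same r) (rows t)
          Matched : Set
          Matched = 84 ∈ r ⊎ ∃[ s ] s ∈ rows t × (∀ {x} → x ∈ r → x ∈ s) × (∀ {x} → x ∈ s → x ∈ r)
          match : elem 84 r ≡ true ⊎ exists (same r) (rows t) ≡ true → Matched
          match (inj₁ h) = inj₁ (elem⁻ r h)
          match (inj₂ h) =
            let s , s∈ , h′ = exists⁻ {f = same r} (rows t) h
            in inj₂ (s , s∈ , ⊆ᵇ⁻ {r} {s} (proj₁ (∧-true {r ⊆ᵇ s} h′)) , ⊆ᵇ⁻ {s} {r} (∧-true² {r ⊆ᵇ s} h′))
          regular : (length r ≡ᵇ 7) ≡ true → (distinct r ∧ matched) ≡ true → Kind t r
          regular e₁ e₂ = inj₂ (≡ᵇ-true {length r} {7} e₁ , distinct⁻ r (proj₁ (∧-true {distinct r} e₂)) ,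
            match (∨-true {elem 84 r} (∧-true² {distinct r} e₂)))
          second : (r ⊆ᵇ f8) ≡ true ⊎ conflict pts ≡ true → Kind t r ⊎ conflict pts ≡ true
          second (inj₁ h) = inj₁ (inj₁ λ x∈ → single (⊆ᵇ⁻ {r} {f8} h x∈))
          second (inj₂ h) = inj₂ h
          first : ((length r ≡ᵇ 7) ∧ (distinct r ∧ matched)) ≡ true ⊎ ((r ⊆ᵇ f8) ∨ conflict pts) ≡ true →
            Kind t r ⊎ conflict pts ≡ true
          first (inj₁ h) = inj₁ (regular (proj₁ (∧-true {length r ≡ᵇ 7} h)) (∧-true² {length r ≡ᵇ 7} h))
          first (inj₂ h) = second (∨-true {r ⊆ᵇ f8} h)

      module Plane {i : Fin n} {pts : List ℕ} (pts< : All (_< 511) pts) (on : ∀ {x} → x ∈ pts → Mem i x)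
          (all : ∀ {x} → x < 511 → Mem i x → x ∈ pts) where

        ClassOf : ℕ → Set
        ClassOf t = ∃[ x ] ∃[ y ] x ∈ pts × y ∈ pts × x ≢ y × t ≡ class (diff x y)

        classes⁻ : ∀ zs → (∀ {x} → x ∈ zs → x ∈ pts) → Unique zs → ∀ {t} → t ∈ classes zs → ClassOf t
        classes⁻ (x ∷ xs) sub (x∉ ∷ u) m = go xs (λ y∈ → y∈) m
          where
            go : ∀ ys → (∀ {y} → y ∈ ys → y ∈ xs) → ∀ {t} → t ∈ classesFrom x ys xs → ClassOf t
            go [] h m = classes⁻ xs (λ y∈ → sub (there y∈)) u m
            go (y ∷ ys) h (here refl) =
              x , y , sub (here refl) , sub (there (h (here refl))) , All.lookup x∉ (h (here refl)) , refl
            go (y ∷ ys) h (there m) = go ys (λ z∈ → h (there z∈)) m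

        later : ∀ {x y} ys zs → y ∈ ys → class (diff x y) ∈ classesFrom x ys zs
        later (_ ∷ ys) zs (here refl) = here refl
        later (_ ∷ ys) zs (there y∈) = there (later ys zs y∈)

        skip : ∀ {t x} ys zs → t ∈ classes zs → t ∈ classesFrom x ys zs
        skip [] zs m = m
        skip (_ ∷ ys) zs m = there (skip ys zs m)

        classes⁺ : ∀ {x y} zs → x ∈ zs → y ∈ zs → x ≢ y → class (diff x y) ∈ classes zs ⊎ class (diff y x) ∈ classes zs
        classes⁺ (z ∷ zs) (here refl) (here refl) x≢y = ⊥-elim (x≢y refl)
        classes⁺ (z ∷ zs) (here refl) (there y∈) _ = inj₁ (later zs zs y∈)
        classes⁺ (z ∷ zs) (there x∈) (here refl) _ = inj₂ (later zs zs x∈)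
        classes⁺ (z ∷ zs) (there x∈) (there y∈) x≢y with classes⁺ zs x∈ y∈ x≢y
        ... | inj₁ m = inj₁ (skip zs zs m)
        ... | inj₂ m = inj₂ (skip zs zs m)

        diff-sym : ∀ {x y} → x < 511 → y < 511 → x ≢ y → diff y x ≡ 511 ∸ diff x y
        diff-sym {x} {y} x< y< x≢y = ≈⇒≡ (diff< y x)
          (∸-monoʳ-< {511} {diff x y} {0} (diff-pos x< y< x≢y) (<⇒≤ (diff< x y)))
          (diff-unique y x _ y< (≈-trans (+-cong (≈-sym (+diff x y x<)) (≈-refl {511 ∸ diff x y}))
            (≈-trans (≡⇒≈ (+-assoc x (diff x y) _)) (≈-trans (+-cong (≈-refl {x}) (inverse≈ (diff< x y))) (≡⇒≈ (+-identityʳ x))))))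

        -- `classes` lists each pair in one order only; the symmetry of `class` under d ↦ -d
        -- supplies the other.
        class∈ : ∀ {x y} → x ∈ pts → y ∈ pts → x ≢ y → class (diff x y) ∈ classes pts
        class∈ {x} {y} x∈ y∈ x≢y with classes⁺ pts x∈ y∈ x≢y
        ... | inj₁ m = m
        ... | inj₂ m = subst (_∈ classes pts)
          (trans (cong class (diff-sym x< y< x≢y)) (class-sym (diff-pos x< y< x≢y) (diff< x y))) m
          where
            x< = All.lookup pts< x∈
            y< = All.lookup pts< y∈

        solution : Unique pts → Solution Mem (nub (classes pts))
        solution u = i , λ {t} t< → from t , to t<
          where
            from : ∀ t → t ∈ nub (classes pts) → Contains Mem i t
            from t m with classes⁻ pts (λ x∈ → x∈) u (nub⁻ (classes pts) m)
            ... | x , y , x∈ , y∈ , x≢y , refl =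
              canon (All.lookup pts< x∈) (All.lookup pts< y∈) x≢y (on x∈) (on y∈)
            to : ∀ {t} → t < 85 → Contains Mem i t → t ∈ nub (classes pts)
            to {t} t< (a , ma , mb) = nub⁺ (classes pts) (subst (_∈ classes pts) eq (class∈ x∈ y∈ x≢y))
              where
                x = a % 511
                y = (a + span t) % 511
                x∈ : x ∈ pts
                x∈ = all (%< a) (respects (≈-sym (%≈ a)) ma)
                y∈ : y ∈ pts
                y∈ = all (%< (a + span t)) (respects (≈-sym (%≈ (a + span t))) mb)
                d≡ : diff x y ≡ span t
                d≡ = trans (diff-+ a (span t)) (m<n⇒m%n≡m (span< t<))
                eq : class (diff x y) ≡ t
                eq = trans (cong class d≡) (class-span t<)
                x≢y : x ≢ y
                x≢y = +≢ a (span t) (span≢0 t<)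

        classes< : Unique pts → ∀ {t} → t ∈ nub (classes pts) → t < 85
        classes< u m with classes⁻ pts (λ x∈ → x∈) u (nub⁻ (classes pts) m)
        ... | x , y , x∈ , y∈ , x≢y , refl =
          class< (diff-pos (All.lookup pts< x∈) (All.lookup pts< y∈) x≢y) (diff< x y)

        -- The translate by `diff x y` shares with the block the two different points `y` and
        -- `w + diff x y`, so it is the block itself and contains the image of `v`.
        shift-closed : ∀ {x y w v} → x ∈ pts → y ∈ pts → w ∈ pts → v ∈ pts → w ≢ x →
          (w + diff x y) % 511 ∈ pts → (v + diff x y) % 511 ∈ pts
        shift-closed {x} {y} {w} {v} x∈ y∈ w∈ v∈ w≢x w′∈ = go (shift i k)
          where
            k = diff x y
            x< : x < 511
            x< = All.lookup pts< x∈
            go : (∃[ j ] ∀ c → (Mem i c → Mem j (c + k)) × (Mem j (c + k) → Mem i c)) → (v + k) % 511 ∈ pts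
            go (j , sh) = all (%< (v + k)) (respects (≈-sym (%≈ (v + k))) (subst (λ j → Mem j (v + k)) j≡i (proj₁ (sh v) (on v∈))))
              where
                at-x : Mem j y
                at-x = respects {j} {x + k} {y} (+diff x y x<) (proj₁ (sh x) (on x∈))
                at-w : Mem j ((w + k) % 511)
                at-w = respects (≈-sym (%≈ (w + k))) (proj₁ (sh w) (on w∈))
                y≢ : y ≢ (w + k) % 511
                y≢ h = w≢x (+diff-injective x< (All.lookup pts< w∈) h)
                j≡i : j ≡ i
                j≡i = unique (All.lookup pts< y∈) (%< (w + k)) y≢ at-x at-w (on y∈) (on w′∈)

        no-conflict : Conflict pts → ⊥
        no-conflict (x , y , w , v , x∈ , y∈ , w∈ , v∈ , w≢x , stay , leave) =
          leave (shift-closed x∈ y∈ w∈ v∈ w≢x stay)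

        conclude : ∀ {t} → judgePlane (rows t) pts ≡ true → t ∈ classes pts → Through t
        conclude {t} g t∈ with judge⁻ t {pts} {nub (classes pts)} (∧-true² {distinct pts} g)
        ... | inj₁ k = nub (classes pts) , solution u , nub⁺ (classes pts) t∈ , classes< u , k
          where
            u : Unique pts
            u = distinct⁻ pts (proj₁ (∧-true g))
        ... | inj₂ c = ⊥-elim (no-conflict (conflict⁻ pts c))

      -- The block through 0 and `span t` represents all blocks with a line of class `t`. A third
      -- point off that line determines its plane; since `classify` judges only the least such
      -- point, the proof descends from any of them to smaller ones in the same block.
      through : ∀ {t} → t < 85 → Through t
      through {t} t< = start (join {0} {d} 0< (span< t<) 0≢d)
        where
          d = span t
          0≢d : 0 ≢ d
          0≢d = <⇒≢ (span-pos t<)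
          0< : 0 < 511
          0< = s≤s z≤n
          z = tri 0 d
          ls = 0 ∷ d ∷ z ∷ []
          module Block {i} (m0 : Mem i 0) (md : Mem i d) where
            mz : Mem i z
            mz = sum 0< (span< t<) 0≢d m0 md
            module _ {c} (c< : c < 511) (mc : Mem i c) (c∉ : c ∉ ls) where
              off₀ : Mem i (tri 0 c)
              off₀ = sum 0< c< (λ e → c∉ (here (sym e))) m0 mc
              off₁ : Mem i (tri d c)
              off₁ = sum (span< t<) c< (λ e → c∉ (there (here (sym e)))) md mc
              off₂ : Mem i (tri z c)
              off₂ = sum (tri< 0 d) c< (λ e → c∉ (there (there (here (sym e))))) mz mc
              off : ∀ {p} → p ∈ tri 0 c ∷ tri d c ∷ tri z c ∷ [] → Mem i p
              off (here refl) = off₀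
              off (there (here refl)) = off₁
              off (there (there (here refl))) = off₂
              on : ∀ {p} → p ∈ plane 0 d c → Mem i p
              on (here refl) = m0
              on (there (here refl)) = md
              on (there (there (here refl))) = mz
              on (there (there (there (here refl)))) = mc
              on (there (there (there (there (here refl))))) = off₀
              on (there (there (there (there (there (here refl)))))) = off₁
              on (there (there (there (there (there (there (here refl))))))) = off₂
            go : ∀ c → Acc _<_ c → c < 511 → Mem i c → c ∉ ls → Through t
            split : ∀ {c} → Acc _<_ c → c < 511 → Mem i c → c ∉ ls →
              c ∈ ls ⊎ (∃[ p ] p ∈ tri 0 c ∷ tri d c ∷ tri z c ∷ [] × p < c × p ∉ ls) ⊎ judgePlane (rows t) (plane 0 d c) ≡ true →
              Through t
            go c ac c< mc c∉ = split ac c< mc c∉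
              (judgeLeast⁻ (rows t) ls (tri 0 c ∷ tri d c ∷ tri z c ∷ []) c (plane 0 d c) (classified t< c<))
            split _ _ _ c∉ (inj₁ c∈) = ⊥-elim (c∉ c∈)
            split (acc rec) c< mc c∉ (inj₂ (inj₁ (p , p∈ , p<c , p∉))) =
              go p (rec p<c) (<-trans p<c c<) (off c< mc c∉ p∈) p∉
            split {c} _ c< mc c∉ (inj₂ (inj₂ g)) =
              Plane.conclude {i} {plane 0 d c} (plane< 0< (span< t<) c<) (on c< mc c∉)
                (λ x< mx → exact 0< (span< t<) c< x< 0≢d c∉ m0 md mc mx) g
                (subst (_∈ classes (plane 0 d c)) (trans (cong class d≡) (class-span t<)) (here refl))
              where
                d≡ : diff 0 d ≡ d
                d≡ = ≈⇒≡ (diff< 0 d) (span< t<) (diff-unique 0 d d 0< ≈-refl)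
          start : (∃[ i ] Mem i 0 × Mem i d) → Through t
          start (i , m0 , md) =
            let c , c< , mc , c∉ = third 0< (span< t<) 0≢d m0 md
            in Block.go m0 md c (<-wellFounded c) c< mc c∉

      -- 85 is not divisible by 7, so some block is an orbit of the multiplicative group of F₈.
      Special : Set
      Special = ∃[ r ] Solution Mem r × 84 ∈ r × (∀ {x} → x ∈ r → x ≡ 84)

      Regular : ℕ → Set
      Regular t = ∃[ r ] Solution Mem r × t ∈ r × Unique r × length r ≡ 7 × (∀ {x} → x ∈ r → x < 85)

      classify-through : ∀ {t} → Through t → Special ⊎ Regular t
      classify-through (r , sol , t∈ , _ , inj₁ only) = inj₁ (r , sol , subst (_∈ r) (only t∈) t∈ , only)
      classify-through (r , sol , t∈ , r< , inj₂ (len , u , _)) = inj₂ (r , sol , t∈ , u , len , r<)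

      dichotomy : Special ⊎ (∀ {t} → t < 85 → Regular t)
      dichotomy = first-or-all {Special} {Regular} 85 (λ {t} t< → classify-through {t} (through {t} t<))

      special : Special
      special = exclude dichotomy
        where
          Bounded : List ℕ → Set
          Bounded r = Solution Mem r × (∀ {x} → x ∈ r → x < 85)
          part : ∀ {x} → Regular x → ∃[ r ] Bounded r × x ∈ r × Unique r × length r ≡ 7 × (∀ {y} → y ∈ r → y ∈ upTo 85)
          part (r , s , x∈r , u , len , r<) = r , (s , r<) , x∈r , u , len , λ y∈ → ∈-upTo⁺ {85} (r< y∈)
          together : ∀ {r r′ x} → Bounded r → Bounded r′ → x ∈ r → x ∈ r′ → ∀ {y} → y ∈ r → y ∈ r′
          together (s , r<) (s′ , _) x∈ x∈′ y∈ = meets (r< x∈) s s′ x∈ x∈′ (r< y∈) y∈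
          exclude : Special ⊎ (∀ {t} → t < 85 → Regular t) → Special
          exclude (inj₁ s) = s
          exclude (inj₂ f) = ⊥-elim (from-no (7 ∣? 85) (subst (7 ∣_) (length-upTo 85)
            (partition-∣ 7 Bounded together (upTo 85) (upTo⁺ 85) (λ {x} x∈ → part {x} (f {x} (∈-upTo⁻ {85} x∈))))))

      -- A set containing both `t` and 84 would share 84 with the special block, and by `meets` `t`
      -- would belong to that block too, whose only class is 84.
      covers : ∀ {t} → t < 84 → ∃[ s ] s ∈ rows t × Solution Mem s × t ∈ s
      covers {t} t< = choose (through {t} (m≤n⇒m≤1+n t<)) special
        where
          choose : Through t → Special → ∃[ s ] s ∈ rows t × Solution Mem s × t ∈ s
          choose (r , sol , t∈ , r< , inj₁ only) _ = ⊥-elim (<⇒≢ t< (only t∈))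
          choose (r , sol , t∈ , r< , inj₂ (_ , _ , inj₁ 84∈)) (s , sol′ , 84∈s , only) =
            ⊥-elim (<⇒≢ t< (only (meets ≤-refl sol sol′ 84∈ 84∈s (r< t∈) t∈)))
          choose (r , (i , f) , t∈ , r< , inj₂ (_ , _ , inj₂ (s , s∈ , r⊆ , ⊆r))) _ =
            s , s∈ , (i , λ u< → (λ u∈ → proj₁ (f u<) (⊆r u∈)) , (λ c → r⊆ (proj₂ (f u<) c))) , r⊆ t∈

    -- This lets one 7-set speak for its whole Frobenius orbit: using the rotated set in a geometry
    -- amounts to using the set itself in the twisted geometry.
    untwist : ∀ {n} {Mem : Fin n → ℕ → Set} → Geometry Mem → ∀ {r} → All (_< 85) r →
      Solution Mem (map rot r) → Solution (twist Mem) r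
    untwist {n} {Mem} G {r} r< (i , f) = i , λ {t} t< → into t< , out t<
      where
        open Geometry G
        2span≢0 : ∀ {t} → t < 85 → 2 * span t % 511 ≢ 0
        2span≢0 {t} t< e = span≢0 G t< (un≈ (double-injective≈ {span t} {0} (mk≈ e)))
        half≢0 : ∀ {t} → t < 85 → h * span t % 511 ≢ 0
        half≢0 {t} t< e = span≢0 G t< (un≈ (≈-trans (≈-sym (half′≈ (span t))) (*-congʳ 2 {h * span t} {0} (mk≈ e))))
        rot< : ∀ {t} → t < 85 → rot t < 85
        rot< {t} t< = class< (n≢0⇒n>0 (2span≢0 t<)) (%< (2 * span t))
        out : ∀ {t} → t < 85 → Contains (twist Mem) i t → t ∈ r
        out {t} t< (a , ma , mb) = unmap (∈-map⁻ rot (proj₂ (f (rot< t<))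
            (canon-+ G (2 * a) (2 * span t) ma (subst (Mem i) (*-distribˡ-+ 2 a (span t)) mb) (2span≢0 t<))))
          where
            unmap : ∃[ u ] u ∈ r × rot t ≡ rot u → t ∈ r
            unmap (u , u∈ , e) = subst (_∈ r)
              (trans (sym (unrot-rot (All.lookup r< u∈))) (trans (cong (unrot h) (sym e)) (unrot-rot t<))) u∈
        into : ∀ {t} → t < 85 → t ∈ r → Contains (twist Mem) i t
        into {t} t< t∈ = back (proj₁ (f (rot< t<)) (∈-map⁺ rot t∈))
          where
            e = span (rot t)
            back : Contains Mem i (rot t) → Contains (twist Mem) i t
            -- The halves of the two exponents lie in the twisted block, and their difference
            -- `h * e` has class `unrot h (rot t)`, which is `t`.
            back (a , ma , mb) = subst (Contains (twist Mem) i) (unrot-rot t<)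
              (canon-+ (frobenius G) (h * a) (h * e) (respects (≈-sym (half′≈ a)) ma)
                (respects (≈-sym (≈-trans (*-congʳ 2 (≡⇒≈ (sym (*-distribˡ-+ h a e)))) (half′≈ (a + e)))) mb)
                (half≢0 (rot< t<)))

-- The numbers X by Chinese remaindering, and refutation root by root.

module Refute (rot : ℕ → ℕ) where

  open import Data.Nat

  open import Agda.Builtin.Nat using (mod-helper; div-helper)
  open import Data.Bool using (Bool; true; false; _∧_; if_then_else_)
  open import Data.Nat.Properties
  open import Data.Nat.DivMod hiding (_%_)
  open import Data.Nat.Divisibility
  open import Data.List using (List; []; _∷_; _++_; map)
  open import Data.List.Membership.Propositional using (_∈_; _∉_)
  open import Data.List.Membership.Propositional.Properties using (∈-++⁻)
  open import Data.List.Relation.Unary.Any using (here; there)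
  open import Data.List.Relation.Unary.All as All using (All; []; _∷_)
  open import Data.List.Relation.Unary.All.Properties using (map⁺)
  open import Data.Product using (∃-syntax; _×_; _,_; proj₁; proj₂)
  open import Data.Sum using (inj₁; inj₂)
  open import Data.Empty using (⊥; ⊥-elim)
  open import Function using (_∘_)
  open import Relation.Nullary using (¬_; yes; no)
  open import Relation.Binary.PropositionalEquality
  open Search
  open Lists

  nth : {A : Set} → A → List A → ℕ → A
  nth a []       _       = a
  nth a (x ∷ xs) zero    = x
  nth a (x ∷ xs) (suc n) = nth a xs n

  -- The index `o` numbers the Frobenius orbit of the 7-set, so that orbits already refuted can be
  -- filtered out by a comparison.
  data Entry : Set where
    entry : (o : ℕ) (s : List ℕ) → Entry

  data Row : Set where
    row : (o p x : ℕ) (s : List ℕ) → Row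

  equalᵇ : List ℕ → List ℕ → Bool
  equalᵇ []       []       = true
  equalᵇ (x ∷ xs) (y ∷ ys) = (x ≡ᵇ y) ∧ equalᵇ xs ys
  equalᵇ _        _        = false

  rotated : ℕ → List ℕ → List ℕ
  rotated zero    s = s
  rotated (suc j) s = map rot (rotated j s)

  period : List ℕ → ℕ
  period s = if s ⊆ᵇ rotated 3 s then 3 else 9

  orbit : ℕ → ℕ → List ℕ → List Entry
  orbit o zero    s = []
  orbit o (suc n) s = entry o s ∷ orbit o n (map rot s)

  entries : ℕ → List (List ℕ) → List Entry
  entries o []       = []
  entries o (s ∷ ss) = orbit o (period s) s ++ entries (suc o) ss

  itemLists : ℕ → List Entry → List (List ℕ)
  itemLists t []               = []
  itemLists t (entry o s ∷ es) = if elem t s then s ∷ itemLists t es else itemLists t es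

  prime : ℕ → List ℕ → Bool
  prime n []       = true
  prime n (d ∷ ds) = if n <ᵇ d * d then true else check (mod-helper 0 (pred d) n (pred d))
    where
      check : ℕ → Bool
      check zero    = false
      check (suc _) = prime n ds

  -- The candidates stay below 109 + 12000 < 113², so trial division by the primes up to 109
  -- suffices.
  divisors : List ℕ
  divisors = 2 ∷ 3 ∷ 5 ∷ 7 ∷ 11 ∷ 13 ∷ 17 ∷ 19 ∷ 23 ∷ 29 ∷ 31 ∷ 37 ∷ 41 ∷ 43 ∷ 47 ∷ 53 ∷ 59 ∷ 61 ∷ 67 ∷ 71 ∷
    73 ∷ 79 ∷ 83 ∷ 89 ∷ 97 ∷ 101 ∷ 103 ∷ 107 ∷ 109 ∷ []

  primes : ℕ → ℕ → List ℕ
  primes zero    n = []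
  primes (suc f) n = if prime n divisors then n ∷ primes f (suc n) else primes f (suc n)

  assign : List ℕ → List Entry → List Row
  assign _        []               = []
  assign []       (entry o s ∷ es) = row o 0 0 s ∷ assign [] es
  assign (p ∷ ps) (entry o s ∷ es) = row o (pred p) 0 s ∷ assign ps es

  modulusOf : List Row → ℕ
  modulusOf []                 = 1
  modulusOf (row _ p _ _ ∷ rs) = suc p * modulusOf rs

  -- Binary exponentiation modulo `suc m`; the first argument is fuel, bounding the number of binary
  -- digits of `e`.
  power : ℕ → (b e m : ℕ) → ℕ
  power zero    b e       m = 1
  power (suc f) b zero    m = 1
  power (suc f) b (suc e) m =
    odd (mod-helper 0 1 (suc e) 1) (power f (mod-helper 0 m (b * b) m) (div-helper 0 1 (suc e) 1) m)
    where
      odd : ℕ → ℕ → ℕ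
      odd zero    r = r
      odd (suc _) r = mod-helper 0 m (b * r) m

  -- By Fermat's little theorem the summand of a row is 1 modulo its own prime and 0 modulo the others.
  indicator : ℕ → List Row → ℕ → ℕ
  indicator M []                 i = 0
  indicator M (row _ p _ s ∷ rs) i =
    if elem i s then summand (div-helper 0 p M p) + indicator M rs i else indicator M rs i
    where
      summand : ℕ → ℕ
      summand N = N * power 16 (mod-helper 0 p N p) (pred p) p

  upFrom : ℕ → ℕ → List ℕ
  upFrom zero    i = []
  upFrom (suc n) i = i ∷ upFrom n (suc i)

  -- This is 1 - z modulo `suc M`, lifted by the modulus to stay nonnegative for reduced `z`.
  complement : ℕ → ℕ → ℕ
  complement M z = suc (suc M) ∸ z

  productMod : ℕ → (ℕ → ℕ) → List ℕ → ℕ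
  productMod M f []       = 1
  productMod M f (i ∷ is) = mod-helper 0 M (f i * productMod M f is) M

  -- This is X(s), namely ∏ (1 - zᵢ) + ∏ zᵢ over i in `s`, where zᵢ modulo p(Q) tells whether i lies
  -- in Q. The first product is 1 when `s` misses Q, the second when `s` lies inside Q, and a
  -- partial overlap kills both.
  value : ℕ → List ℕ → List ℕ → ℕ
  value M zs s =
    mod-helper 0 M (productMod M (λ i → complement M (nth 0 zs i)) s + productMod M (nth 0 zs) s) M

  evaluate : ℕ → List ℕ → List Row → List Row
  evaluate M zs []                 = []
  evaluate M zs (row o p _ s ∷ rs) = row o p (value M zs s) s ∷ evaluate M zs rs

  -- Certifies the remainders directly for each row, so the proof relies on the residues found and
  -- not on how the numbers were computed.
  residues : (M p : ℕ) → List ℕ → ℕ → List ℕ → Bool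
  residues M p s i []       = true
  residues M p s i (z ∷ zs) =
    (if elem i s
     then (mod-helper 0 p z p ≡ᵇ 1) ∧ (mod-helper 0 p (complement M z) p ≡ᵇ 0)
     else (mod-helper 0 p z p ≡ᵇ 0) ∧ (mod-helper 0 p (complement M z) p ≡ᵇ 1)) ∧ residues M p s (suc i) zs

  -- The empty set is refused: both products in `value` would be 1 and their sum 2.
  bounded : List ℕ → Bool
  bounded []       = false
  bounded (x ∷ xs) = every (λ i → i <ᵇ 84) (x ∷ xs)

  rowOK : ℕ → List ℕ → Row → Bool
  rowOK M zs (row o p x s) =
    (mod-helper 0 p (suc M) p ≡ᵇ 0) ∧ (bounded s ∧ residues M p s 0 zs)

  containing : ℕ → List Row → List Row
  containing i []                 = []
  containing i (row o p x s ∷ rs) = if elem i s then row o p x s ∷ containing i rs else containing i rs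

  groups : List ℕ → List Row → List (List Row)
  groups []       rs = []
  groups (i ∷ is) rs = containing i rs ∷ groups is rs

  options : ℕ → List Row → Options
  options k []                 = []
  options k (row o p x _ ∷ rs) = if o <ᵇ k then options k rs else opt p x (options k rs)

  items : ℕ → List (List Row) → List Item
  items k []       = []
  items k (g ∷ gs) = build (options k g) ∷ items k gs

  seek : List ℕ → List Row → (ℕ → ℕ → Bool) → Bool
  seek r []                 f = false
  seek r (row o p x s ∷ rs) f = if equalᵇ r s then f x p else seek r rs f

  earlier : ℕ → Row → Bool
  earlier k (row o _ _ _) = o <ᵇ k

  -- Item 81 lies on the short Frobenius cycle, so few orbits of 7-sets contain a set through it.
  -- Once they are refuted, the final test finds no set left to cover 81.
  refute : List ℕ → ℕ → ℕ → List (List ℕ) → List Row → List (List Row) → Bool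
  refute ks zero    k reps       rows gs = every (earlier k) (containing 81 rows)
  refute ks (suc n) k []         rows gs = false
  refute ks (suc n) k (r ∷ reps) rows gs =
    seek r rows (λ x p → step ks 0 x p (items k gs)) ∧ refute ks n (suc k) reps rows gs

  equalᵇ⁻ : ∀ xs ys → equalᵇ xs ys ≡ true → xs ≡ ys
  equalᵇ⁻ [] [] e = refl
  equalᵇ⁻ (x ∷ xs) (y ∷ ys) e =
    cong₂ _∷_ (≡ᵇ-true (proj₁ (∧-true e))) (equalᵇ⁻ xs ys (∧-true² {x ≡ᵇ y} e))

  seek⁻ : ∀ r rs {f} → seek r rs f ≡ true → ∃[ o ] ∃[ p ] ∃[ x ] row o p x r ∈ rs × f x p ≡ true
  seek⁻ r (row o p x s ∷ rs) e with equalᵇ r s in eq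
  ... | true  = o , p , x , here (cong (row o p x) (equalᵇ⁻ r s eq)) , e
  ... | false with seek⁻ r rs e
  ... | o′ , p′ , x′ , m , e′ = o′ , p′ , x′ , there m , e′

  orbit⁻ : ∀ o n j r {e} → e ∈ orbit o n (rotated j r) → ∃[ i ] e ≡ entry o (rotated i r)
  orbit⁻ o (suc n) j r (here refl) = j , refl
  orbit⁻ o (suc n) j r (there m) = orbit⁻ o n (suc j) r m

  entries⁻ : ∀ k reps {o s} → entry o s ∈ entries k reps → ∃[ m ] ∃[ j ] o ≡ k + m × s ≡ rotated j (nth [] reps m)
  entries⁻ k (r ∷ reps) m with ∈-++⁻ (orbit k (period r) r) m
  ... | inj₁ m₁ with orbit⁻ k (period r) 0 r m₁
  ... | j , refl = 0 , j , sym (+-identityʳ k) , refl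
  entries⁻ k (r ∷ reps) m | inj₂ m₂ with entries⁻ (suc k) reps m₂
  ... | i , j , refl , e = suc i , j , sym (+-suc k i) , e

  itemLists⁻ : ∀ t es {s} → s ∈ itemLists t es → ∃[ o ] entry o s ∈ es
  itemLists⁻ t (entry o s ∷ es) m with elem t s
  itemLists⁻ t (entry o s ∷ es) (here refl) | true = o , here refl
  itemLists⁻ t (entry o s ∷ es) (there m) | true with itemLists⁻ t es m
  ... | o′ , m′ = o′ , there m′
  itemLists⁻ t (entry o s ∷ es) m | false with itemLists⁻ t es m
  ... | o′ , m′ = o′ , there m′

  assign⁺ : ∀ ps es {o s} → entry o s ∈ es → ∃[ p ] row o p 0 s ∈ assign ps es
  assign⁺ [] (_ ∷ es) (here refl) = 0 , here refl
  assign⁺ (p ∷ ps) (_ ∷ es) (here refl) = pred p , here refl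
  assign⁺ [] (entry _ _ ∷ es) (there m) with assign⁺ [] es m
  ... | p , m′ = p , there m′
  assign⁺ (_ ∷ ps) (entry _ _ ∷ es) (there m) with assign⁺ ps es m
  ... | p , m′ = p , there m′

  assign⁻ : ∀ ps es {o p x s} → row o p x s ∈ assign ps es → entry o s ∈ es
  assign⁻ [] (entry _ _ ∷ es) (here refl) = here refl
  assign⁻ (_ ∷ ps) (entry _ _ ∷ es) (here refl) = here refl
  assign⁻ [] (entry _ _ ∷ es) (there m) = there (assign⁻ [] es m)
  assign⁻ (_ ∷ ps) (entry _ _ ∷ es) (there m) = there (assign⁻ ps es m)

  evaluate⁺ : ∀ M zs rs {o p x s} → row o p x s ∈ rs → row o p (value M zs s) s ∈ evaluate M zs rs
  evaluate⁺ M zs (row _ _ _ _ ∷ rs) (here refl) = here refl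
  evaluate⁺ M zs (row _ _ _ _ ∷ rs) (there m) = there (evaluate⁺ M zs rs m)

  evaluate⁻ : ∀ M zs rs {o p x s} → row o p x s ∈ evaluate M zs rs →
    x ≡ value M zs s × ∃[ x′ ] row o p x′ s ∈ rs
  evaluate⁻ M zs (row o p x s ∷ rs) (here refl) = refl , x , here refl
  evaluate⁻ M zs (row o p x s ∷ rs) (there m) with evaluate⁻ M zs rs m
  ... | e , x′ , m′ = e , x′ , there m′

  containing⁺ : ∀ i rs {o p x s} → row o p x s ∈ rs → i ∈ s → row o p x s ∈ containing i rs
  containing⁺ i (row o p x s ∷ rs) m i∈ with elem i s in eq
  containing⁺ i (row o p x s ∷ rs) (here refl) i∈ | true = here refl
  containing⁺ i (row o p x s ∷ rs) (there m) i∈ | true = there (containing⁺ i rs m i∈)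
  containing⁺ i (row o p x s ∷ rs) (here refl) i∈ | false with () ← trans (sym eq) (elem⁺ i∈)
  containing⁺ i (row o p x s ∷ rs) (there m) i∈ | false = containing⁺ i rs m i∈

  residues⁻ : ∀ M p s i zs → residues M p s i zs ≡ true → ∀ {j z} → nth 0 zs j ≡ z → j < Data.List.length zs →
    (i + j ∈ s → z % suc p ≡ 1 × complement M z % suc p ≡ 0) × (i + j ∉ s → z % suc p ≡ 0 × complement M z % suc p ≡ 1)
  residues⁻ M p s i (z ∷ zs) e {zero} refl _ rewrite +-identityʳ i with elem i s in eq
  ... | true  = (λ _ → both) , λ i∉ → ⊥-elim (i∉ (elem⁻ s eq))
    where
      both : z % suc p ≡ 1 × complement M z % suc p ≡ 0
      both = let c = proj₁ (∧-true e) in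
        ≡ᵇ-true (proj₁ (∧-true c)) , ≡ᵇ-true (∧-true² {mod-helper 0 p z p ≡ᵇ 1} c)
  ... | false = (λ i∈ → ⊥-elim (absurd (trans (sym eq) (elem⁺ i∈)))) , λ _ → both
    where
      absurd : false ≢ true
      absurd ()
      both : z % suc p ≡ 0 × complement M z % suc p ≡ 1
      both = let c = proj₁ (∧-true e) in
        ≡ᵇ-true (proj₁ (∧-true c)) , ≡ᵇ-true (∧-true² {mod-helper 0 p z p ≡ᵇ 0} c)
  residues⁻ M p s i (z ∷ zs) e {suc j} eq (s≤s j<) rewrite +-suc i j =
    residues⁻ M p s (suc i) zs (∧-true² {if elem i s then _ else _} e) eq j<

  module Numbers {M p : ℕ} (p∣M : suc p ∣ suc M) (p≢0 : 1 % suc p ≡ 1) where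

    reduce-* : ∀ a b → mod-helper 0 M (a * b) M % suc p ≡ (a % suc p) * (b % suc p) % suc p
    reduce-* a b = trans (m∣n⇒o%n%m≡o%m (suc p) (suc M) (a * b) p∣M) (%-distribˡ-* a b (suc p))

    product-1 : ∀ f s → (∀ {i} → i ∈ s → f i % suc p ≡ 1) → productMod M f s % suc p ≡ 1
    product-1 f [] h = p≢0
    product-1 f (i ∷ is) h = trans (reduce-* (f i) (productMod M f is))
      (trans (cong₂ (λ u v → u * v % suc p) (h (here refl)) (product-1 f is (λ m → h (there m)))) p≢0)

    product-0 : ∀ f i is → f i % suc p ≡ 0 → productMod M f (i ∷ is) % suc p ≡ 0
    product-0 f i is h = trans (reduce-* (f i) (productMod M f is))
      (cong (λ u → u * (productMod M f is % suc p) % suc p) h)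

    sum-mod : ∀ a b → mod-helper 0 M (a + b) M % suc p ≡ (a % suc p + b % suc p) % suc p
    sum-mod a b = trans (m∣n⇒o%n%m≡o%m (suc p) (suc M) (a + b) p∣M) (%-distribˡ-+ a b (suc p))

    value-disjoint : ∀ zs i is → (∀ {j} → j ∈ i ∷ is → nth 0 zs j % suc p ≡ 0 × complement M (nth 0 zs j) % suc p ≡ 1) →
      value M zs (i ∷ is) % suc p ≡ 1
    value-disjoint zs i is h = trans (sum-mod (productMod M y (i ∷ is)) (productMod M (nth 0 zs) (i ∷ is)))
      (trans (cong₂ (λ u v → (u + v) % suc p) (product-1 y (i ∷ is) (λ m → proj₂ (h m)))
        (product-0 (nth 0 zs) i is (proj₁ (h (here refl))))) p≢0)
      where
        y : ℕ → ℕ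
        y i = complement M (nth 0 zs i)

    value-inside : ∀ zs i is → (∀ {j} → j ∈ i ∷ is → nth 0 zs j % suc p ≡ 1 × complement M (nth 0 zs j) % suc p ≡ 0) →
      value M zs (i ∷ is) % suc p ≡ 1
    value-inside zs i is h = trans (sum-mod (productMod M y (i ∷ is)) (productMod M (nth 0 zs) (i ∷ is)))
      (trans (cong₂ (λ u v → (u + v) % suc p) (product-0 y i is (proj₂ (h (here refl))))
        (product-1 (nth 0 zs) (i ∷ is) (λ m → proj₁ (h m)))) p≢0)
      where
        y : ℕ → ℕ
        y i = complement M (nth 0 zs i)

  module Sound {I : Set₁} (Sol : I → List ℕ → Set) (twist : I → I)
    (untwist : ∀ {D r} → All (_< 85) r → Sol D (map rot r) → Sol (twist D) r)
    (rot< : ∀ {t} → t < 85 → rot t < 85)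
    (meets : ∀ D {r s t} → t < 85 → Sol D r → Sol D s → t ∈ r → t ∈ s → ∀ {u} → u < 85 → u ∈ r → u ∈ s)
    (reps : List (List ℕ))
    (covers : ∀ D {t} → t < 84 → ∃[ s ] s ∈ itemLists t (entries 0 reps) × Sol D s × t ∈ s)
    (reps-bounded : ∀ k → All (_< 85) (nth [] reps k))
    (M : ℕ) (zs : List ℕ) (zs-length : Data.List.length zs ≡ 84) (ps : List ℕ) where

    es : List Entry
    es = entries 0 reps

    rows : List Row
    rows = evaluate M zs (assign ps es)

    module _ (ok : every (rowOK M zs) rows ≡ true) where

      row-∣ : ∀ {o p x s} → row o p x s ∈ rows → suc p ∣ suc M
      row-∣ {p = p} m = m%n≡0⇒n∣m (suc M) (suc p) (≡ᵇ-true (proj₁ (∧-true (every⁻ ok m))))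

      row-bounded : ∀ {o p x s} → row o p x s ∈ rows → bounded s ≡ true
      row-bounded {p = p} m = proj₁ (∧-true (∧-true² {mod-helper 0 p (suc M) p ≡ᵇ 0} (every⁻ ok m)))

      row-residues : ∀ {o p x s} → row o p x s ∈ rows → ∀ {i} → i < 84 →
        (i ∈ s → nth 0 zs i % suc p ≡ 1 × complement M (nth 0 zs i) % suc p ≡ 0) ×
        (i ∉ s → nth 0 zs i % suc p ≡ 0 × complement M (nth 0 zs i) % suc p ≡ 1)
      row-residues {p = p} {s = s} m i< =
        residues⁻ M p s 0 zs (∧-true² {bounded s} (∧-true² {mod-helper 0 p (suc M) p ≡ᵇ 0} (every⁻ ok m)))
          refl (subst (_ <_) (sym zs-length) i<)

      bounded⁻ : ∀ {s} → bounded s ≡ true → ∀ {i} → i ∈ s → i < 84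
      bounded⁻ {x ∷ xs} b i∈ = <ᵇ-true (every⁻ {xs = x ∷ xs} b i∈)

      -- Either the two sets are disjoint or, sharing a class, `meets` puts `s` inside `s′`; the two
      -- cases are the two summands of `value`.
      row-good : ∀ D {o p x s o′ p′ x′ s′} → row o p x s ∈ rows → row o′ p′ x′ s′ ∈ rows → Sol D s → Sol D s′ →
        x % suc p′ ≡ 1
      row-good D {s = s} {p′ = p′} {s′ = s′} m m′ sol sol′ with evaluate⁻ M zs (assign ps es) m
      row-good D {s = []} m m′ sol sol′ | _ with () ← row-bounded m
      row-good D {s = i ∷ is} {p′ = p′} {s′ = s′} m m′ sol sol′ | refl , _ =
        go (exists (λ j → elem j s′) (i ∷ is)) refl
        where
          s< : ∀ {j} → j ∈ i ∷ is → j < 84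
          s< = bounded⁻ (row-bounded m)
          unit : ∀ s′ → bounded s′ ≡ true → (∀ {j} → j ∈ s′ → nth 0 zs j % suc p′ ≡ 1) → 1 % suc p′ ≡ 1
          unit (j ∷ _) b h = 1%p≡1 p′ (nth 0 zs j) (h (here refl))
          one : 1 % suc p′ ≡ 1
          one = unit s′ (row-bounded m′) (λ j∈ → proj₁ (proj₁ (row-residues m′ (bounded⁻ (row-bounded m′) j∈)) j∈))
          open Numbers {M} {p′} (row-∣ m′) one
          absurd : false ≢ true
          absurd ()
          exists⁺ : ∀ {xs j} → j ∈ xs → j ∈ s′ → exists (λ j → elem j s′) xs ≡ true
          exists⁺ {x ∷ xs} (here refl) j∈ rewrite elem⁺ j∈ = refl
          exists⁺ {x ∷ xs} (there m) j∈ = ∨-trueʳ (elem x s′) (exists⁺ m j∈)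
          go : ∀ b → exists (λ j → elem j s′) (i ∷ is) ≡ b → value M zs (i ∷ is) % suc p′ ≡ 1
          go true e with exists⁻ (i ∷ is) e
          ... | j , j∈ , e′ = value-inside zs i is λ {k} k∈ → proj₁ (row-residues m′ (s< k∈))
            (meets D (m<n⇒m<1+n (s< j∈)) sol sol′ j∈ (elem⁻ s′ e′) (m<n⇒m<1+n (s< k∈)) k∈)
          go false e = value-disjoint zs i is λ {k} k∈ → proj₂ (row-residues m′ (s< k∈))
            (λ k∈′ → absurd (trans (sym e) (exists⁺ k∈ k∈′)))

      Chosen : I → ℕ → Set
      Chosen D p = ∃[ o ] ∃[ x ] ∃[ s ] row o p x s ∈ rows × Sol D s

      -- Quantified over all models, because passing from a rotated 7-set to its representative
      -- replaces the model by a twisted one.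
      Eliminated : ℕ → Set₁
      Eliminated k = ∀ D {o p x s} → row o p x s ∈ rows → o < k → ¬ Sol D s

      covering-row : ∀ D {t} → t < 84 → ∃[ o ] ∃[ p ] ∃[ x ] ∃[ s ] row o p x s ∈ rows × Sol D s × t ∈ s
      covering-row D {t} t< with covers D t<
      ... | s , s∈ , sol , t∈ with itemLists⁻ t es s∈
      ... | o , m with assign⁺ ps es m
      ... | p , m′ = o , p , _ , s , evaluate⁺ M zs (assign ps es) m′ , sol , t∈

      options-live : ∀ D k → Eliminated k → ∀ rs → (∀ {r} → r ∈ rs → r ∈ rows) → ∀ {o p x s} → row o p x s ∈ rs → Sol D s →
        ∀ {m} → suc p ∣ suc m → Live (Chosen D) m (options k rs)
      options-live D k el (row o p x s ∷ rs) sub (here refl) sol d with o <ᵇ k in eq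
      ... | true  = ⊥-elim (el D (sub (here refl)) (<ᵇ-true eq) sol)
      ... | false = here (o , x , s , sub (here refl) , sol)
        (λ { (o′ , x′ , s′ , m′ , sol′) → row-good D (sub (here refl)) m′ sol sol′ }) d
      options-live D k el (row o p x s ∷ rs) sub (there m) sol d with o <ᵇ k
      ... | true  = options-live D k el rs (sub ∘ there) m sol d
      ... | false = there (options-live D k el rs (sub ∘ there) m sol d)

      containing⁻ : ∀ t rs {r} → r ∈ containing t rs → r ∈ rs
      containing⁻ t (row o p x s ∷ rs) m with elem t s
      containing⁻ t (row o p x s ∷ rs) (here refl) | true = here refl
      containing⁻ t (row o p x s ∷ rs) (there m) | true = there (containing⁻ t rs m)
      containing⁻ t (row o p x s ∷ rs) m | false = there (containing⁻ t rs m)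

      items-solvable : ∀ D k → Eliminated k → ∀ is → All (_< 84) is → All (Solvable (Chosen D)) (items k (groups is rows))
      items-solvable D k el [] [] = []
      items-solvable D k el (t ∷ is) (t< ∷ is<) = one (covering-row D t<) ∷ items-solvable D k el is is<
        where
          one : ∃[ o ] ∃[ p ] ∃[ x ] ∃[ s ] row o p x s ∈ rows × Sol D s × t ∈ s →
            Solvable (Chosen D) (build (options k (containing t rows)))
          one (o , p , x , s , m , sol , t∈) =
            live-build (options-live D k el (containing t rows) (containing⁻ t rows) (containing⁺ t rows m t∈) sol {p} ∣-refl)

      rotated-bounded : ∀ j {r} → All (_< 85) r → All (_< 85) (rotated j r)
      rotated-bounded zero    b = b
      rotated-bounded (suc j) b = map⁺ (All.map rot< (rotated-bounded j b))

      untwisted : ∀ j {D r} → All (_< 85) r → Sol D (rotated j r) → ∃[ D′ ] Sol D′ r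
      untwisted zero    {D} b sol = D , sol
      untwisted (suc j) b sol = untwisted j b (untwist (rotated-bounded j b) sol)

      refute-sound : ∀ ks n k rs → (∀ m → nth [] rs m ≡ nth [] reps (k + m)) → ks ≢ [] → Eliminated k →
        refute ks n k rs rows (groups (upFrom 84 0) rows) ≡ true → I → ⊥
      refute-sound ks zero k rs eq ks≢ el e D with covering-row D {81} (m≤m+n 82 2)
      ... | o , p , x , s , m , sol , t∈ = el D m (<ᵇ-true (every⁻ {xs = containing 81 rows} e (containing⁺ 81 rows m t∈))) sol
      refute-sound ks (suc n) k (r ∷ rs) eq ks≢ el e D =
        refute-sound ks n (suc k) rs (λ m → trans (eq (suc m)) (cong (nth [] reps) (+-suc k m))) ks≢ el′
          (∧-true² {seek r rows _} e) D
        where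
          root : ∀ D → ¬ Sol D r
          root D sol with seek⁻ r rows (proj₁ (∧-true e))
          ... | o , p , x , m , e′ = step-sound {P = Chosen D} ks p (items k (groups (upFrom 84 0) rows)) (λ z → ⊥-elim (ks≢ z)) e′
            (λ { (o′ , x′ , s′ , m′ , sol′) → row-good D m m′ sol sol′ })
            (items-solvable D k el (upFrom 84 0) (upFrom-< 84 0 84 ≤-refl))
            where
              upFrom-< : ∀ n i N → i + n ≤ N → All (_< N) (upFrom n i)
              upFrom-< zero i N le = []
              upFrom-< (suc n) i N le = ≤-trans (m≤m+n (suc i) n) (subst (_≤ N) (+-suc i n) le) ∷
                upFrom-< n (suc i) N (subst (_≤ N) (+-suc i n) le)
          el′ : Eliminated (suc k)
          el′ D {o} m o< sol with o ≟ k
          ... | no o≢k = el D m (≤∧≢⇒< (s≤s⁻¹ o<) o≢k) sol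
          ... | yes refl with entries⁻ 0 reps (assign⁻ ps es (proj₂ (proj₂ (evaluate⁻ M zs (assign ps es) m))))
          ... | .o , j , refl , refl =
            let r≡ = trans (eq 0) (cong (nth [] reps) (+-identityʳ k))
                D′ , sol′ = untwisted j (reps-bounded k) sol
            in root D′ (subst (Sol D′) (sym r≡) sol′)

-- Vectors over F₂ and polynomials in a linear map.

module LinearAlgebra where

  open import Data.Bool using (Bool; true; false; _∧_; _xor_)
  open import Data.Bool.Properties using (xor-assoc; xor-comm; xor-same; xor-identityˡ; xor-identityʳ; ∧-distribʳ-xor; ∧-distribˡ-xor)
  open import Data.Nat
  open import Data.Nat.Properties
  open import Data.Nat.DivMod hiding (_%_)
  import Data.Fin as Fin
  import Data.Fin.Properties as Finₚ
  open import Data.List using ([]; _∷_)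
  open import Data.Vec using (Vec; []; _∷_; _∷ʳ_; zipWith; map; replicate; initLast)
  open import Data.Vec.Properties using (zipWith-assoc; zipWith-comm; zipWith-identityˡ; zipWith-identityʳ)
  open import Data.Product using (Σ; _,_)
  open import Data.Empty using (⊥-elim)
  open import Relation.Binary.PropositionalEquality
  open Search using (∧-true; ∨-true)
  open Lists

  ⊕-comm : ∀ x y → x ⊕ y ≡ y ⊕ x
  ⊕-comm = zipWith-comm xor-comm

  ⊕-assoc : ∀ x y z → (x ⊕ y) ⊕ z ≡ x ⊕ (y ⊕ z)
  ⊕-assoc = zipWith-assoc xor-assoc

  ⊕-identityʳ : ∀ x → x ⊕ 0v ≡ x
  ⊕-identityʳ = zipWith-identityʳ xor-identityʳ

  ⊕-identityˡ : ∀ x → 0v ⊕ x ≡ x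
  ⊕-identityˡ = zipWith-identityˡ xor-identityˡ

  ⊕-self : ∀ x → x ⊕ x ≡ 0v
  ⊕-self = go
    where
      go : ∀ {n} (x : Vec Bool n) → zipWith _xor_ x x ≡ replicate n false
      go []       = refl
      go (b ∷ bs) = cong₂ _∷_ (xor-same b) (go bs)

  ⊕-zero⇒≡ : ∀ x y → x ⊕ y ≡ 0v → x ≡ y
  ⊕-zero⇒≡ x y e = trans (sym (⊕-identityʳ x)) (trans (cong (x ⊕_) (sym (⊕-self y)))
    (trans (sym (⊕-assoc x y y)) (trans (cong (_⊕ y) e) (⊕-identityˡ y))))

  ⊕-medial : ∀ a b c d → (a ⊕ b) ⊕ (c ⊕ d) ≡ (a ⊕ c) ⊕ (b ⊕ d)
  ⊕-medial a b c d = trans (⊕-assoc a b (c ⊕ d)) (trans (cong (a ⊕_) (trans (sym (⊕-assoc b c d))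
    (trans (cong (_⊕ d) (⊕-comm b c)) (⊕-assoc c b d)))) (sym (⊕-assoc a c (b ⊕ d))))

  true· : ∀ x → true · x ≡ x
  true· = go
    where
      go : ∀ {n} (x : Vec Bool n) → map (true ∧_) x ≡ x
      go []       = refl
      go (b ∷ bs) = cong (b ∷_) (go bs)

  false· : ∀ x → false · x ≡ 0v
  false· = go
    where
      go : ∀ {n} (x : Vec Bool n) → map (false ∧_) x ≡ replicate n false
      go []       = refl
      go (b ∷ bs) = cong (false ∷_) (go bs)

  xor-· : ∀ a b x → (a xor b) · x ≡ (a · x) ⊕ (b · x)
  xor-· a b = go
    where
      go : ∀ {n} (x : Vec Bool n) → map ((a xor b) ∧_) x ≡ zipWith _xor_ (map (a ∧_) x) (map (b ∧_) x)
      go []       = refl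
      go (c ∷ cs) = cong₂ _∷_ (∧-distribʳ-xor c a b) (go cs)

  xor-medial : ∀ a b c d → (a xor b) xor (c xor d) ≡ (a xor c) xor (b xor d)
  xor-medial a b c d = trans (xor-assoc a b (c xor d)) (trans (cong (a xor_) (trans (sym (xor-assoc b c d))
    (trans (cong (_xor d) (xor-comm b c)) (xor-assoc c b d)))) (sym (xor-assoc a c (b xor d))))

  dot-⊕ : ∀ r x y → dot r (x ⊕ y) ≡ dot r x xor dot r y
  dot-⊕ = go
    where
      go : ∀ {n} (r x y : Vec Bool n) → Data.Vec.foldr (λ _ → Bool) _xor_ false (zipWith _∧_ r (zipWith _xor_ x y)) ≡
        Data.Vec.foldr (λ _ → Bool) _xor_ false (zipWith _∧_ r x) xor Data.Vec.foldr (λ _ → Bool) _xor_ false (zipWith _∧_ r y)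
      go []       []       []       = refl
      go (a ∷ r) (b ∷ x) (c ∷ y) = trans (cong₂ _xor_ (∧-distribˡ-xor a b c) (go r x y)) (xor-medial (a ∧ b) (a ∧ c) _ _)

  record Linear (f : V → V) : Set where
    field
      additive : ∀ x y → f (x ⊕ y) ≡ f x ⊕ f y

    zero-image : f 0v ≡ 0v
    zero-image = trans (cong f (sym (⊕-self 0v))) (trans (additive 0v 0v) (⊕-self (f 0v)))

    scale : ∀ b x → f (b · x) ≡ b · f x
    scale true  x = trans (cong f (true· x)) (sym (true· (f x)))
    scale false x = trans (cong f (false· x)) (trans zero-image (sym (false· (f x))))

  apply-linear : ∀ M → Linear (apply M)
  apply-linear M = record { additive = λ x y → go M x y }
    where
      go : ∀ {n} (M : Vec V n) x y → map (λ r → dot r (x ⊕ y)) M ≡ zipWith _xor_ (map (λ r → dot r x) M) (map (λ r → dot r y) M)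
      go []      x y = refl
      go (r ∷ M) x y = cong₂ _∷_ (dot-⊕ r x y) (go M x y)

  applyPow-linear : ∀ k M → Linear (applyPow k M)
  applyPow-linear zero    M = record { additive = λ _ _ → refl }
  applyPow-linear (suc k) M = record { additive = λ x y → trans (cong (apply M) (additive (applyPow-linear k M) x y))
      (additive (apply-linear M) (applyPow k M x) (applyPow k M y)) }
    where open Linear

  iter : ℕ → (V → V) → V → V
  iter zero    f x = x
  iter (suc k) f x = f (iter k f x)

  iter-+ : ∀ a b f x → iter (a + b) f x ≡ iter a f (iter b f x)
  iter-+ zero    b f x = refl
  iter-+ (suc a) b f x = cong f (iter-+ a b f x)

  iter-linear : ∀ k {f} → Linear f → Linear (iter k f)
  iter-linear zero    l = record { additive = λ _ _ → refl }
  iter-linear (suc k) {f} l = record { additive = λ x y → trans (cong f (Linear.additive (iter-linear k l) x y)) (Linear.additive l _ _) }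

  e₀ : V
  e₀ = true ∷ replicate 8 false

  e₀≢0 : e₀ ≢ 0v
  e₀≢0 ()

  -- multiplication by x modulo x⁹ - c(x)
  shiftIn : ∀ {n} → Bool → Vec Bool n → Vec Bool n
  shiftIn b []       = []
  shiftIn b (x ∷ xs) = b ∷ shiftIn x xs

  lastOf : ∀ {n} → Bool → Vec Bool n → Bool
  lastOf b []       = b
  lastOf b (x ∷ xs) = lastOf x xs

  times-x : V → V → V
  times-x c v = shiftIn false v ⊕ (lastOf false v · c)

  shiftIn-∷ʳ : ∀ {n} b (v : Vec Bool n) → b ∷ v ≡ shiftIn b v ∷ʳ lastOf b v
  shiftIn-∷ʳ b []       = refl
  shiftIn-∷ʳ b (x ∷ xs) = cong (b ∷_) (shiftIn-∷ʳ x xs)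

  module Krylov (f : V → V) (lin : Linear f) (e : V) where
    open Linear lin

    -- Horner's scheme, lowest coefficient first: the polynomial in `f` with these coefficients,
    -- applied to `e`.
    ev : ∀ {n} → Vec Bool n → V
    ev []       = 0v
    ev (b ∷ bs) = (b · e) ⊕ f (ev bs)

    ev-⊕ : ∀ {n} (x y : Vec Bool n) → ev (zipWith _xor_ x y) ≡ ev x ⊕ ev y
    ev-⊕ []       []       = sym (⊕-self 0v)
    ev-⊕ (a ∷ x) (b ∷ y) = trans (cong₂ _⊕_ (xor-· a b e) (trans (cong f (ev-⊕ x y)) (additive (ev x) (ev y))))
      (⊕-medial (a · e) (b · e) _ _)

    ev-zero : ∀ n → ev (replicate n false) ≡ 0v
    ev-zero zero    = refl
    ev-zero (suc n) = trans (cong₂ _⊕_ (false· e) (trans (cong f (ev-zero n)) zero-image)) (⊕-identityˡ 0v)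

    ev-∷ʳ : ∀ {n} (v : Vec Bool n) b → ev (v ∷ʳ b) ≡ ev v ⊕ (b · iter n f e)
    ev-∷ʳ [] b = trans (cong ((b · e) ⊕_) zero-image) (⊕-comm (b · e) 0v)
    ev-∷ʳ {suc n} (a ∷ v) b = trans (cong ((a · e) ⊕_) (trans (cong f (ev-∷ʳ v b))
        (trans (additive (ev v) (b · iter n f e)) (cong (f (ev v) ⊕_) (scale b (iter n f e))))))
      (sym (⊕-assoc (a · e) (f (ev v)) (b · iter (suc n) f e)))

    ev-scale : ∀ b (v : V) → ev (b · v) ≡ b · ev v
    ev-scale true  v = trans (cong ev (true· v)) (sym (true· (ev v)))
    ev-scale false v = trans (cong ev (false· v)) (trans (ev-zero 9) (sym (false· (ev v))))

    module Annihilated (c : V) (annihilated : ev c ≡ iter 9 f e) where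
      -- The coefficient pushed out by the shift belongs to x⁹, and `c` has the same value there. So
      -- `ev` carries the powers of x in F₂[x]/(x⁹ - c) to the orbit of `e` under `f`, even if that
      -- ring is not a field.
      ev-times-x : ∀ v → ev (times-x c v) ≡ f (ev v)
      ev-times-x v = trans (ev-⊕ (shiftIn false v) (lastOf false v · c))
        (trans (cong (ev (shiftIn false v) ⊕_) (trans (ev-scale (lastOf false v) c) (cong (lastOf false v ·_) annihilated)))
          (trans (sym (ev-∷ʳ (shiftIn false v) (lastOf false v)))
            (trans (cong ev (sym (shiftIn-∷ʳ false v))) (trans (cong (_⊕ f (ev v)) (false· e)) (⊕-identityˡ (f (ev v)))))))

      ev-e₀ : ev e₀ ≡ e
      ev-e₀ = trans (cong₂ _⊕_ (true· e) (trans (cong f (ev-zero 8)) zero-image)) (⊕-identityʳ e)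

      ev-iter : ∀ k → ev (iter k (times-x c) e₀) ≡ iter k f e
      ev-iter zero    = ev-e₀
      ev-iter (suc k) = trans (ev-times-x (iter k (times-x c) e₀)) (cong f (ev-iter k))

    -- A zero leading coefficient is dropped; multiplying the monic polynomial found in lower degree
    -- by x restores the degree.
    monic : ∀ n (q : Vec Bool (suc n)) → q ≢ replicate (suc n) false → ev q ≡ 0v → e ≢ 0v →
      Σ (Vec Bool n) λ c → ev (c ∷ʳ true) ≡ 0v
    monic n q q≢ ev≡ e≢ with initLast q
    ... | q′ , true  , refl = q′ , ev≡
    monic zero q q≢ ev≡ e≢ | [] , false , refl = ⊥-elim (q≢ refl)
    monic (suc n) q q≢ ev≡ e≢ | q′ , false , refl with monic n q′ q′≢ ev′ e≢
      where
        q′≢ : q′ ≢ replicate (suc n) false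
        q′≢ refl = q≢ (snoc (suc n))
          where
            snoc : ∀ n → replicate n false ∷ʳ false ≡ replicate (suc n) false
            snoc zero    = refl
            snoc (suc n) = cong (false ∷_) (snoc n)
        ev′ : ev q′ ≡ 0v
        ev′ = trans (sym (trans (cong (ev q′ ⊕_) (false· _)) (⊕-identityʳ (ev q′)))) (trans (sym (ev-∷ʳ q′ false)) ev≡)
    ... | c , eq = false ∷ c , trans (cong₂ _⊕_ (false· e) (trans (cong f eq) zero-image)) (⊕-identityˡ 0v)

-- A single cycle has a generating power that is a root of x⁹ + x⁴ + 1.

module Singer where

  open import Data.Bool using (Bool; true; false; _∧_; _∨_; _xor_)
  open import Data.Bool.Properties using () renaming (_≟_ to _≟ᵇ_)
  open import Data.Nat
  open import Data.Nat.Properties hiding (suc-injective)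
  open import Data.Nat.DivMod hiding (_%_; _/_)
  open import Data.Fin using (Fin; toℕ; fromℕ<; combine; remQuot; zero; suc)
  open import Data.Fin.Properties using (pigeonhole; combine-injective; combine-remQuot; fromℕ<-injective)
  open import Data.List using (List; []; _∷_; drop)
  open import Data.Vec using (Vec; []; _∷_; _∷ʳ_; zipWith; replicate)
  open import Data.Vec.Properties using (∷-injective; ≡-dec)
  open import Data.Product using (Σ; ∃-syntax; _×_; _,_; proj₁; proj₂)
  open import Data.Sum using (_⊎_; inj₁; inj₂)
  open import Data.Empty using (⊥; ⊥-elim)
  open import Data.Unit using (tt)
  open import Relation.Nullary using (yes; no)
  open import Relation.Binary.PropositionalEquality
  open Search using (∧-true; ∨-true)
  open Lists
  open LinearAlgebra

  bit : Bool → Fin 2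
  bit false = zero
  bit true  = suc zero

  bit⁻¹ : Fin 2 → Bool
  bit⁻¹ zero = false
  bit⁻¹ (suc zero) = true

  bit-injective : ∀ {a b} → bit a ≡ bit b → a ≡ b
  bit-injective {false} {false} _ = refl
  bit-injective {true}  {true}  _ = refl

  bit-bit⁻¹ : ∀ i → bit (bit⁻¹ i) ≡ i
  bit-bit⁻¹ zero       = refl
  bit-bit⁻¹ (suc zero) = refl

  bit⁻¹-injective : ∀ {i j} → bit⁻¹ i ≡ bit⁻¹ j → i ≡ j
  bit⁻¹-injective {i} {j} e = trans (sym (bit-bit⁻¹ i)) (trans (cong bit e) (bit-bit⁻¹ j))

  encode : ∀ {n} → Vec Bool n → Fin (2 ^ n)
  encode []       = zero
  encode {suc n} (b ∷ bs) = combine (bit b) (encode bs)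

  encode-injective : ∀ {n} (x y : Vec Bool n) → encode x ≡ encode y → x ≡ y
  encode-injective []       []       _ = refl
  encode-injective {suc n} (a ∷ x) (b ∷ y) e with combine-injective (bit a) (encode x) (bit b) (encode y) e
  ... | p , q = cong₂ _∷_ (bit-injective p) (encode-injective x y q)

  decode : ∀ n → Fin (2 ^ n) → Vec Bool n
  decode zero    i = []
  decode (suc n) i = bit⁻¹ (proj₁ (remQuot {2} (2 ^ n) i)) ∷ decode n (proj₂ (remQuot {2} (2 ^ n) i))

  decode-injective : ∀ n {i j} → decode n i ≡ decode n j → i ≡ j
  decode-injective zero {zero} {zero} _ = refl
  decode-injective (suc n) {i} {j} e with ∷-injective e
  ... | p , q = trans (sym (combine-remQuot {2} (2 ^ n) i))
    (trans (cong₂ combine (bit⁻¹-injective p) (decode-injective n q)) (combine-remQuot {2} (2 ^ n) j))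

  xor-zero⇒≡ : ∀ {n} (x y : Vec Bool n) → zipWith _xor_ x y ≡ replicate n false → x ≡ y
  xor-zero⇒≡ []       []       _ = refl
  xor-zero⇒≡ (a ∷ x) (b ∷ y) e with ∷-injective e
  ... | p , q = cong₂ _∷_ (bits a b p) (xor-zero⇒≡ x y q)
    where
      bits : ∀ a b → a xor b ≡ false → a ≡ b
      bits true  true  _ = refl
      bits false false _ = refl

  eqV : ∀ {n} → Vec Bool n → Vec Bool n → Bool
  eqV []           []           = true
  eqV (true  ∷ x) (true  ∷ y) = eqV x y
  eqV (false ∷ x) (false ∷ y) = eqV x y
  eqV _            _            = false

  eqV⁻ : ∀ {n} (x y : Vec Bool n) → eqV x y ≡ true → x ≡ y
  eqV⁻ []           []           _ = refl
  eqV⁻ (true  ∷ x) (true  ∷ y) e = cong (true ∷_) (eqV⁻ x y e)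
  eqV⁻ (false ∷ x) (false ∷ y) e = cong (false ∷_) (eqV⁻ x y e)

  everyVec : ∀ n → (Vec Bool n → Bool) → Bool
  everyVec zero    f = f []
  everyVec (suc n) f = everyVec n (λ v → f (true ∷ v)) ∧ everyVec n (λ v → f (false ∷ v))

  everyVec⁻ : ∀ n {f} → everyVec n f ≡ true → ∀ v → f v ≡ true
  everyVec⁻ zero e [] = e
  everyVec⁻ (suc n) e (true ∷ v) = everyVec⁻ n (proj₁ (∧-true e)) v
  everyVec⁻ (suc n) {f} e (false ∷ v) = everyVec⁻ n (∧-true² {everyVec n (λ v → f (true ∷ v))} e) v

  trajectory : (V → V) → ℕ → V → List V
  trajectory f zero    x = []
  trajectory f (suc n) x = x ∷ trajectory f n (f x)

  get : List V → ℕ → V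
  get []       _       = 0v
  get (x ∷ xs) zero    = x
  get (x ∷ xs) (suc k) = get xs k

  iter-suc : ∀ k f x → iter k f (f x) ≡ f (iter k f x)
  iter-suc zero    f x = refl
  iter-suc (suc k) f x = cong f (iter-suc k f x)

  get-trajectory : ∀ f n x k → k < n → get (trajectory f n x) k ≡ iter k f x
  get-trajectory f (suc n) x zero    _        = refl
  get-trajectory f (suc n) x (suc k) (s≤s k<) = trans (get-trajectory f n (f x) k k<) (iter-suc k f x)

  get-drop : ∀ n xs k → get (drop n xs) k ≡ get xs (n + k)
  get-drop zero    xs       k = refl
  get-drop (suc n) []       k = refl
  get-drop (suc n) (x ∷ xs) k = get-drop n xs k

  occurs : ℕ → V → List V → Bool
  occurs zero    y xs       = false
  occurs (suc n) y []       = false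
  occurs (suc n) y (x ∷ xs) = eqV x y ∨ occurs n y xs

  occurs⁻ : ∀ n y xs → occurs n y xs ≡ true → ∃[ k ] k < n × get xs k ≡ y
  occurs⁻ (suc n) y (x ∷ xs) e with ∨-true {eqV x y} e
  ... | inj₁ h = 0 , s≤s z≤n , eqV⁻ x y h
  ... | inj₂ h with occurs⁻ n y xs h
  ... | k , k< , eq = suc k , s≤s k< , eq

  someBelow : ℕ → (ℕ → Bool) → Bool
  someBelow zero    f = false
  someBelow (suc n) f = f n ∨ someBelow n f

  someBelow⁻ : ∀ n {f} → someBelow n f ≡ true → ∃[ k ] k < n × f k ≡ true
  someBelow⁻ (suc n) {f} e with ∨-true {f n} e
  ... | inj₁ h = n , ≤-refl , h
  ... | inj₂ h with someBelow⁻ n h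
  ... | k , k< , eq = k , m<n⇒m<1+n k< , eq

  isRoot : List V → ℕ → Bool
  isRoot xs k = eqV (get xs (9 * k % 511)) (get xs (4 * k % 511) ⊕ e₀) ∧ someBelow 511 (λ j → (j * k) % 511 ≡ᵇ 1)

  -- Either x has order less than 511, or some power of x is a root of x⁹ + x⁴ + 1 and generates the same group.
  -- After nine steps the powers of x modulo any polynomial of degree 9 are in their cycle.
  dichotomyOf : V → List V → Bool
  dichotomyOf c xs =
    occurs 501 (get xs 9) (drop 10 xs) ∨ (eqV (times-x c (get xs 510)) e₀ ∧ someBelow 511 (isRoot xs))

  orderOrRoot : ℕ → V → Bool
  orderOrRoot n c = dichotomyOf c (trajectory (times-x c) n e₀)

  applyPow-iter : ∀ k g x → applyPow k g x ≡ iter k (apply g) x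
  applyPow-iter zero    g x = refl
  applyPow-iter (suc k) g x = cong (apply g) (applyPow-iter k g x)

  iter-periodic : ∀ {f x} n → iter n f x ≡ x → ∀ m a → iter (a + m * n) f x ≡ iter a f x
  iter-periodic {f} {x} n e zero a = cong (λ k → iter k f x) (+-identityʳ a)
  iter-periodic {f} {x} n e (suc m) a = trans (cong (λ k → iter k f x) lemma)
    (trans (iter-+ (a + m * n) n f x) (trans (cong (iter (a + m * n) f) e) (iter-periodic n e m a)))
    where
      lemma : a + (n + m * n) ≡ a + m * n + n
      lemma = trans (cong (a +_) (+-comm n (m * n))) (sym (+-assoc a (m * n) n))

  iter-% : ∀ {f x} → iter 511 f x ≡ x → ∀ a → iter a f x ≡ iter (a % 511) f x
  iter-% {f} {x} e a = trans (cong (λ k → iter k f x) (m≡m%n+[m/n]*n a 511)) (iter-periodic 511 e (a / 511) (a % 511))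

  module _ (g : Matrix) (cyclic : IsSingleCycle g) where

    pw : ℕ → V
    pw k = iter k (apply g) e₀

    hits : ∀ y → y ≢ 0v → ∃[ k ] k < 511 × pw k ≡ y
    hits y y≢ with cyclic e₀ y e₀≢0 y≢
    ... | k , k< , e = k , k< , trans (sym (applyPow-iter k g e₀)) e

    open Krylov (apply g) (apply-linear g) e₀

    -- There are 2¹⁰ polynomials of degree at most 9 but only 2⁹ values, so two of them agree at
    -- `e₀` and their difference annihilates it.
    dependency : Σ (Vec Bool 10) λ q → q ≢ replicate 10 false × ev q ≡ 0v
    dependency = from (pigeonhole {2 ^ 9} {2 ^ 10} (<ᵇ⇒< (2 ^ 9) (2 ^ 10) tt) (λ i → encode (ev (decode 10 i))))
      where
        from : ∃[ i ] ∃[ j ] (i Data.Fin.< j) × encode (ev (decode 10 i)) ≡ encode (ev (decode 10 j)) →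
          Σ (Vec Bool 10) λ q → q ≢ replicate 10 false × ev q ≡ 0v
        from (i , j , i<j , e) = zipWith _xor_ (decode 10 i) (decode 10 j) ,
          (λ z → <⇒≢ i<j (cong toℕ (decode-injective 10 (xor-zero⇒≡ (decode 10 i) (decode 10 j) z)))) ,
          trans (ev-⊕ (decode 10 i) (decode 10 j))
            (trans (cong (_⊕ ev (decode 10 j)) (encode-injective (ev (decode 10 i)) (ev (decode 10 j)) e)) (⊕-self (ev (decode 10 j))))

    -- A repetition makes the exponent `m` redundant: those below `m` already reach every nonzero
    -- vector, which frees the code `m` for `0v`. So `suc m` codes would separate `N` vectors.
    not-short : ∀ {N} (point : Fin N → V) → (∀ {i i′} → point i ≡ point i′ → i ≡ i′) →
      ∀ {j} m → suc m < N → 511 ≤ suc m → j < m → pw j ≢ pw m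
    not-short point point-injective {j} m m< 511≤ j< e = from (pigeonhole m< (λ i → fromℕ< (proj₁ (proj₂ (code (point i))))))
      where
        Code : V → ℕ → Set
        Code y k = (k ≡ m × y ≡ 0v) ⊎ (k < m × pw k ≡ y)
        short : ∀ {y} → ∃[ k ] k < 511 × pw k ≡ y → ∃[ k ] k < suc m × Code y k
        short {y} (k , k< , eq) with k ≟ m
        ... | yes k≡m = j , m<n⇒m<1+n j< , inj₂ (j< , trans e (trans (cong pw (sym k≡m)) eq))
        ... | no k≢m = k , ≤-trans k< 511≤ , inj₂ (≤∧≢⇒< (s≤s⁻¹ (≤-trans k< 511≤)) k≢m , eq)
        code : ∀ y → ∃[ k ] k < suc m × Code y k
        code y with ≡-dec _≟ᵇ_ y 0v
        ... | yes y≡0 = m , ≤-refl , inj₁ (refl , y≡0)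
        ... | no y≢0 = short (hits y y≢0)
        unique : ∀ {y z k l} → Code y k → Code z l → k ≡ l → y ≡ z
        unique (inj₁ (_ , p)) (inj₁ (_ , q)) _ = trans p (sym q)
        unique (inj₁ (p , _)) (inj₂ (l< , _)) e = ⊥-elim (<⇒≢ l< (trans (sym e) p))
        unique (inj₂ (k< , _)) (inj₁ (p , _)) e = ⊥-elim (<⇒≢ k< (trans e p))
        unique (inj₂ (_ , p)) (inj₂ (_ , q)) e = trans (sym p) (trans (cong pw e) q)
        from : ∃[ i ] ∃[ i′ ] (i Data.Fin.< i′) × fromℕ< (proj₁ (proj₂ (code (point i)))) ≡ fromℕ< (proj₁ (proj₂ (code (point i′)))) → ⊥
        from (i , i′ , i<i′ , eq) = <⇒≢ i<i′ (cong toℕ (point-injective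
          (unique (proj₂ (proj₂ (code (point i)))) (proj₂ (proj₂ (code (point i′))))
            (fromℕ<-injective _ _ (proj₁ (proj₂ (code (point i)))) (proj₁ (proj₂ (code (point i′)))) eq))))

    -- The congruence for `j` and `k` says that the `k`-th power of `g` has the same orbit on `e₀`
    -- as `g`.
    Root : Set
    Root = ∃[ k ] ∃[ j ] (j * k) % 511 ≡ 1 × pw (9 * k) ≡ pw (4 * k) ⊕ e₀ × pw 511 ≡ e₀

    module _ (c : V) (xs : List V) (ev-get : ∀ {k} → k < 511 → ev (get xs k) ≡ pw k)
        (ev-step : ∀ v → ev (times-x c v) ≡ apply g (ev v)) (ev-e₀ : ev e₀ ≡ e₀) where

      rooted : pw 511 ≡ e₀ → ∃[ k ] k < 511 × isRoot xs k ≡ true → Root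
      rooted p (k , _ , h) = inverse (someBelow⁻ 511 {λ j → (j * k) % 511 ≡ᵇ 1}
          (∧-true² {eqV (get xs (9 * k % 511)) (get xs (4 * k % 511) ⊕ e₀)} h))
        where
          equation : pw (9 * k) ≡ pw (4 * k) ⊕ e₀
          equation = trans (iter-% p (9 * k)) (trans (sym (ev-get (m%n<n (9 * k) 511)))
            (trans (cong ev (eqV⁻ (get xs (9 * k % 511)) (get xs (4 * k % 511) ⊕ e₀)
                (proj₁ (∧-true {eqV (get xs (9 * k % 511)) (get xs (4 * k % 511) ⊕ e₀)} h))))
              (trans (ev-⊕ (get xs (4 * k % 511)) e₀)
                (cong₂ _⊕_ (trans (ev-get (m%n<n (4 * k) 511)) (sym (iter-% p (4 * k)))) ev-e₀))))
          inverse : ∃[ j ] j < 511 × ((j * k) % 511 ≡ᵇ 1) ≡ true → Root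
          inverse (j , _ , e) = k , j , ≡ᵇ-true e , equation , p

      repeated : ∃[ k ] k < 501 × get (drop 10 xs) k ≡ get xs 9 → ⊥
      -- Another `500 ∸ k` steps move the repetition up to the exponent 510, the smallest that
      -- `not-short` accepts.
      repeated (k , s≤s k≤ , e) = not-short (decode 9) (decode-injective 9) {500 ∸ k + 9} (500 ∸ k + (10 + k))
          (subst (λ m → suc m < 512) (sym total) ≤-refl) (subst (λ m → 511 ≤ suc m) (sym total) ≤-refl)
          (+-monoʳ-< (500 ∸ k) (m≤m+n 10 k))
          (trans (iter-+ (500 ∸ k) 9 (apply g) e₀) (trans (cong (iter (500 ∸ k) (apply g)) (sym returns))
            (sym (iter-+ (500 ∸ k) (10 + k) (apply g) e₀))))
        where
          total : 500 ∸ k + (10 + k) ≡ 510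
          total = trans (cong (500 ∸ k +_) (+-comm 10 k)) (trans (sym (+-assoc (500 ∸ k) k 10)) (cong (_+ 10) (m∸n+n≡m k≤)))
          returns : pw (10 + k) ≡ pw 9
          returns = trans (sym (ev-get (+-monoʳ-≤ 11 k≤)))
            (trans (cong ev (trans (sym (get-drop 10 xs k)) e)) (ev-get (m≤m+n 10 501)))

      periodic : eqV (times-x c (get xs 510)) e₀ ≡ true → pw 511 ≡ e₀
      periodic h = trans (cong (apply g) (sym (ev-get {510} ≤-refl))) (trans (sym (ev-step (get xs 510)))
        (trans (cong ev (eqV⁻ (times-x c (get xs 510)) e₀ h)) ev-e₀))

      split : dichotomyOf c xs ≡ true → Root
      split h = alternatives (∨-true {occurs 501 (get xs 9) (drop 10 xs)} h)
        where
          alternatives : occurs 501 (get xs 9) (drop 10 xs) ≡ true ⊎ (eqV (times-x c (get xs 510)) e₀ ∧ someBelow 511 (isRoot xs)) ≡ true → Root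
          alternatives (inj₁ h) = ⊥-elim (repeated (occurs⁻ 501 (get xs 9) (drop 10 xs) h))
          alternatives (inj₂ h) = rooted (periodic (proj₁ (∧-true {eqV (times-x c (get xs 510)) e₀} h)))
            (someBelow⁻ 511 {isRoot xs} (∧-true² {eqV (times-x c (get xs 510)) e₀} h))

    -- The annihilating polynomial is unknown, so the check runs over every `c`; its first
    -- alternative, a short cycle, contradicts the length 511.
    root : ∀ n → 511 ≤ n → (∀ c → orderOrRoot n c ≡ true) → Root
    root n 511≤n all-c = from dependency
      where
        decide : ∀ c → ev c ≡ pw 9 → Root
        decide c annihilated = split c (trajectory (times-x c) n e₀)
            (λ {k} k< → trans (cong ev (get-trajectory (times-x c) n e₀ k (≤-trans k< 511≤n))) (ev-iter k))
            ev-times-x ev-e₀ (all-c c)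
          where
            open Annihilated c annihilated
        conclude : Σ (Vec Bool 9) (λ c → ev (c ∷ʳ true) ≡ 0v) → Root
        conclude (c , eq) = decide c (⊕-zero⇒≡ (ev c) (pw 9)
          (trans (cong (ev c ⊕_) (sym (true· (pw 9)))) (trans (sym (ev-∷ʳ c true)) eq)))
        from : Σ (Vec Bool 10) (λ q → q ≢ replicate 10 false × ev q ≡ 0v) → Root
        from (q , q≢ , e) = conclude (monic 9 q q≢ e e₀≢0)

-- From a cyclic design to a geometry on exponents.

module Planes where

  open import Data.Bool using (Bool; true; false; _∨_; _xor_; not; if_then_else_)
  open import Data.Bool.Properties using () renaming (_≟_ to _≟ᵇ_)
  open import Data.Nat
  open import Data.Nat.Properties
  open import Data.Nat.DivMod hiding (_%_; _/_)
  open import Data.Fin using (Fin)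
  open import Data.List using ([]; _∷_)
  open import Data.List.Membership.Propositional using (_∈_; _∉_)
  open import Data.List.Relation.Unary.Any using (here; there)
  open import Data.Vec using (Vec; []; _∷_; zipWith; replicate)
  open import Data.Product using (∃-syntax; _×_; _,_; proj₁; proj₂)
  open import Data.Sum using (_⊎_; inj₁; inj₂)
  open import Data.Empty using (⊥; ⊥-elim)
  open import Relation.Nullary using (yes; no)
  open import Relation.Binary.PropositionalEquality
  open Search using (∧-true; ∨-true)
  open Lists
  open LinearAlgebra
  open Singer
  open Exponent

  iter-* : ∀ a k f x → iter a (iter k f) x ≡ iter (a * k) f x
  iter-* zero    k f x = refl
  iter-* (suc a) k f x = trans (cong (iter k f) (iter-* a k f x)) (sym (iter-+ k (a * k) f x))

  -- The lower part of the modulus: with this `c`, `times-x` computes in F₂[x] with x⁹ = 1 + x⁴.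
  trinomial : V
  trinomial = e₀ ⊕ (false ∷ false ∷ false ∷ false ∷ true ∷ replicate 4 false)

  standard : ℕ → V
  standard d = iter d (times-x trinomial) e₀

  Coefficients : Set
  Coefficients = Vec Bool 3

  combine : Triple → Coefficients → V
  combine (u , v , w) (a ∷ b ∷ c ∷ []) = ((a · u) ⊕ (b · v)) ⊕ (c · w)

  combine-⊕ : ∀ t x y → combine t (zipWith _xor_ x y) ≡ combine t x ⊕ combine t y
  combine-⊕ (u , v , w) (a ∷ b ∷ c ∷ []) (a′ ∷ b′ ∷ c′ ∷ []) = trans
    (cong₂ _⊕_ (trans (cong₂ _⊕_ (xor-· a a′ u) (xor-· b b′ v)) (⊕-medial (a · u) (a′ · u) (b · v) (b′ · v))) (xor-· c c′ w))
    (⊕-medial ((a · u) ⊕ (b · v)) ((a′ · u) ⊕ (b′ · v)) (c · w) (c′ · w))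

  span⁻ : ∀ {x} t → x ∈span t → ∃[ k ] combine t k ≡ x
  span⁻ t (a , b , c , e) = a ∷ b ∷ c ∷ [] , sym e

  span⁺ : ∀ t k → combine t k ∈span t
  span⁺ t (a ∷ b ∷ c ∷ []) = a , b , c , refl

  combine-linear : ∀ {f} → Linear f → ∀ u v w k → f (combine (u , v , w) k) ≡ combine (f u , f v , f w) k
  combine-linear {f} l u v w (a ∷ b ∷ c ∷ []) = trans (additive ((a · u) ⊕ (b · v)) (c · w))
    (cong₂ _⊕_ (trans (additive (a · u) (b · v)) (cong₂ _⊕_ (scale a u) (scale b v))) (scale c w))
    where open Linear l

  _+₃_ : Coefficients → Coefficients → Coefficients
  _+₃_ = zipWith _xor_

  inLine : Coefficients → Coefficients → Coefficients → Bool
  inLine a b x = eqV x (replicate 3 false) ∨ (eqV x a ∨ (eqV x b ∨ eqV x (a +₃ b)))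

  offLine : Coefficients → Coefficients → Coefficients
  offLine a b = if inLine a b (true ∷ false ∷ false ∷ []) then
    (if inLine a b (false ∷ true ∷ false ∷ []) then
      -- The span of two vectors misses one of the three unit vectors, so the all-ones vector is
      -- only a default.
      (if inLine a b (false ∷ false ∷ true ∷ []) then true ∷ true ∷ true ∷ [] else false ∷ false ∷ true ∷ [])
     else false ∷ true ∷ false ∷ [])
    else true ∷ false ∷ false ∷ []

  offLine-correct : ∀ a b → not (inLine a b (offLine a b)) ≡ true
  offLine-correct a b = everyVec⁻ 3 {λ b → not (inLine a b (offLine a b))}
    (everyVec⁻ 3 {λ a → everyVec 3 λ b → not (inLine a b (offLine a b))} refl a) b

  -- The Fano plane is exhausted by a line, a point `c` off it and the sums with `c`. Degenerate
  -- inputs appear as alternatives, so the implication is a Boolean that is true on all 8⁴ inputs.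
  fills : Coefficients → Coefficients → Coefficients → Coefficients → Bool
  fills a b c x = (eqV a (replicate 3 false) ∨ (eqV b (replicate 3 false) ∨ (eqV a b ∨ inLine a b c))) ∨
    (inLine a b x ∨ (eqV x c ∨ (eqV x (a +₃ c) ∨ (eqV x (b +₃ c) ∨ eqV x ((a +₃ b) +₃ c)))))

  fills-correct : ∀ a b c x → fills a b c x ≡ true
  fills-correct a b c x = everyVec⁻ 3 {λ x → fills a b c x} (everyVec⁻ 3 {λ c → everyVec 3 λ x → fills a b c x}
    (everyVec⁻ 3 {λ b → everyVec 3 λ c → everyVec 3 λ x → fills a b c x}
      (everyVec⁻ 3 {λ a → everyVec 3 λ b → everyVec 3 λ c → everyVec 3 λ x → fills a b c x} refl a) b) c) x

  eqV⁺ : ∀ {n} (x : Vec Bool n) → eqV x x ≡ true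
  eqV⁺ []           = refl
  eqV⁺ (true  ∷ x) = eqV⁺ x
  eqV⁺ (false ∷ x) = eqV⁺ x

  ∨-trueˡ : ∀ {a b} → a ≡ true → a ∨ b ≡ true
  ∨-trueˡ refl = refl

  inLine⁻ : ∀ a b x → inLine a b x ≡ true → x ≡ replicate 3 false ⊎ x ≡ a ⊎ x ≡ b ⊎ x ≡ a +₃ b
  inLine⁻ a b x e with ∨-true {eqV x (replicate 3 false)} e
  ... | inj₁ h = inj₁ (eqV⁻ x _ h)
  ... | inj₂ e with ∨-true {eqV x a} e
  ... | inj₁ h = inj₂ (inj₁ (eqV⁻ x _ h))
  ... | inj₂ e with ∨-true {eqV x b} e
  ... | inj₁ h = inj₂ (inj₂ (inj₁ (eqV⁻ x _ h)))
  ... | inj₂ h = inj₂ (inj₂ (inj₂ (eqV⁻ x _ h)))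

  inLine⁺ : ∀ {a b x} → x ≡ replicate 3 false ⊎ x ≡ a ⊎ x ≡ b ⊎ x ≡ a +₃ b → inLine a b x ≡ true
  inLine⁺ (inj₁ refl) = refl
  inLine⁺ {a} {b} {x} (inj₂ (inj₁ refl)) = ∨-trueʳ (eqV x (replicate 3 false)) (∨-trueˡ (eqV⁺ x))
  inLine⁺ {a} {b} {x} (inj₂ (inj₂ (inj₁ refl))) =
    ∨-trueʳ (eqV x (replicate 3 false)) (∨-trueʳ (eqV x a) (∨-trueˡ (eqV⁺ x)))
  inLine⁺ {a} {b} {x} (inj₂ (inj₂ (inj₂ refl))) =
    ∨-trueʳ (eqV x (replicate 3 false)) (∨-trueʳ (eqV x a) (∨-trueʳ (eqV x b) (eqV⁺ x)))

  fills⁻ : ∀ a b c x → a ≢ replicate 3 false → b ≢ replicate 3 false → a ≢ b → inLine a b c ≢ true →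
    inLine a b x ≡ true ⊎ x ≡ c ⊎ x ≡ a +₃ c ⊎ x ≡ b +₃ c ⊎ x ≡ (a +₃ b) +₃ c
  fills⁻ a b c x a≢ b≢ a≢b c∉ = go (∨-true (fills-correct a b c x))
    where
      degenerate : (eqV a (replicate 3 false) ∨ (eqV b (replicate 3 false) ∨ (eqV a b ∨ inLine a b c))) ≡ true → ⊥
      degenerate e with ∨-true {eqV a (replicate 3 false)} e
      ... | inj₁ h = a≢ (eqV⁻ a _ h)
      ... | inj₂ e with ∨-true {eqV b (replicate 3 false)} e
      ... | inj₁ h = b≢ (eqV⁻ b _ h)
      ... | inj₂ e with ∨-true {eqV a b} e
      ... | inj₁ h = a≢b (eqV⁻ a b h)
      ... | inj₂ h = c∉ h
      covered′ : (inLine a b x ∨ (eqV x c ∨ (eqV x (a +₃ c) ∨ (eqV x (b +₃ c) ∨ eqV x ((a +₃ b) +₃ c))))) ≡ true →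
        inLine a b x ≡ true ⊎ x ≡ c ⊎ x ≡ a +₃ c ⊎ x ≡ b +₃ c ⊎ x ≡ (a +₃ b) +₃ c
      covered′ e with ∨-true {inLine a b x} e
      ... | inj₁ h = inj₁ h
      ... | inj₂ e with ∨-true {eqV x c} e
      ... | inj₁ h = inj₂ (inj₁ (eqV⁻ x c h))
      ... | inj₂ e with ∨-true {eqV x (a +₃ c)} e
      ... | inj₁ h = inj₂ (inj₂ (inj₁ (eqV⁻ x _ h)))
      ... | inj₂ e with ∨-true {eqV x (b +₃ c)} e
      ... | inj₁ h = inj₂ (inj₂ (inj₂ (inj₁ (eqV⁻ x _ h))))
      ... | inj₂ h = inj₂ (inj₂ (inj₂ (inj₂ (eqV⁻ x _ h))))
      go : (eqV a (replicate 3 false) ∨ (eqV b (replicate 3 false) ∨ (eqV a b ∨ inLine a b c))) ≡ true ⊎ _ → _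
      go (inj₁ h) = ⊥-elim (degenerate h)
      go (inj₂ h) = covered′ h

  module Powers (zech : ℕ → ℕ)
    (zech-sum : ∀ {d} → 0 < d → d < 511 → e₀ ⊕ standard d ≡ standard (zech d))
    {n : ℕ} {B : Fin n → Triple} (design : Is2Analog931 n B)
    {g : Matrix} (automorphism : IsAutomorphism n B g) (cyclic : IsSingleCycle g)
    (k j : ℕ) (jk≡1 : (j * k) % 511 ≡ 1)
    (equation : pw g cyclic (9 * k) ≡ pw g cyclic (4 * k) ⊕ e₀) (periodic : pw g cyclic 511 ≡ e₀) where

    open Triangle zech

    f : V → V
    f = iter k (apply g)

    f-linear : Linear f
    f-linear = iter-linear k (apply-linear g)

    pt : ℕ → V
    pt a = iter a f e₀

    pt-pw : ∀ a → pt a ≡ pw g cyclic (a * k)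
    pt-pw a = iter-* a k (apply g) e₀

    pt-511 : pt 511 ≡ e₀
    pt-511 = trans (pt-pw 511) (trans (cong (λ m → iter m (apply g) e₀) (*-comm 511 k)) (iter-periodic 511 periodic k 0))

    pt-≈ : ∀ {a b} → a ≈ b → pt a ≡ pt b
    pt-≈ {a} {b} (mk≈ e) = trans (iter-% pt-511 a) (trans (cong pt e) (sym (iter-% pt-511 b)))

    pt≢0 : ∀ {a} → a < 511 → pt a ≢ 0v
    pt≢0 {a} a< z = e₀≢0 (trans (sym pt-511) (trans (cong pt (sym (m∸n+n≡m (<⇒≤ a<))))
      (trans (iter-+ (511 ∸ a) a f e₀) (trans (cong (iter (511 ∸ a) f) z) (Linear.zero-image (iter-linear (511 ∸ a) f-linear))))))

    open Krylov f f-linear e₀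

    unit : ∀ n → ev (true ∷ replicate n false) ≡ e₀
    unit n = trans (cong₂ _⊕_ (true· e₀) (trans (cong f (ev-zero n)) (Linear.zero-image f-linear))) (⊕-identityʳ e₀)

    shifted : ∀ {n} (v : Vec Bool n) → ev (false ∷ v) ≡ f (ev v)
    shifted v = trans (cong (_⊕ f (ev v)) (false· e₀)) (⊕-identityˡ (f (ev v)))

    annihilated : ev trinomial ≡ pt 9
    annihilated = trans (ev-⊕ e₀ (false ∷ false ∷ false ∷ false ∷ true ∷ replicate 4 false)) (trans (cong₂ _⊕_ (unit 8) fourth)
        (trans (⊕-comm e₀ (pt 4)) (trans (cong (_⊕ e₀) (pt-pw 4)) (trans (sym equation) (sym (pt-pw 9))))))
      where
        fourth : ev (false ∷ false ∷ false ∷ false ∷ true ∷ replicate 4 false) ≡ pt 4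
        fourth = trans (shifted (false ∷ false ∷ false ∷ true ∷ replicate 4 false)) (cong f
          (trans (shifted (false ∷ false ∷ true ∷ replicate 4 false)) (cong f
          (trans (shifted (false ∷ true ∷ replicate 4 false)) (cong f
          (trans (shifted (true ∷ replicate 4 false)) (cong f (unit 4))))))))

    open Annihilated trinomial annihilated

    -- The logarithms are verified once, for powers of x modulo the trinomial; `ev` transports them
    -- to the powers of `f`.
    pt-zech : ∀ {d} → 0 < d → d < 511 → e₀ ⊕ pt d ≡ pt (zech d)
    pt-zech {d} d> d< = trans (cong₂ _⊕_ (sym ev-e₀) (sym (ev-iter d)))
      (trans (sym (ev-⊕ e₀ (standard d))) (trans (cong ev (zech-sum d> d<)) (ev-iter (zech d))))

    diff≢0 : ∀ {a b} → a < 511 → b < 511 → a ≢ b → 0 < diff a b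
    diff≢0 {a} {b} a< b< a≢b = n≢0⇒n>0 λ e → a≢b (≈⇒≡ a< b<
      (≈-trans (≡⇒≈ (sym (trans (cong (a +_) e) (+-identityʳ a)))) (+diff a b a<)))

    pt-sum : ∀ {a b} → a < 511 → b < 511 → a ≢ b → pt a ⊕ pt b ≡ pt (tri a b)
    pt-sum {a} {b} a< b< a≢b = trans (cong (pt a ⊕_) (trans (sym (pt-≈ (+diff a b a<))) (iter-+ a (diff a b) f e₀)))
      (trans (sym (Linear.additive (iter-linear a f-linear) e₀ (pt (diff a b))))
        (trans (cong (iter a f) (pt-zech (diff≢0 a< b< a≢b) (diff< a b)))
          (trans (sym (iter-+ a (zech (diff a b)) f e₀)) (pt-≈ (≈-sym (%≈ (a + zech (diff a b))))))))

    pt-injective : ∀ {a b} → a < 511 → b < 511 → pt a ≡ pt b → a ≡ b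
    pt-injective {a} {b} a< b< e with a ≟ b
    ... | yes a≡b = a≡b
    ... | no a≢b = ⊥-elim (pt≢0 (tri< a b) (trans (sym (pt-sum a< b< a≢b)) (trans (cong (pt a ⊕_) (sym e)) (⊕-self (pt a)))))

    pt-onto : ∀ x → x ≢ 0v → ∃[ a ] a < 511 × pt a ≡ x
    pt-onto x x≢ = from (hits g cyclic x x≢)
      where
        from : ∃[ m ] m < 511 × pw g cyclic m ≡ x → ∃[ a ] a < 511 × pt a ≡ x
        -- Since `j * k` is 1 modulo 511, the power `m * j` of `f` acts on `e₀` as the power `m` of
        -- `g`.
        from (m , _ , e) = (m * j) % 511 , %< (m * j) , trans (pt-≈ (%≈ (m * j))) (trans (pt-pw (m * j))
            (trans (iter-% periodic (m * j * k)) (trans (cong (λ a → iter a (apply g) e₀) residue) (trans (sym (iter-% periodic m)) e))))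
          where
            residue : (m * j * k) % 511 ≡ m % 511
            residue = trans (cong (_% 511) (*-assoc m j k))
              (trans (un≈ (*-congʳ m {j * k} {1} (mk≈ jk≡1))) (cong (_% 511) (*-identityʳ m)))

    Mem : Fin n → ℕ → Set
    Mem i a = pt a ∈span B i

    shift-block : ∀ i → ∃[ i′ ] ∀ x → (x ∈span B i → apply g x ∈span B i′) × (apply g x ∈span B i′ → x ∈span B i)
    shift-block i = from (proj₂ automorphism i)
      where
        u = proj₁ (B i)
        v = proj₁ (proj₂ (B i))
        w = proj₂ (proj₂ (B i))
        from : ∃[ i′ ] SameSpan (applyT g (B i)) (B i′) →
          ∃[ i′ ] ∀ x → (x ∈span B i → apply g x ∈span B i′) × (apply g x ∈span B i′ → x ∈span B i)
        from (i′ , into , back) = i′ , λ x → forth x , (λ m → pull x (span⁻ (applyT g (B i)) (back (apply g x) m)))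
          where
            forth : ∀ x → x ∈span B i → apply g x ∈span B i′
            forth x (a , b , c , refl) = into (apply g x)
              (a , b , c , combine-linear (apply-linear g) u v w (a ∷ b ∷ c ∷ []))
            N = proj₁ (proj₁ automorphism)
            left : ∀ x → apply N (apply g x) ≡ x
            left = proj₁ (proj₂ (proj₁ automorphism))
            pull : ∀ x → ∃[ c ] combine (applyT g (B i)) c ≡ apply g x → x ∈span B i
            pull x (c , e) = subst (_∈span B i) (trans (sym (left (combine (B i) c)))
              (trans (cong (apply N) (trans (combine-linear (apply-linear g) u v w c) e)) (left x))) (span⁺ (B i) c)

    shift-iter : ∀ m i → ∃[ i′ ] ∀ x → (x ∈span B i → iter m (apply g) x ∈span B i′) × (iter m (apply g) x ∈span B i′ → x ∈span B i)
    shift-iter zero    i = i , λ x → (λ p → p) , (λ p → p)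
    shift-iter (suc m) i = from (shift-iter m i)
      where
        from : ∃[ i′ ] (∀ x → (x ∈span B i → iter m (apply g) x ∈span B i′) × (iter m (apply g) x ∈span B i′ → x ∈span B i)) →
          ∃[ i′ ] ∀ x → (x ∈span B i → iter (suc m) (apply g) x ∈span B i′) × (iter (suc m) (apply g) x ∈span B i′ → x ∈span B i)
        from (i₁ , p) = let i₂ , q = shift-block i₁ in
          i₂ , λ x → (λ z → proj₁ (q (iter m (apply g) x)) (proj₁ (p x) z)) , (λ z → proj₂ (p x) (proj₂ (q (iter m (apply g) x)) z))

    module Block (i : Fin n) where
      t = B i
      zero₃ : Coefficients
      zero₃ = replicate 3 false

      combine-zero : ∀ c → combine t c ≡ 0v → c ≡ zero₃
      combine-zero (a ∷ b ∷ c ∷ []) e with proj₁ design i a b c e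
      ... | refl , refl , refl = refl

      -- Coordinates in a block are unique, so incidence inside it becomes a question about F₂³,
      -- settled by `offLine` and `fills`.
      combine-injective : ∀ {x y} → combine t x ≡ combine t y → x ≡ y
      combine-injective {x} {y} e = xor-zero⇒≡ x y (combine-zero (x +₃ y)
        (trans (combine-⊕ t x y) (trans (cong (_⊕ combine t y) e) (⊕-self (combine t y)))))

      zero-combine : combine t zero₃ ≡ 0v
      zero-combine = trans (cong (combine t) {zero₃} {zero₃ +₃ zero₃} refl)
        (trans (combine-⊕ t zero₃ zero₃) (⊕-self (combine t zero₃)))

      nonzero : ∀ {x a} → a < 511 → combine t x ≡ pt a → x ≢ zero₃
      nonzero a< e refl = pt≢0 a< (trans (sym e) zero-combine)

      distinct′ : ∀ {x y a b} → a < 511 → b < 511 → a ≢ b → combine t x ≡ pt a → combine t y ≡ pt b → x ≢ y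
      distinct′ a< b< a≢b p q refl = a≢b (pt-injective a< b< (trans (sym p) q))

      combine-sum : ∀ {x y a b} → a < 511 → b < 511 → a ≢ b → combine t x ≡ pt a → combine t y ≡ pt b →
        combine t (x +₃ y) ≡ pt (tri a b)
      combine-sum {x} {y} a< b< a≢b p q = trans (combine-⊕ t x y) (trans (cong₂ _⊕_ p q) (pt-sum a< b< a≢b))

      sum-closed : ∀ {a b} → a < 511 → b < 511 → a ≢ b → Mem i a → Mem i b → Mem i (tri a b)
      sum-closed a< b< a≢b ma mb = let x , p = span⁻ t ma ; y , q = span⁻ t mb in
        subst (_∈span t) (combine-sum {x} {y} a< b< a≢b p q) (span⁺ t (x +₃ y))

      third-point : ∀ {a b} → a < 511 → b < 511 → a ≢ b → Mem i a → Mem i b →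
        ∃[ c ] c < 511 × Mem i c × c ∉ a ∷ b ∷ tri a b ∷ []
      third-point {a} {b} a< b< a≢b ma mb = from (span⁻ t ma) (span⁻ t mb)
        where
          from : ∃[ x ] combine t x ≡ pt a → ∃[ y ] combine t y ≡ pt b → ∃[ c ] c < 511 × Mem i c × c ∉ a ∷ b ∷ tri a b ∷ []
          from (x , p) (y , q) = named (pt-onto (combine t z) (λ e → outside (inj₁ (combine-zero z e))))
            where
              z = offLine x y
              outside : z ≡ zero₃ ⊎ z ≡ x ⊎ z ≡ y ⊎ z ≡ x +₃ y → ⊥
              outside s with () ← trans (sym (not-true (offLine-correct x y))) (inLine⁺ s)
              named : ∃[ c ] c < 511 × pt c ≡ combine t z → ∃[ c ] c < 511 × Mem i c × c ∉ a ∷ b ∷ tri a b ∷ []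
              named (c , c< , e) = c , c< , subst (_∈span t) (sym e) (span⁺ t z) , off
                where
                  off : c ∉ a ∷ b ∷ tri a b ∷ []
                  off (here refl) = outside (inj₂ (inj₁ (combine-injective (trans (sym e) (sym p)))))
                  off (there (here refl)) = outside (inj₂ (inj₂ (inj₁ (combine-injective (trans (sym e) (sym q))))))
                  off (there (there (here refl))) = outside (inj₂ (inj₂ (inj₂ (combine-injective
                    (trans (sym e) (sym (combine-sum {x} {y} a< b< a≢b p q)))))))

      exact-points : ∀ {a b c x} → a < 511 → b < 511 → c < 511 → x < 511 → a ≢ b → c ∉ a ∷ b ∷ tri a b ∷ [] →
        Mem i a → Mem i b → Mem i c → Mem i x → x ∈ plane a b c
      exact-points {a} {b} {c} {x} a< b< c< x< a≢b c∉ ma mb mc mx = from (span⁻ t ma) (span⁻ t mb) (span⁻ t mc) (span⁻ t mx)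
        where
          c≢a : c ≢ a
          c≢a e = c∉ (here e)
          c≢b : c ≢ b
          c≢b e = c∉ (there (here e))
          c≢ab : c ≢ tri a b
          c≢ab e = c∉ (there (there (here e)))
          from : ∃[ A ] combine t A ≡ pt a → ∃[ B ] combine t B ≡ pt b → ∃[ C ] combine t C ≡ pt c → ∃[ X ] combine t X ≡ pt x →
            x ∈ plane a b c
          from (A , pa) (B , pb) (C , pc) (X , px) = place (fills⁻ A B C X (nonzero a< pa) (nonzero b< pb) (distinct′ a< b< a≢b pa pb) C∉)
            where
              pab : combine t (A +₃ B) ≡ pt (tri a b)
              pab = combine-sum {A} {B} a< b< a≢b pa pb
              at : ∀ {Y y} → y < 511 → combine t Y ≡ pt y → X ≡ Y → x ≡ y
              at y< p refl = pt-injective x< y< (trans (sym px) p)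
              C∉ : inLine A B C ≢ true
              C∉ e = off (inLine⁻ A B C e)
                where
                  off : C ≡ zero₃ ⊎ C ≡ A ⊎ C ≡ B ⊎ C ≡ A +₃ B → ⊥
                  off (inj₁ z) = nonzero c< pc z
                  off (inj₂ (inj₁ z)) = distinct′ c< a< c≢a pc pa z
                  off (inj₂ (inj₂ (inj₁ z))) = distinct′ c< b< c≢b pc pb z
                  off (inj₂ (inj₂ (inj₂ z))) = distinct′ c< (tri< a b) c≢ab pc pab z
              on-line : X ≡ zero₃ ⊎ X ≡ A ⊎ X ≡ B ⊎ X ≡ A +₃ B → x ∈ plane a b c
              on-line (inj₁ z) = ⊥-elim (nonzero x< px z)
              on-line (inj₂ (inj₁ z)) = here (at a< pa z)
              on-line (inj₂ (inj₂ (inj₁ z))) = there (here (at b< pb z))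
              on-line (inj₂ (inj₂ (inj₂ z))) = there (there (here (at (tri< a b) pab z)))
              place : inLine A B X ≡ true ⊎ X ≡ C ⊎ X ≡ A +₃ C ⊎ X ≡ B +₃ C ⊎ X ≡ (A +₃ B) +₃ C → x ∈ plane a b c
              place (inj₁ l) = on-line (inLine⁻ A B X l)
              place (inj₂ (inj₁ z)) = there (there (there (here (at c< pc z))))
              place (inj₂ (inj₂ (inj₁ z))) = there (there (there (there (here
                (at (tri< a c) (combine-sum {A} {C} a< c< (λ e → c≢a (sym e)) pa pc) z)))))
              place (inj₂ (inj₂ (inj₂ (inj₁ z)))) = there (there (there (there (there (here
                (at (tri< b c) (combine-sum {B} {C} b< c< (λ e → c≢b (sym e)) pb pc) z))))))
              place (inj₂ (inj₂ (inj₂ (inj₂ z)))) = there (there (there (there (there (there (here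
                (at (tri< (tri a b) c) (combine-sum {A +₃ B} {C} (tri< a b) c< (λ e → c≢ab (sym e)) pab pc) z)))))))

    pt-distinct : ∀ {a b} → a < 511 → b < 511 → a ≢ b → pt a ≢ pt b
    pt-distinct a< b< a≢b e = a≢b (pt-injective a< b< e)

    geometry : Geometry Mem
    geometry = record
      { respects = λ {i} e m → subst (_∈span B i) (pt-≈ e) m
      ; shift    = λ i m → let i′ , p = shift-iter (m * k) i in i′ , λ a →
          (λ z → subst (_∈span B i′) (sym (moved m a)) (proj₁ (p (pt a)) z)) , (λ z → proj₂ (p (pt a)) (subst (_∈span B i′) (moved m a) z))
      ; sum      = λ {i} → Block.sum-closed i
      ; join     = λ {a} {b} a< b< a≢b →
          let i , ma , mb , _ = proj₂ design (pt a) (pt b) (pt≢0 a<) (pt≢0 b<) (pt-distinct a< b< a≢b) in i , ma , mb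
      ; unique   = λ {i} {i′} {a} {b} a< b< a≢b p q r s →
          let _ , _ , _ , only = proj₂ design (pt a) (pt b) (pt≢0 a<) (pt≢0 b<) (pt-distinct a< b< a≢b) in
          trans (only i p q) (sym (only i′ r s))
      ; third    = λ {i} → Block.third-point i
      ; exact    = λ {i} → Block.exact-points i
      }
      where
        moved : ∀ m a → pt (a + m) ≡ iter (m * k) (apply g) (pt a)
        moved m a = trans (cong pt (+-comm a m)) (trans (iter-+ m a f e₀) (iter-* m k (apply g) (pt a)))

-- Logarithms, line orbits and candidate 7-sets.

module Tables where

  open import Data.Nat using (ℕ)
  open import Data.List using (List; []; _∷_)

  -- Zech logarithms for α⁹ = α⁴ + 1. Rows of 23, about √511, keep lookups short; the entry at 0 is
  -- filler.
  zechTable : List (List ℕ)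
  zechTable =
    (0 ∷ 130 ∷ 260 ∷ 420 ∷ 9 ∷ 507 ∷ 329 ∷ 67 ∷ 18 ∷ 4 ∷ 503 ∷ 470 ∷ 147 ∷ 138 ∷ 134 ∷ 126 ∷ 36 ∷ 341 ∷ 8 ∷ 421 ∷ 495 ∷ 306 ∷ 429 ∷ []) ∷
    (337 ∷ 294 ∷ 56 ∷ 276 ∷ 142 ∷ 268 ∷ 463 ∷ 252 ∷ 486 ∷ 72 ∷ 181 ∷ 171 ∷ 231 ∷ 16 ∷ 375 ∷ 331 ∷ 214 ∷ 479 ∷ 52 ∷ 101 ∷ 370 ∷ 347 ∷ 310 ∷ []) ∷
    (163 ∷ 301 ∷ 77 ∷ 119 ∷ 112 ∷ 454 ∷ 41 ∷ 225 ∷ 284 ∷ 408 ∷ 25 ∷ 108 ∷ 415 ∷ 469 ∷ 504 ∷ 167 ∷ 461 ∷ 263 ∷ 144 ∷ 256 ∷ 362 ∷ 7 ∷ 342 ∷ []) ∷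
    (262 ∷ 462 ∷ 269 ∷ 32 ∷ 219 ∷ 239 ∷ 435 ∷ 151 ∷ 48 ∷ 428 ∷ 307 ∷ 447 ∷ 379 ∷ 104 ∷ 161 ∷ 202 ∷ 349 ∷ 229 ∷ 354 ∷ 183 ∷ 414 ∷ 109 ∷ 94 ∷ []) ∷
    (326 ∷ 304 ∷ 91 ∷ 423 ∷ 154 ∷ 186 ∷ 238 ∷ 220 ∷ 224 ∷ 42 ∷ 397 ∷ 158 ∷ 82 ∷ 384 ∷ 450 ∷ 275 ∷ 57 ∷ 90 ∷ 305 ∷ 496 ∷ 50 ∷ 358 ∷ 216 ∷ []) ∷
    (484 ∷ 319 ∷ 465 ∷ 427 ∷ 49 ∷ 497 ∷ 412 ∷ 334 ∷ 356 ∷ 411 ∷ 498 ∷ 15 ∷ 232 ∷ 288 ∷ 510 ∷ 1 ∷ 290 ∷ 213 ∷ 332 ∷ 14 ∷ 499 ∷ 173 ∷ 477 ∷ []) ∷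
    (13 ∷ 333 ∷ 413 ∷ 184 ∷ 27 ∷ 425 ∷ 64 ∷ 321 ∷ 438 ∷ 12 ∷ 478 ∷ 215 ∷ 359 ∷ 76 ∷ 302 ∷ 266 ∷ 96 ∷ 278 ∷ 345 ∷ 244 ∷ 103 ∷ 380 ∷ 383 ∷ []) ∷
    (83 ∷ 247 ∷ 46 ∷ 208 ∷ 437 ∷ 322 ∷ 61 ∷ 404 ∷ 237 ∷ 187 ∷ 34 ∷ 458 ∷ 136 ∷ 197 ∷ 472 ∷ 366 ∷ 299 ∷ 317 ∷ 312 ∷ 218 ∷ 33 ∷ 188 ∷ 88 ∷ []) ∷
    (141 ∷ 277 ∷ 97 ∷ 170 ∷ 182 ∷ 355 ∷ 335 ∷ 446 ∷ 308 ∷ 442 ∷ 372 ∷ 401 ∷ 476 ∷ 174 ∷ 440 ∷ 378 ∷ 448 ∷ 246 ∷ 84 ∷ 395 ∷ 283 ∷ 226 ∷ 316 ∷ []) ∷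
    (300 ∷ 164 ∷ 361 ∷ 257 ∷ 418 ∷ 389 ∷ 132 ∷ 39 ∷ 149 ∷ 114 ∷ 241 ∷ 180 ∷ 73 ∷ 99 ∷ 352 ∷ 481 ∷ 351 ∷ 100 ∷ 53 ∷ 205 ∷ 281 ∷ 432 ∷ 86 ∷ []) ∷
    (457 ∷ 35 ∷ 127 ∷ 388 ∷ 419 ∷ 261 ∷ 343 ∷ 169 ∷ 98 ∷ 74 ∷ 483 ∷ 217 ∷ 313 ∷ 271 ∷ 157 ∷ 398 ∷ 201 ∷ 162 ∷ 311 ∷ 318 ∷ 485 ∷ 253 ∷ 30 ∷ []) ∷
    (251 ∷ 464 ∷ 320 ∷ 65 ∷ 210 ∷ 509 ∷ 289 ∷ 2 ∷ 235 ∷ 69 ∷ 63 ∷ 426 ∷ 466 ∷ 153 ∷ 424 ∷ 28 ∷ 71 ∷ 487 ∷ 243 ∷ 346 ∷ 371 ∷ 443 ∷ 107 ∷ []) ∷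
    (26 ∷ 185 ∷ 155 ∷ 406 ∷ 315 ∷ 227 ∷ 368 ∷ 204 ∷ 54 ∷ 490 ∷ 339 ∷ 387 ∷ 128 ∷ 259 ∷ 131 ∷ 390 ∷ 365 ∷ 473 ∷ 24 ∷ 409 ∷ 445 ∷ 336 ∷ 430 ∷ []) ∷
    (177 ∷ 207 ∷ 47 ∷ 152 ∷ 467 ∷ 93 ∷ 110 ∷ 21 ∷ 79 ∷ 192 ∷ 393 ∷ 45 ∷ 248 ∷ 179 ∷ 242 ∷ 488 ∷ 280 ∷ 206 ∷ 178 ∷ 249 ∷ 116 ∷ 255 ∷ 145 ∷ []) ∷
    (166 ∷ 505 ∷ 494 ∷ 422 ∷ 92 ∷ 468 ∷ 416 ∷ 6 ∷ 363 ∷ 38 ∷ 133 ∷ 139 ∷ 122 ∷ 190 ∷ 297 ∷ 23 ∷ 474 ∷ 286 ∷ 374 ∷ 17 ∷ 68 ∷ 236 ∷ 405 ∷ []) ∷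
    (156 ∷ 272 ∷ 44 ∷ 394 ∷ 85 ∷ 433 ∷ 223 ∷ 221 ∷ 456 ∷ 87 ∷ 189 ∷ 123 ∷ 453 ∷ 113 ∷ 150 ∷ 436 ∷ 209 ∷ 66 ∷ 330 ∷ 376 ∷ 292 ∷ 176 ∷ 431 ∷ []) ∷
    (282 ∷ 396 ∷ 43 ∷ 273 ∷ 194 ∷ 386 ∷ 340 ∷ 37 ∷ 364 ∷ 391 ∷ 199 ∷ 81 ∷ 159 ∷ 382 ∷ 381 ∷ 160 ∷ 105 ∷ 400 ∷ 373 ∷ 287 ∷ 233 ∷ 212 ∷ 291 ∷ []) ∷
    (377 ∷ 441 ∷ 309 ∷ 348 ∷ 203 ∷ 369 ∷ 102 ∷ 245 ∷ 449 ∷ 385 ∷ 195 ∷ 492 ∷ 460 ∷ 168 ∷ 344 ∷ 279 ∷ 489 ∷ 55 ∷ 295 ∷ 452 ∷ 124 ∷ 121 ∷ 140 ∷ []) ∷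
    (89 ∷ 58 ∷ 328 ∷ 508 ∷ 211 ∷ 234 ∷ 3 ∷ 19 ∷ 325 ∷ 95 ∷ 267 ∷ 143 ∷ 264 ∷ 118 ∷ 78 ∷ 22 ∷ 298 ∷ 367 ∷ 228 ∷ 350 ∷ 482 ∷ 75 ∷ 360 ∷ []) ∷
    (165 ∷ 146 ∷ 471 ∷ 198 ∷ 392 ∷ 193 ∷ 274 ∷ 451 ∷ 296 ∷ 191 ∷ 80 ∷ 200 ∷ 399 ∷ 106 ∷ 444 ∷ 410 ∷ 357 ∷ 51 ∷ 480 ∷ 353 ∷ 230 ∷ 172 ∷ 500 ∷ []) ∷
    (403 ∷ 62 ∷ 70 ∷ 29 ∷ 254 ∷ 117 ∷ 265 ∷ 303 ∷ 327 ∷ 59 ∷ 11 ∷ 439 ∷ 175 ∷ 293 ∷ 338 ∷ 491 ∷ 196 ∷ 137 ∷ 148 ∷ 40 ∷ 455 ∷ 222 ∷ 434 ∷ []) ∷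
    (240 ∷ 115 ∷ 250 ∷ 31 ∷ 270 ∷ 314 ∷ 407 ∷ 285 ∷ 475 ∷ 402 ∷ 501 ∷ 324 ∷ 20 ∷ 111 ∷ 120 ∷ 125 ∷ 135 ∷ 459 ∷ 493 ∷ 506 ∷ 10 ∷ 60 ∷ 323 ∷ []) ∷
    (502 ∷ 5 ∷ 417 ∷ 258 ∷ 129 ∷ []) ∷
    []

  classTable : List (List ℕ)
  classTable =
    (0 ∷ 27 ∷ 28 ∷ 78 ∷ 29 ∷ 29 ∷ 79 ∷ 51 ∷ 30 ∷ 29 ∷ 30 ∷ 60 ∷ 80 ∷ 58 ∷ 52 ∷ 49 ∷ 31 ∷ 36 ∷ 30 ∷ 18 ∷ 31 ∷ 6 ∷ 61 ∷ []) ∷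
    (17 ∷ 72 ∷ 45 ∷ 59 ∷ 70 ∷ 53 ∷ 73 ∷ 50 ∷ 45 ∷ 32 ∷ 41 ∷ 37 ∷ 83 ∷ 31 ∷ 39 ∷ 19 ∷ 1 ∷ 32 ∷ 60 ∷ 7 ∷ 11 ∷ 62 ∷ 26 ∷ []) ∷
    (9 ∷ 77 ∷ 73 ∷ 81 ∷ 46 ∷ 63 ∷ 60 ∷ 13 ∷ 71 ∷ 66 ∷ 45 ∷ 63 ∷ 74 ∷ 7 ∷ 51 ∷ 14 ∷ 46 ∷ 48 ∷ 33 ∷ 35 ∷ 42 ∷ 51 ∷ 38 ∷ []) ∷
    (57 ∷ 81 ∷ 69 ∷ 32 ∷ 84 ∷ 40 ∷ 20 ∷ 20 ∷ 73 ∷ 2 ∷ 65 ∷ 33 ∷ 43 ∷ 61 ∷ 2 ∷ 8 ∷ 44 ∷ 12 ∷ 16 ∷ 54 ∷ 23 ∷ 18 ∷ 78 ∷ []) ∷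
    (10 ∷ 22 ∷ 78 ∷ 54 ∷ 74 ∷ 23 ∷ 82 ∷ 68 ∷ 47 ∷ 7 ∷ 64 ∷ 66 ∷ 61 ∷ 76 ∷ 14 ∷ 0 ∷ 63 ∷ 18 ∷ 67 ∷ 49 ∷ 46 ∷ 5 ∷ 64 ∷ []) ∷
    (70 ∷ 75 ∷ 9 ∷ 8 ∷ 81 ∷ 52 ∷ 68 ∷ 15 ∷ 25 ∷ 47 ∷ 58 ∷ 49 ∷ 76 ∷ 34 ∷ 27 ∷ 27 ∷ 56 ∷ 43 ∷ 4 ∷ 52 ∷ 80 ∷ 39 ∷ 37 ∷ []) ∷
    (58 ∷ 24 ∷ 82 ∷ 11 ∷ 70 ∷ 12 ∷ 33 ∷ 55 ∷ 84 ∷ 80 ∷ 41 ∷ 42 ∷ 21 ∷ 20 ∷ 21 ∷ 5 ∷ 74 ∷ 25 ∷ 3 ∷ 16 ∷ 66 ∷ 56 ∷ 34 ∷ []) ∷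
    (2 ∷ 44 ∷ 9 ∷ 62 ∷ 40 ∷ 3 ∷ 14 ∷ 0 ∷ 38 ∷ 36 ∷ 37 ∷ 13 ∷ 39 ∷ 17 ∷ 1 ∷ 55 ∷ 15 ∷ 24 ∷ 4 ∷ 19 ∷ 41 ∷ 79 ∷ 54 ∷ []) ∷
    (11 ∷ 10 ∷ 23 ∷ 36 ∷ 79 ∷ 3 ∷ 55 ∷ 35 ∷ 75 ∷ 57 ∷ 24 ∷ 67 ∷ 83 ∷ 17 ∷ 69 ∷ 4 ∷ 48 ∷ 26 ∷ 8 ∷ 75 ∷ 65 ∷ 6 ∷ 67 ∷ []) ∷
    (22 ∷ 62 ∷ 21 ∷ 77 ∷ 22 ∷ 15 ∷ 43 ∷ 1 ∷ 42 ∷ 64 ∷ 72 ∷ 19 ∷ 84 ∷ 68 ∷ 56 ∷ 50 ∷ 34 ∷ 47 ∷ 13 ∷ 6 ∷ 71 ∷ 65 ∷ 12 ∷ []) ∷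
    (71 ∷ 83 ∷ 76 ∷ 25 ∷ 10 ∷ 59 ∷ 0 ∷ 38 ∷ 82 ∷ 40 ∷ 53 ∷ 72 ∷ 69 ∷ 53 ∷ 16 ∷ 5 ∷ 26 ∷ 44 ∷ 48 ∷ 57 ∷ 59 ∷ 28 ∷ 50 ∷ []) ∷
    (28 ∷ 77 ∷ 35 ∷ 35 ∷ 77 ∷ 28 ∷ 50 ∷ 28 ∷ 59 ∷ 57 ∷ 48 ∷ 44 ∷ 26 ∷ 5 ∷ 16 ∷ 53 ∷ 69 ∷ 72 ∷ 53 ∷ 40 ∷ 82 ∷ 38 ∷ 0 ∷ []) ∷
    (59 ∷ 10 ∷ 25 ∷ 76 ∷ 83 ∷ 71 ∷ 12 ∷ 65 ∷ 71 ∷ 6 ∷ 13 ∷ 47 ∷ 34 ∷ 50 ∷ 56 ∷ 68 ∷ 84 ∷ 19 ∷ 72 ∷ 64 ∷ 42 ∷ 1 ∷ 43 ∷ []) ∷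
    (15 ∷ 22 ∷ 77 ∷ 21 ∷ 62 ∷ 22 ∷ 67 ∷ 6 ∷ 65 ∷ 75 ∷ 8 ∷ 26 ∷ 48 ∷ 4 ∷ 69 ∷ 17 ∷ 83 ∷ 67 ∷ 24 ∷ 57 ∷ 75 ∷ 35 ∷ 55 ∷ []) ∷
    (3 ∷ 79 ∷ 36 ∷ 23 ∷ 10 ∷ 11 ∷ 54 ∷ 79 ∷ 41 ∷ 19 ∷ 4 ∷ 24 ∷ 15 ∷ 55 ∷ 1 ∷ 17 ∷ 39 ∷ 13 ∷ 37 ∷ 36 ∷ 38 ∷ 0 ∷ 14 ∷ []) ∷
    (3 ∷ 40 ∷ 62 ∷ 9 ∷ 44 ∷ 2 ∷ 34 ∷ 56 ∷ 66 ∷ 16 ∷ 3 ∷ 25 ∷ 74 ∷ 5 ∷ 21 ∷ 20 ∷ 21 ∷ 42 ∷ 41 ∷ 80 ∷ 84 ∷ 55 ∷ 33 ∷ []) ∷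
    (12 ∷ 70 ∷ 11 ∷ 82 ∷ 24 ∷ 58 ∷ 37 ∷ 39 ∷ 80 ∷ 52 ∷ 4 ∷ 43 ∷ 56 ∷ 27 ∷ 27 ∷ 34 ∷ 76 ∷ 49 ∷ 58 ∷ 47 ∷ 25 ∷ 15 ∷ 68 ∷ []) ∷
    (52 ∷ 81 ∷ 8 ∷ 9 ∷ 75 ∷ 70 ∷ 64 ∷ 5 ∷ 46 ∷ 49 ∷ 67 ∷ 18 ∷ 63 ∷ 0 ∷ 14 ∷ 76 ∷ 61 ∷ 66 ∷ 64 ∷ 7 ∷ 47 ∷ 68 ∷ 82 ∷ []) ∷
    (23 ∷ 74 ∷ 54 ∷ 78 ∷ 22 ∷ 10 ∷ 78 ∷ 18 ∷ 23 ∷ 54 ∷ 16 ∷ 12 ∷ 44 ∷ 8 ∷ 2 ∷ 61 ∷ 43 ∷ 33 ∷ 65 ∷ 2 ∷ 73 ∷ 20 ∷ 20 ∷ []) ∷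
    (40 ∷ 84 ∷ 32 ∷ 69 ∷ 81 ∷ 57 ∷ 38 ∷ 51 ∷ 42 ∷ 35 ∷ 33 ∷ 48 ∷ 46 ∷ 14 ∷ 51 ∷ 7 ∷ 74 ∷ 63 ∷ 45 ∷ 66 ∷ 71 ∷ 13 ∷ 60 ∷ []) ∷
    (63 ∷ 46 ∷ 81 ∷ 73 ∷ 77 ∷ 9 ∷ 26 ∷ 62 ∷ 11 ∷ 7 ∷ 60 ∷ 32 ∷ 1 ∷ 19 ∷ 39 ∷ 31 ∷ 83 ∷ 37 ∷ 41 ∷ 32 ∷ 45 ∷ 50 ∷ 73 ∷ []) ∷
    (53 ∷ 70 ∷ 59 ∷ 45 ∷ 72 ∷ 17 ∷ 61 ∷ 6 ∷ 31 ∷ 18 ∷ 30 ∷ 36 ∷ 31 ∷ 49 ∷ 52 ∷ 58 ∷ 80 ∷ 60 ∷ 30 ∷ 29 ∷ 30 ∷ 51 ∷ 79 ∷ []) ∷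
    (29 ∷ 29 ∷ 78 ∷ 28 ∷ 27 ∷ []) ∷
    []

  -- One difference for each line orbit, ordered so that doubling moves cyclically through nine
  -- blocks of nine and then through 81, 82, 83. The last entry is 73 = 511 / 7, a generator of F₈*.
  spanTable : List ℕ
  spanTable =
    107 ∷ 214 ∷ 428 ∷ 345 ∷ 179 ∷ 358 ∷ 205 ∷ 410 ∷ 309 ∷ 46 ∷ 92 ∷ 184 ∷ 368 ∷ 225 ∷ 450 ∷ 389 ∷ 267 ∷
    23 ∷ 19 ∷ 38 ∷ 76 ∷ 152 ∷ 304 ∷ 97 ∷ 194 ∷ 388 ∷ 265 ∷ 1 ∷ 2 ∷ 4 ∷ 8 ∷ 16 ∷ 32 ∷ 64 ∷
    128 ∷ 256 ∷ 17 ∷ 34 ∷ 68 ∷ 136 ∷ 272 ∷ 33 ∷ 66 ∷ 132 ∷ 264 ∷ 25 ∷ 50 ∷ 100 ∷ 200 ∷ 400 ∷ 289 ∷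
    67 ∷ 134 ∷ 268 ∷ 88 ∷ 176 ∷ 352 ∷ 193 ∷ 386 ∷ 261 ∷ 11 ∷ 22 ∷ 44 ∷ 51 ∷ 102 ∷ 204 ∷ 408 ∷ 305 ∷
    99 ∷ 198 ∷ 396 ∷ 281 ∷ 24 ∷ 48 ∷ 96 ∷ 192 ∷ 384 ∷ 257 ∷ 3 ∷ 6 ∷ 12 ∷ 49 ∷ 98 ∷ 196 ∷ 73 ∷
    []

  -- One 7-set for each Frobenius orbit. The 39 sets through 81 come first and are the roots of the
  -- search.
  representatives : List (List ℕ)
  representatives =
    (4 ∷ 27 ∷ 46 ∷ 48 ∷ 51 ∷ 57 ∷ 81 ∷ []) ∷
    (4 ∷ 27 ∷ 48 ∷ 52 ∷ 57 ∷ 69 ∷ 81 ∷ []) ∷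
    (7 ∷ 27 ∷ 30 ∷ 37 ∷ 51 ∷ 60 ∷ 81 ∷ []) ∷
    (11 ∷ 20 ∷ 24 ∷ 28 ∷ 55 ∷ 79 ∷ 81 ∷ []) ∷
    (7 ∷ 24 ∷ 27 ∷ 53 ∷ 69 ∷ 73 ∷ 81 ∷ []) ∷
    (19 ∷ 28 ∷ 32 ∷ 41 ∷ 43 ∷ 68 ∷ 81 ∷ []) ∷
    (17 ∷ 26 ∷ 29 ∷ 32 ∷ 67 ∷ 70 ∷ 81 ∷ []) ∷
    (4 ∷ 8 ∷ 27 ∷ 48 ∷ 57 ∷ 75 ∷ 81 ∷ []) ∷
    (27 ∷ 30 ∷ 33 ∷ 46 ∷ 49 ∷ 52 ∷ 81 ∷ []) ∷
    (28 ∷ 32 ∷ 50 ∷ 65 ∷ 77 ∷ 79 ∷ 81 ∷ []) ∷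
    (9 ∷ 11 ∷ 22 ∷ 28 ∷ 62 ∷ 77 ∷ 81 ∷ []) ∷
    (13 ∷ 25 ∷ 29 ∷ 56 ∷ 62 ∷ 64 ∷ 81 ∷ []) ∷
    (23 ∷ 32 ∷ 35 ∷ 37 ∷ 56 ∷ 68 ∷ 81 ∷ []) ∷
    (2 ∷ 8 ∷ 27 ∷ 43 ∷ 60 ∷ 73 ∷ 81 ∷ []) ∷
    (8 ∷ 14 ∷ 28 ∷ 38 ∷ 55 ∷ 63 ∷ 81 ∷ []) ∷
    (13 ∷ 14 ∷ 29 ∷ 42 ∷ 55 ∷ 74 ∷ 81 ∷ []) ∷
    (7 ∷ 21 ∷ 24 ∷ 28 ∷ 63 ∷ 68 ∷ 81 ∷ []) ∷
    (9 ∷ 28 ∷ 38 ∷ 40 ∷ 52 ∷ 54 ∷ 81 ∷ []) ∷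
    (21 ∷ 22 ∷ 28 ∷ 41 ∷ 54 ∷ 66 ∷ 81 ∷ []) ∷
    (4 ∷ 8 ∷ 28 ∷ 43 ∷ 52 ∷ 65 ∷ 81 ∷ []) ∷
    (4 ∷ 24 ∷ 27 ∷ 48 ∷ 57 ∷ 79 ∷ 81 ∷ []) ∷
    (13 ∷ 14 ∷ 19 ∷ 38 ∷ 56 ∷ 68 ∷ 81 ∷ []) ∷
    (20 ∷ 26 ∷ 55 ∷ 56 ∷ 59 ∷ 64 ∷ 81 ∷ []) ∷
    (5 ∷ 37 ∷ 56 ∷ 61 ∷ 72 ∷ 80 ∷ 81 ∷ []) ∷
    (12 ∷ 15 ∷ 19 ∷ 43 ∷ 60 ∷ 78 ∷ 81 ∷ []) ∷
    (20 ∷ 43 ∷ 46 ∷ 48 ∷ 58 ∷ 79 ∷ 81 ∷ []) ∷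
    (36 ∷ 38 ∷ 46 ∷ 58 ∷ 63 ∷ 68 ∷ 81 ∷ []) ∷
    (21 ∷ 41 ∷ 61 ∷ 68 ∷ 69 ∷ 73 ∷ 81 ∷ []) ∷
    (10 ∷ 17 ∷ 22 ∷ 61 ∷ 66 ∷ 70 ∷ 81 ∷ []) ∷
    (0 ∷ 39 ∷ 47 ∷ 53 ∷ 80 ∷ 81 ∷ 82 ∷ []) ∷
    (3 ∷ 9 ∷ 75 ∷ 77 ∷ 78 ∷ 81 ∷ 82 ∷ []) ∷
    (0 ∷ 3 ∷ 6 ∷ 74 ∷ 77 ∷ 80 ∷ 81 ∷ []) ∷
    (7 ∷ 21 ∷ 26 ∷ 45 ∷ 53 ∷ 78 ∷ 81 ∷ []) ∷
    (45 ∷ 48 ∷ 51 ∷ 72 ∷ 75 ∷ 78 ∷ 81 ∷ []) ∷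
    (13 ∷ 36 ∷ 42 ∷ 53 ∷ 68 ∷ 69 ∷ 81 ∷ []) ∷
    (9 ∷ 13 ∷ 25 ∷ 36 ∷ 38 ∷ 64 ∷ 81 ∷ []) ∷
    (0 ∷ 3 ∷ 6 ∷ 36 ∷ 39 ∷ 42 ∷ 81 ∷ []) ∷
    (18 ∷ 21 ∷ 24 ∷ 47 ∷ 50 ∷ 53 ∷ 81 ∷ []) ∷
    (0 ∷ 3 ∷ 6 ∷ 9 ∷ 12 ∷ 15 ∷ 81 ∷ []) ∷
    (10 ∷ 27 ∷ 28 ∷ 56 ∷ 59 ∷ 76 ∷ 78 ∷ []) ∷
    (2 ∷ 15 ∷ 27 ∷ 28 ∷ 43 ∷ 56 ∷ 68 ∷ []) ∷
    (18 ∷ 27 ∷ 29 ∷ 30 ∷ 49 ∷ 68 ∷ 78 ∷ []) ∷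
    (0 ∷ 14 ∷ 27 ∷ 38 ∷ 43 ∷ 57 ∷ 59 ∷ []) ∷
    (1 ∷ 4 ∷ 8 ∷ 19 ∷ 27 ∷ 43 ∷ 78 ∷ []) ∷
    (4 ∷ 24 ∷ 27 ∷ 29 ∷ 52 ∷ 58 ∷ 75 ∷ []) ∷
    (1 ∷ 18 ∷ 27 ∷ 32 ∷ 41 ∷ 42 ∷ 44 ∷ []) ∷
    (4 ∷ 27 ∷ 29 ∷ 47 ∷ 54 ∷ 78 ∷ 79 ∷ []) ∷
    (6 ∷ 18 ∷ 27 ∷ 31 ∷ 49 ∷ 55 ∷ 67 ∷ []) ∷
    (12 ∷ 27 ∷ 33 ∷ 42 ∷ 44 ∷ 48 ∷ 52 ∷ []) ∷
    (3 ∷ 14 ∷ 25 ∷ 27 ∷ 42 ∷ 59 ∷ 76 ∷ []) ∷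
    (27 ∷ 29 ∷ 49 ∷ 52 ∷ 58 ∷ 70 ∷ 80 ∷ []) ∷
    (5 ∷ 12 ∷ 21 ∷ 27 ∷ 31 ∷ 42 ∷ 64 ∷ []) ∷
    (14 ∷ 17 ∷ 19 ∷ 27 ∷ 39 ∷ 62 ∷ 72 ∷ []) ∷
    (15 ∷ 27 ∷ 33 ∷ 38 ∷ 43 ∷ 55 ∷ 77 ∷ []) ∷
    (25 ∷ 27 ∷ 41 ∷ 42 ∷ 48 ∷ 51 ∷ 79 ∷ []) ∷
    (22 ∷ 27 ∷ 28 ∷ 34 ∷ 43 ∷ 77 ∷ 78 ∷ []) ∷
    (3 ∷ 14 ∷ 27 ∷ 39 ∷ 51 ∷ 57 ∷ 79 ∷ []) ∷
    (5 ∷ 16 ∷ 27 ∷ 37 ∷ 54 ∷ 72 ∷ 74 ∷ []) ∷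
    (10 ∷ 11 ∷ 17 ∷ 22 ∷ 27 ∷ 39 ∷ 62 ∷ []) ∷
    (2 ∷ 6 ∷ 15 ∷ 27 ∷ 61 ∷ 63 ∷ 65 ∷ []) ∷
    (1 ∷ 8 ∷ 9 ∷ 26 ∷ 27 ∷ 44 ∷ 80 ∷ []) ∷
    (15 ∷ 27 ∷ 28 ∷ 47 ∷ 50 ∷ 73 ∷ 77 ∷ []) ∷
    (27 ∷ 36 ∷ 37 ∷ 41 ∷ 60 ∷ 74 ∷ 79 ∷ []) ∷
    (3 ∷ 16 ∷ 27 ∷ 40 ∷ 53 ∷ 64 ∷ 70 ∷ []) ∷
    (11 ∷ 13 ∷ 27 ∷ 39 ∷ 60 ∷ 79 ∷ 80 ∷ []) ∷
    (3 ∷ 6 ∷ 15 ∷ 25 ∷ 27 ∷ 51 ∷ 55 ∷ []) ∷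
    (16 ∷ 27 ∷ 49 ∷ 53 ∷ 64 ∷ 70 ∷ 72 ∷ []) ∷
    (7 ∷ 13 ∷ 27 ∷ 47 ∷ 54 ∷ 60 ∷ 73 ∷ []) ∷
    (10 ∷ 27 ∷ 34 ∷ 45 ∷ 50 ∷ 56 ∷ 66 ∷ []) ∷
    (27 ∷ 40 ∷ 45 ∷ 64 ∷ 66 ∷ 72 ∷ 76 ∷ []) ∷
    (3 ∷ 6 ∷ 13 ∷ 21 ∷ 27 ∷ 31 ∷ 39 ∷ []) ∷
    (15 ∷ 22 ∷ 24 ∷ 27 ∷ 36 ∷ 67 ∷ 73 ∷ []) ∷
    (8 ∷ 9 ∷ 19 ∷ 26 ∷ 27 ∷ 44 ∷ 62 ∷ []) ∷
    (27 ∷ 43 ∷ 56 ∷ 59 ∷ 61 ∷ 66 ∷ 73 ∷ []) ∷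
    (5 ∷ 26 ∷ 27 ∷ 46 ∷ 48 ∷ 69 ∷ 75 ∷ []) ∷
    (10 ∷ 19 ∷ 26 ∷ 27 ∷ 39 ∷ 41 ∷ 80 ∷ []) ∷
    (10 ∷ 15 ∷ 22 ∷ 25 ∷ 27 ∷ 50 ∷ 61 ∷ []) ∷
    (0 ∷ 14 ∷ 19 ∷ 27 ∷ 38 ∷ 46 ∷ 63 ∷ []) ∷
    (12 ∷ 16 ∷ 27 ∷ 53 ∷ 58 ∷ 64 ∷ 70 ∷ []) ∷
    (10 ∷ 23 ∷ 25 ∷ 27 ∷ 41 ∷ 45 ∷ 74 ∷ []) ∷
    (7 ∷ 11 ∷ 13 ∷ 27 ∷ 54 ∷ 69 ∷ 74 ∷ []) ∷
    (1 ∷ 18 ∷ 22 ∷ 27 ∷ 31 ∷ 67 ∷ 78 ∷ []) ∷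
    (0 ∷ 1 ∷ 17 ∷ 22 ∷ 27 ∷ 43 ∷ 61 ∷ []) ∷
    (5 ∷ 27 ∷ 36 ∷ 46 ∷ 63 ∷ 65 ∷ 74 ∷ []) ∷
    (5 ∷ 17 ∷ 21 ∷ 26 ∷ 27 ∷ 39 ∷ 62 ∷ []) ∷
    (5 ∷ 11 ∷ 17 ∷ 27 ∷ 53 ∷ 69 ∷ 72 ∷ []) ∷
    (25 ∷ 27 ∷ 28 ∷ 45 ∷ 50 ∷ 59 ∷ 68 ∷ []) ∷
    (20 ∷ 27 ∷ 40 ∷ 53 ∷ 66 ∷ 67 ∷ 73 ∷ []) ∷
    (3 ∷ 7 ∷ 13 ∷ 16 ∷ 27 ∷ 54 ∷ 79 ∷ []) ∷
    (5 ∷ 16 ∷ 27 ∷ 53 ∷ 64 ∷ 66 ∷ 70 ∷ []) ∷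
    (6 ∷ 20 ∷ 25 ∷ 27 ∷ 61 ∷ 66 ∷ 71 ∷ []) ∷
    (7 ∷ 25 ∷ 27 ∷ 47 ∷ 71 ∷ 74 ∷ 79 ∷ []) ∷
    (10 ∷ 11 ∷ 27 ∷ 59 ∷ 66 ∷ 70 ∷ 80 ∷ []) ∷
    (4 ∷ 19 ∷ 27 ∷ 46 ∷ 54 ∷ 69 ∷ 72 ∷ []) ∷
    (3 ∷ 27 ∷ 52 ∷ 57 ∷ 59 ∷ 70 ∷ 75 ∷ []) ∷
    (13 ∷ 20 ∷ 21 ∷ 27 ∷ 61 ∷ 73 ∷ 77 ∷ []) ∷
    (7 ∷ 11 ∷ 16 ∷ 27 ∷ 53 ∷ 64 ∷ 70 ∷ []) ∷
    (6 ∷ 13 ∷ 20 ∷ 27 ∷ 65 ∷ 71 ∷ 74 ∷ []) ∷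
    (11 ∷ 12 ∷ 16 ∷ 27 ∷ 47 ∷ 66 ∷ 71 ∷ []) ∷
    (13 ∷ 16 ∷ 27 ∷ 37 ∷ 47 ∷ 58 ∷ 77 ∷ []) ∷
    (5 ∷ 12 ∷ 27 ∷ 40 ∷ 65 ∷ 70 ∷ 75 ∷ []) ∷
    (2 ∷ 12 ∷ 27 ∷ 44 ∷ 62 ∷ 65 ∷ 68 ∷ []) ∷
    (2 ∷ 9 ∷ 22 ∷ 27 ∷ 37 ∷ 62 ∷ 77 ∷ []) ∷
    (8 ∷ 9 ∷ 26 ∷ 27 ∷ 41 ∷ 44 ∷ 48 ∷ []) ∷
    (0 ∷ 14 ∷ 17 ∷ 27 ∷ 38 ∷ 51 ∷ 55 ∷ []) ∷
    (14 ∷ 38 ∷ 43 ∷ 48 ∷ 56 ∷ 70 ∷ 71 ∷ []) ∷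
    (4 ∷ 19 ∷ 38 ∷ 44 ∷ 54 ∷ 56 ∷ 78 ∷ []) ∷
    (1 ∷ 51 ∷ 56 ∷ 58 ∷ 69 ∷ 71 ∷ 79 ∷ []) ∷
    (13 ∷ 19 ∷ 52 ∷ 56 ∷ 60 ∷ 76 ∷ 78 ∷ []) ∷
    (4 ∷ 39 ∷ 44 ∷ 56 ∷ 59 ∷ 64 ∷ 73 ∷ []) ∷
    (1 ∷ 3 ∷ 36 ∷ 45 ∷ 52 ∷ 56 ∷ 66 ∷ []) ∷
    (36 ∷ 40 ∷ 44 ∷ 45 ∷ 55 ∷ 56 ∷ 64 ∷ []) ∷
    (8 ∷ 18 ∷ 24 ∷ 48 ∷ 56 ∷ 57 ∷ 66 ∷ []) ∷
    (21 ∷ 23 ∷ 43 ∷ 46 ∷ 48 ∷ 56 ∷ 57 ∷ []) ∷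
    (16 ∷ 17 ∷ 19 ∷ 22 ∷ 39 ∷ 52 ∷ 56 ∷ []) ∷
    (18 ∷ 24 ∷ 43 ∷ 46 ∷ 53 ∷ 56 ∷ 61 ∷ []) ∷
    (22 ∷ 36 ∷ 52 ∷ 55 ∷ 56 ∷ 60 ∷ 65 ∷ []) ∷
    (4 ∷ 5 ∷ 9 ∷ 16 ∷ 56 ∷ 59 ∷ 61 ∷ []) ∷
    (3 ∷ 7 ∷ 23 ∷ 48 ∷ 50 ∷ 56 ∷ 66 ∷ []) ∷
    (23 ∷ 24 ∷ 46 ∷ 56 ∷ 65 ∷ 70 ∷ 77 ∷ []) ∷
    (8 ∷ 10 ∷ 21 ∷ 51 ∷ 56 ∷ 58 ∷ 69 ∷ []) ∷
    (5 ∷ 16 ∷ 26 ∷ 56 ∷ 62 ∷ 63 ∷ 64 ∷ []) ∷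
    (5 ∷ 36 ∷ 37 ∷ 40 ∷ 56 ∷ 63 ∷ 79 ∷ []) ∷
    (1 ∷ 3 ∷ 6 ∷ 9 ∷ 51 ∷ 56 ∷ 74 ∷ []) ∷
    (17 ∷ 49 ∷ 56 ∷ 69 ∷ 73 ∷ 75 ∷ 79 ∷ []) ∷
    (2 ∷ 21 ∷ 43 ∷ 56 ∷ 69 ∷ 71 ∷ 73 ∷ []) ∷
    (0 ∷ 5 ∷ 56 ∷ 64 ∷ 71 ∷ 73 ∷ 79 ∷ []) ∷
    (17 ∷ 25 ∷ 40 ∷ 42 ∷ 56 ∷ 63 ∷ 79 ∷ []) ∷
    (7 ∷ 44 ∷ 52 ∷ 55 ∷ 56 ∷ 59 ∷ 76 ∷ []) ∷
    (8 ∷ 18 ∷ 21 ∷ 37 ∷ 46 ∷ 53 ∷ 56 ∷ []) ∷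
    (6 ∷ 7 ∷ 9 ∷ 19 ∷ 44 ∷ 48 ∷ 56 ∷ []) ∷
    (0 ∷ 11 ∷ 25 ∷ 37 ∷ 52 ∷ 73 ∷ 78 ∷ []) ∷
    (3 ∷ 5 ∷ 20 ∷ 38 ∷ 44 ∷ 69 ∷ 78 ∷ []) ∷
    (6 ∷ 43 ∷ 49 ∷ 64 ∷ 65 ∷ 78 ∷ 80 ∷ []) ∷
    (14 ∷ 21 ∷ 25 ∷ 49 ∷ 72 ∷ 78 ∷ 80 ∷ []) ∷
    (6 ∷ 8 ∷ 49 ∷ 68 ∷ 70 ∷ 72 ∷ 78 ∷ []) ∷
    (15 ∷ 17 ∷ 42 ∷ 48 ∷ 53 ∷ 68 ∷ 78 ∷ []) ∷
    (5 ∷ 20 ∷ 22 ∷ 36 ∷ 65 ∷ 74 ∷ 78 ∷ []) ∷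
    (9 ∷ 11 ∷ 22 ∷ 36 ∷ 52 ∷ 73 ∷ 78 ∷ []) ∷
    (8 ∷ 16 ∷ 21 ∷ 51 ∷ 70 ∷ 72 ∷ 78 ∷ []) ∷
    (1 ∷ 13 ∷ 22 ∷ 43 ∷ 52 ∷ 65 ∷ 78 ∷ []) ∷
    (0 ∷ 21 ∷ 25 ∷ 26 ∷ 67 ∷ 70 ∷ 78 ∷ []) ∷
    (13 ∷ 19 ∷ 38 ∷ 45 ∷ 48 ∷ 53 ∷ 78 ∷ []) ∷
    (36 ∷ 37 ∷ 39 ∷ 52 ∷ 63 ∷ 65 ∷ 78 ∷ []) ∷
    (1 ∷ 8 ∷ 24 ∷ 25 ∷ 70 ∷ 72 ∷ 78 ∷ []) ∷
    (8 ∷ 15 ∷ 19 ∷ 21 ∷ 42 ∷ 53 ∷ 78 ∷ []) ∷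
    (4 ∷ 24 ∷ 26 ∷ 40 ∷ 43 ∷ 51 ∷ 52 ∷ []) ∷
    (0 ∷ 16 ∷ 23 ∷ 24 ∷ 26 ∷ 43 ∷ 46 ∷ []) ∷
    (11 ∷ 16 ∷ 26 ∷ 43 ∷ 49 ∷ 50 ∷ 64 ∷ []) ∷
    (0 ∷ 9 ∷ 12 ∷ 14 ∷ 43 ∷ 45 ∷ 46 ∷ []) ∷
    (5 ∷ 6 ∷ 10 ∷ 14 ∷ 47 ∷ 52 ∷ 68 ∷ []) ∷
    (2 ∷ 4 ∷ 6 ∷ 12 ∷ 22 ∷ 46 ∷ 68 ∷ []) ∷
    []

-- The finite checks and their assembly into the theorem.

open import Agda.Builtin.Nat using (mod-helper)
open import Data.Bool using (Bool; true; _∧_; _∨_)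
open import Data.Nat
open import Data.Nat.Properties
open import Data.Nat.DivMod hiding (_%_; _/_)
open import Data.List using (List; []; _∷_; map)
open import Data.List.Relation.Unary.All as All using (All; []; _∷_)
open import Data.Product using (Σ; _×_; _,_; proj₁; proj₂)
open import Data.Empty using (⊥; ⊥-elim)
open import Relation.Binary.PropositionalEquality
open Search using (elem; ∧-true; ∨-true)
open Lists
open Tables
open Exponent
open LinearAlgebra
open Singer
open Planes

-- Numbers of items tried first at the three rebuilding levels. They tune the cost of the search, as
-- `step₁` falls back on all items.
levels : List ℕ
levels = 45 ∷ 30 ∷ 18 ∷ []

levels≢[] : levels ≢ []
levels≢[] ()

nonzero-case : ∀ {d b} → 0 < d → (d ≡ᵇ 0) ∨ b ≡ true → b ≡ true
nonzero-case (s≤s _) e = e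

nth-bounded : ∀ rs → every (every (λ i → i <ᵇ 85)) rs ≡ true → ∀ k → All (_< 85) (Refute.nth (λ t → t) [] rs k)
nth-bounded []       e k       = []
nth-bounded (r ∷ rs) e zero    = All.tabulate λ x∈ → <ᵇ-true (every⁻ {xs = r} (proj₁ (∧-true e)) x∈)
nth-bounded (r ∷ rs) e (suc k) = nth-bounded rs (∧-true² {every (λ i → i <ᵇ 85) r} e) k

module Checks (zech class span : ℕ → ℕ) (reps : List (List ℕ)) where
  open Classes zech class span
  open Refute rot

  doubleOK : ℕ → Bool
  doubleOK d = zech (2 * d % 511) ≡ᵇ 2 * zech d % 511

  sumOK : List V → ℕ → Bool
  sumOK xs d = (d ≡ᵇ 0) ∨ ((zech d <ᵇ 511) ∧ eqV (e₀ ⊕ get xs d) (get xs (zech d)))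

  -- 256 halves exponents: 2 · 256 = 512 is 1 modulo 511.
  spanOK : ℕ → Bool
  spanOK t = (0 <ᵇ span t) ∧ ((span t <ᵇ 511) ∧ ((class (span t) ≡ᵇ t) ∧ ((rot t <ᵇ 85) ∧ (unrot 256 (rot t) ≡ᵇ t))))

  classOK : ℕ → Bool
  classOK d = (d ≡ᵇ 0) ∨ (canonical d ∧ (class (511 ∸ d) ≡ᵇ class d))

  classifyAll : ℕ → List (List ℕ) → ℕ → Bool
  classifyAll n rows d = everyBelow n (classify rows d)

  -- Up to translation, a block with a line of class `t` passes through 0 and `span t`, so judging
  -- the planes through these pairs suffices.
  planesOK : ℕ → ℕ → List Entry → Bool
  planesOK n m es = everyBelow m (λ t → classifyAll n (itemLists t es) (span t))

  searchRows : ℕ → List ℕ → List Row → Bool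
  searchRows M zs rows = every (rowOK M zs) rows ∧ refute levels 39 0 reps rows (groups (upFrom 84 0) rows)

  searchNumbers : ℕ → List ℕ → List Row → Bool
  searchNumbers M zs rs = searchRows M zs (evaluate M zs rs)

  indicators : ℕ → List Row → List ℕ
  indicators M rs = map (λ i → mod-helper 0 M (indicator (suc M) rs i) M) (upFrom 84 0)

  searchModulus : ℕ → List Row → Bool
  searchModulus M rs = searchNumbers M (indicators M rs) rs

  searchFrom : List Row → Bool
  searchFrom rs = searchModulus (pred (modulusOf rs)) rs

-- Tables and bounds are variables here, so that the soundness argument is checked without unfolding
-- any of the large computations.
module Certified (zech class span : ℕ → ℕ) (reps : List (List ℕ)) (n₁ n₂ : ℕ) (n₁≡511 : n₁ ≡ 511) (n₂≡85 : n₂ ≡ 85)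
  (xs : List V) (xs-ok : ∀ {k} → k < 511 → get xs k ≡ standard k)
  (double-ok : everyBelow n₁ (Checks.doubleOK zech class span reps) ≡ true)
  (sum-ok : everyBelow n₁ (Checks.sumOK zech class span reps xs) ≡ true)
  (span-ok : everyBelow n₂ (Checks.spanOK zech class span reps) ≡ true)
  (class-ok : everyBelow n₁ (Checks.classOK zech class span reps) ≡ true)
  (plane-ok : Checks.planesOK zech class span reps n₁ n₂ (Refute.entries (Classes.rot zech class span) 0 reps) ≡ true)
  (reps-ok : every (every (λ i → i <ᵇ 85)) reps ≡ true)
  where
    open Checks zech class span reps
    open Classes zech class span
    open Refute rot

    up₁ : ∀ {d} → d < 511 → d < n₁
    up₁ {d} = subst (d <_) (sym n₁≡511)

    up₂ : ∀ {t} → t < 85 → t < n₂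
    up₂ {t} = subst (t <_) (sym n₂≡85)

    zech-double : ∀ {d} → d < 511 → zech (2 * d % 511) ≡ 2 * zech d % 511
    zech-double {d} d< = ≡ᵇ-true (everyBelow⁻ {doubleOK} n₁ double-ok (up₁ d<))

    zech-sum : ∀ {d} → 0 < d → d < 511 → e₀ ⊕ standard d ≡ standard (zech d)
    zech-sum {d} d> d< = trans (cong (e₀ ⊕_) (sym (xs-ok d<)))
        (trans (eqV⁻ (e₀ ⊕ get xs d) (get xs (zech d)) (∧-true² {zech d <ᵇ 511} both)) (xs-ok (<ᵇ-true (proj₁ (∧-true {zech d <ᵇ 511} both)))))
      where
        both : ((zech d <ᵇ 511) ∧ eqV (e₀ ⊕ get xs d) (get xs (zech d))) ≡ true
        both = nonzero-case d> (everyBelow⁻ {sumOK xs} n₁ sum-ok (up₁ d<))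

    spans : ∀ {t} → t < 85 → spanOK t ≡ true
    spans t< = everyBelow⁻ {spanOK} n₂ span-ok (up₂ t<)

    span-pos : ∀ {t} → t < 85 → 0 < span t
    span-pos {t} t< = <ᵇ-true (proj₁ (∧-true {0 <ᵇ span t} (spans t<)))

    span< : ∀ {t} → t < 85 → span t < 511
    span< {t} t< = <ᵇ-true (proj₁ (∧-true {span t <ᵇ 511} (∧-true² {0 <ᵇ span t} (spans t<))))

    class-span : ∀ {t} → t < 85 → class (span t) ≡ t
    class-span {t} t< = ≡ᵇ-true (proj₁ (∧-true {class (span t) ≡ᵇ t} (∧-true² {span t <ᵇ 511} (∧-true² {0 <ᵇ span t} (spans t<)))))

    rot-pair : ∀ {t} → t < 85 → ((rot t <ᵇ 85) ∧ (unrot 256 (rot t) ≡ᵇ t)) ≡ true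
    rot-pair {t} t< = ∧-true² {class (span t) ≡ᵇ t} (∧-true² {span t <ᵇ 511} (∧-true² {0 <ᵇ span t} (spans t<)))

    classes-ok : ∀ {d} → 0 < d → d < 511 → (canonical d ∧ (class (511 ∸ d) ≡ᵇ class d)) ≡ true
    classes-ok d> d< = nonzero-case d> (everyBelow⁻ {classOK} n₁ class-ok (up₁ d<))

    classified : ∀ es → planesOK n₁ n₂ es ≡ true → ∀ {t c} → t < 85 → c < 511 → classify (itemLists t es) (span t) c ≡ true
    classified es ok {t} {c} t< c< = everyBelow⁻ {classify (itemLists t es) (span t)} n₁
      (everyBelow⁻ {λ t → classifyAll n₁ (itemLists t es) (span t)} n₂ ok (up₂ t<)) (up₁ c<)

    module C = Classes.Sound zech class span zech-double 256 (mk≈ refl) span-pos span< class-span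
      (λ {d} d> d< → proj₁ (∧-true {canonical d} (classes-ok d> d<))) (λ {d} d> d< → ≡ᵇ-true (∧-true² {canonical d} (classes-ok d> d<)))
      (λ {t} t< → ≡ᵇ-true (∧-true² {rot t <ᵇ 85} (rot-pair t<))) (λ t → itemLists t (entries 0 reps))
      (classified (entries 0 reps) plane-ok)

    open Triangle zech

    Model : ℕ → Set₁
    Model n = Σ (Fin n → ℕ → Set) Geometry

    search-sound : ∀ {n} M zs ps → Data.List.length zs ≡ 84 → searchNumbers M zs (assign ps (entries 0 reps)) ≡ true →
      Model n → ⊥
    search-sound {n} M zs ps len e = R.refute-sound
        (proj₁ (∧-true {every (rowOK M zs) R.rows} e)) levels 39 0 reps (λ m → refl) levels≢[] (λ D m o<0 → ⊥-elim (n≮0 o<0)) (∧-true² {every (rowOK M zs) R.rows} e)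
      where
        module R = Refute.Sound rot {Model n} (λ D → Solution (proj₁ D))
          (λ D → twist (proj₁ D) , Twist.frobenius zech zech-double 256 (mk≈ refl) (proj₂ D))
          (λ {D} → C.untwist (proj₂ D)) (λ {t} t< → <ᵇ-true (proj₁ (∧-true {rot t <ᵇ 85} (rot-pair t<))))
          (λ D → C.meets (proj₂ D)) reps (λ D → C.covers (proj₂ D)) (nth-bounded reps reps-ok) M zs len ps

    no-geometry : ∀ {n} ps → Checks.searchFrom zech class span reps (Refute.assign (Classes.rot zech class span) ps
        (Refute.entries (Classes.rot zech class span) 0 reps)) ≡ true → Model n → ⊥
    no-geometry ps ok = search-sound (pred (modulusOf (assign ps (entries 0 reps))))
      (indicators (pred (modulusOf (assign ps (entries 0 reps)))) (assign ps (entries 0 reps))) ps refl ok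

    no-design : ∀ ps → Checks.searchFrom zech class span reps (Refute.assign (Classes.rot zech class span) ps
        (Refute.entries (Classes.rot zech class span) 0 reps)) ≡ true → (∀ c → orderOrRoot 511 c ≡ true) →
      (n : ℕ) (B : Fin n → Triple) → Is2Analog931 n B → ¬ (Σ Matrix λ g → IsAutomorphism n B g × IsSingleCycle g)
    no-design ps ok order n B design (g , automorphism , cyclic) = from (root g cyclic 511 ≤-refl order)
      where
        from : Root g cyclic → ⊥
        from r = no-geometry ps ok (_ , Powers.geometry zech zech-sum design automorphism cyclic
          (proj₁ r) (proj₁ (proj₂ r)) (proj₁ (proj₂ (proj₂ r))) (proj₁ (proj₂ (proj₂ (proj₂ r)))) (proj₂ (proj₂ (proj₂ (proj₂ r)))))

at : List (List ℕ) → ℕ → ℕ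
at t d = Refute.nth (λ t → t) 0 (Refute.nth (λ t → t) [] t (d / 23)) (d % 23)

zech class span : ℕ → ℕ
zech  = at zechTable
class = at classTable
span  = Refute.nth (λ t → t) 0 spanTable

double-ok : everyBelow 511 (Checks.doubleOK zech class span representatives) ≡ true
double-ok = refl

sum-ok : everyBelow 511 (Checks.sumOK zech class span representatives (trajectory (times-x trinomial) 511 e₀)) ≡ true
sum-ok = refl

span-ok : everyBelow 85 (Checks.spanOK zech class span representatives) ≡ true
span-ok = refl

class-ok : everyBelow 511 (Checks.classOK zech class span representatives) ≡ true
class-ok = refl

reps-ok : every (every (λ i → i <ᵇ 85)) representatives ≡ true
reps-ok = refl

order-ok : everyVec 9 (orderOrRoot 511) ≡ true
order-ok = refl

plane-ok : Checks.planesOK zech class span representatives 511 85 (Refute.entries (Classes.rot zech class span) 0 representatives) ≡ true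
plane-ok = refl

-- The 12000 candidates from 109 on supply more primes than there are 7-sets.
search-ok : Checks.searchFrom zech class span representatives
  (Refute.assign (Classes.rot zech class span) (Refute.primes (Classes.rot zech class span) 12000 109)
    (Refute.entries (Classes.rot zech class span) 0 representatives)) ≡ true
search-ok = refl

theorem5p3 : (n : ℕ) (B : Fin n → Triple) → Is2Analog931 n B →
    ¬ (Σ Matrix λ g → IsAutomorphism n B g × IsSingleCycle g)
theorem5p3 = Certified.no-design zech class span representatives 511 85 refl refl
  (trajectory (times-x trinomial) 511 e₀) (λ {k} k< → get-trajectory (times-x trinomial) 511 e₀ k k<)
  double-ok sum-ok span-ok class-ok plane-ok reps-ok
  (Refute.primes (Classes.rot zech class span) 12000 109) search-ok (everyVec⁻ 9 {orderOrRoot 511} order-ok)
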